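{- Every planar oriented graph $G$ with $n$ vertices and $m$ arcs satisfies $\mathrm{fv}(G) \le \frac{2n + m}{9}$ and thus $\mathrm{fv}(G) \le \frac{5n-6}{9}$.
   Context: An oriented graph is a directed graph with no loops, no parallel arcs and no digons (no pair of opposite arcs between the same two vertices). It is planar if its underlying undirected graph is planar. $\mathrm{fv}(G)$ denotes the minimum number of vertices whose deletion from $G$ leaves a graph with no directed cycle.
   Formalization: The second bound fv(G) ≤ (5n−6)/9 is stated for n ≥ 2 only, since for n = 0 and n = 1 its right-hand side is negative while fv(G) = 0; the first bound is stated for every n. -}

module Defs where

open import Level using (0ℓ)
open import Data.Empty using (⊥)
open import Data.Nat as ℕ using (ℕ; zero; suc; _+_; _*_; _≤_; z≤n; s≤s)
open import Data.Fin using (Fin; zero; suc; _<?_)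
open import Data.Fin.Properties as Fin using (any?; injective⇒≤)
open import Data.Fin.Subset using (Subset; ∣_∣; _∉_; ⊤)
open import Data.Fin.Subset.Properties using (_∈?_; anySubset?; ∈⊤)
open import Data.List using (List; []; _∷_; _∷ʳ_; length; filter; allFin; cartesianProduct; lookup)
open import Data.List.Membership.Propositional.Properties using (∈-lookup)
open import Data.List.Relation.Unary.All as All using (All; []; _∷_)
open import Data.List.Relation.Unary.AllPairs using (_∷_)
open import Data.List.Relation.Unary.Linked using (Linked; linked?)
open import Data.List.Relation.Unary.Unique.Propositional using (Unique)
import Data.List.Relation.Unary.Unique.DecPropositional as UniqueDec
open import Data.Product using (_×_; _,_; ∃; proj₁; proj₂; uncurry)
open import Data.Sum using (_⊎_; inj₁; inj₂; swap; reduce)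
open import Function using (_∘_)
open import Relation.Binary using (Rel; Decidable; Symmetric; Asymmetric; Irreflexive)
open import Relation.Binary.Construct.Closure.Equivalence using (EqClosure)
open import Relation.Binary.Construct.Closure.ReflexiveTransitive using (Star)
open import Relation.Binary.PropositionalEquality using (_≡_; refl; sym; cong)
open import Relation.Nullary using (¬_; Dec; yes; no; ¬?; contradiction)
open import Relation.Nullary.Decidable using (_×-dec_; _⊎-dec_; map′)
import Relation.Unary as U

------------------------------------------------------------------------
-- Simple graphs and oriented graphs on the vertex set Fin n

record Graph (n : ℕ) : Set₁ where
  field
    Adj     : Rel (Fin n) 0ℓ
    adj?    : Decidable Adj
    adj-irr : Irreflexive _≡_ Adj
    adj-sym : Symmetric Adj

  edges : List (Fin n × Fin n)
  edges = filter (λ (u , v) → (u <? v) ×-dec adj? u v)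
                 (cartesianProduct (allFin n) (allFin n))

  isolated : List (Fin n)
  isolated = filter (λ v → ¬? (any? (adj? v))) (allFin n)

-- Arcs form a relation, so there are no parallel arcs.
record OrientedGraph (n : ℕ) : Set₁ where
  infix 4 _⟶_ _⟶?_
  field
    _⟶_       : Rel (Fin n) 0ℓ
    _⟶?_      : Decidable _⟶_
    no-loops  : Irreflexive _≡_ _⟶_
    no-digons : Asymmetric _⟶_

  arcs : List (Fin n × Fin n)
  arcs = filter (uncurry _⟶?_) (cartesianProduct (allFin n) (allFin n))

  underlying : Graph n
  underlying = record
    { Adj     = λ u v → (u ⟶ v) ⊎ (v ⟶ u)
    ; adj?    = λ u v → (u ⟶? v) ⊎-dec (v ⟶? u)
    ; adj-irr = λ { refl → no-loops refl ∘ reduce }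
    ; adj-sym = swap
    }

------------------------------------------------------------------------
-- Planarity of a graph, by combinatorial embeddings (rotation systems)

-- The equivalence relation generated by R has exactly k classes:
-- rep is a system of distinct representatives.
record ClassCount {A : Set} (R : Rel A 0ℓ) (k : ℕ) : Set where
  field
    rep      : Fin k → A
    covers   : ∀ x → ∃ λ i → EqClosure R x (rep i)
    distinct : ∀ i j → EqClosure R (rep i) (rep j) → i ≡ j

module _ {n : ℕ} (G : Graph n) where
  open Graph G

  -- An edge with a direction of traversal.  Adjacency is irrelevant here so
  -- that a dart is determined by its two ends.
  record Dart : Set where
    constructor dart
    field
      tail head : Fin n
      .adj      : Adj tail head

  -- A cyclic order on the neighbours of every vertex.  By transitivity,
  -- next v restricts to a permutation of the neighbours of v with a single
  -- cycle; its values at non-neighbours play no role.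
  record RotationSystem : Set where
    field
      next       : Fin n → Fin n → Fin n
      next-adj   : ∀ {v w} → Adj v w → Adj v (next v w)
      transitive : ∀ {v w w′} → Adj v w → Adj v w′ →
                   Star (λ x y → next v x ≡ y) w w′

    -- Walking along a face boundary: cross the edge v w, then leave w along
    -- the edge following w v in the rotation at w.
    faceStep : Dart → Dart
    faceStep (dart v w a) = dart w (next w v) (next-adj (adj-sym a))

  -- An embedding of a connected graph is in the sphere iff v - e + f = 2.
  -- In general v - e + f ≤ 2 holds for every component, so the embedding
  -- is planar iff the sum over the components is 2 * components.  Faces are
  -- counted separately in each component; a component with edges has the
  -- orbits of faceStep as its faces, and an isolated vertex has one face,
  -- which contains no dart.
  record PlanarEmbedding : Set where
    field
      rotation   : RotationSystem
      faces      : ℕ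
      components : ℕ
      face-count      : ClassCount (λ d d′ → RotationSystem.faceStep rotation d ≡ d′) faces
      component-count : ClassCount Adj components
      euler           : n + (faces + length isolated) ≡ length edges + 2 * components

Planar : ∀ {n} → OrientedGraph n → Set
Planar G = PlanarEmbedding (OrientedGraph.underlying G)

------------------------------------------------------------------------
-- Directed cycles and feedback vertex sets

module _ {n : ℕ} (G : OrientedGraph n) where
  open OrientedGraph G

  IsDirectedCycle : U.Pred (List (Fin n)) 0ℓ
  IsDirectedCycle []       = ⊥
  IsDirectedCycle (v ∷ vs) = Unique (v ∷ vs) × Linked _⟶_ (v ∷ vs ∷ʳ v)

  -- The directed cycles of G - S are those of G with no vertex in S.
  IsFeedbackVertexSet : U.Pred (Subset n) 0ℓ
  IsFeedbackVertexSet S = ¬ ∃ λ vs → IsDirectedCycle vs × All (_∉ S) vs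

  HasFVSOfSize : U.Pred ℕ 0ℓ
  HasFVSOfSize k = ∃ λ S → IsFeedbackVertexSet S × ∣ S ∣ ≡ k

private
  lookup-injective : ∀ {A : Set} {xs : List A} → Unique xs →
                     ∀ {i j} → lookup xs i ≡ lookup xs j → i ≡ j
  lookup-injective (_  ∷ _) {zero}  {zero}  _  = refl
  lookup-injective (px ∷ _) {zero}  {suc j} eq = contradiction eq (All.lookup px (∈-lookup j))
  lookup-injective (px ∷ _) {suc i} {zero}  eq = contradiction (sym eq) (All.lookup px (∈-lookup i))
  lookup-injective (_  ∷ u) {suc i} {suc j} eq = cong suc (lookup-injective u eq)

  unique⇒length≤ : ∀ {n} {xs : List (Fin n)} → Unique xs → length xs ≤ n
  unique⇒length≤ u = injective⇒≤ (lookup-injective u)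

  anyList≤? : ∀ {n} {P : U.Pred (List (Fin n)) 0ℓ} → U.Decidable P →
              ∀ b → Dec (∃ λ xs → length xs ≤ b × P xs)
  anyList≤? P? zero =
    map′ (λ p → [] , z≤n , p) (λ { ([] , _ , p) → p }) (P? [])
  anyList≤? P? (suc b) =
    map′ (λ { (inj₁ p)                  → [] , z≤n , p
            ; (inj₂ (x , xs , le , p)) → x ∷ xs , s≤s le , p })
         (λ { ([] , _ , p)              → inj₁ p
            ; (x ∷ xs , s≤s le , p)     → inj₂ (x , xs , le , p) })
         (P? [] ⊎-dec any? (λ x → anyList≤? (P? ∘ (x ∷_)) b))

  least : ∀ {P : U.Pred ℕ 0ℓ} → U.Decidable P → ∀ b → P b →
          ∃ λ k → P k × (∀ j → P j → k ≤ j)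
  least P? b Pb with P? zero
  ... | yes P0 = zero , P0 , λ _ _ → z≤n
  least P? zero    P0 | no ¬P0 = contradiction P0 ¬P0
  least P? (suc b) Pb | no ¬P0 with least (P? ∘ suc) b Pb
  ... | k , Pk , min = suc k , Pk , λ
    { zero    P0 → contradiction P0 ¬P0
    ; (suc j) Pj → s≤s (min j Pj) }

module _ {n : ℕ} (G : OrientedGraph n) where
  open OrientedGraph G

  isDirectedCycle? : U.Decidable (IsDirectedCycle G)
  isDirectedCycle? []       = no λ ()
  isDirectedCycle? (v ∷ vs) = UniqueDec.unique? Fin._≟_ (v ∷ vs) ×-dec linked? _⟶?_ (v ∷ vs ∷ʳ v)

  private
    cycle-length≤ : ∀ vs → IsDirectedCycle G vs → length vs ≤ n
    cycle-length≤ (_ ∷ _) (u , _) = unique⇒length≤ u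

    ⊤-isFVS : IsFeedbackVertexSet G ⊤
    ⊤-isFVS (_ ∷ _ , _ , v∉⊤ ∷ _) = v∉⊤ ∈⊤

  isFeedbackVertexSet? : U.Decidable (IsFeedbackVertexSet G)
  isFeedbackVertexSet? S = ¬? (map′
    (λ (vs , _ , c) → vs , c)
    (λ (vs , c) → vs , cycle-length≤ vs (proj₁ c) , c)
    (anyList≤? (λ vs → isDirectedCycle? vs ×-dec All.all? (λ v → ¬? (v ∈? S)) vs) n))

  hasFVSOfSize? : U.Decidable (HasFVSOfSize G)
  hasFVSOfSize? k = anySubset? (λ S → isFeedbackVertexSet? S ×-dec (∣ S ∣ ℕ.≟ k))

  private
    minimum : ∃ λ k → HasFVSOfSize G k × (∀ j → HasFVSOfSize G j → k ≤ j)
    minimum = least hasFVSOfSize? ∣ ⊤ {n} ∣ (⊤ , ⊤-isFVS , refl)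

  fv : ℕ
  fv = proj₁ minimum

  fv-attained : HasFVSOfSize G fv
  fv-attained = proj₁ (proj₂ minimum)

  fv-minimal : ∀ S → IsFeedbackVertexSet G S → fv ≤ ∣ S ∣
  fv-minimal S fvs = proj₂ (proj₂ minimum) ∣ S ∣ (S , fvs , refl)

{-# OPTIONS --safe #-}

-- Give a digraph with n vertices and m arcs the weight 2n + m.  By induction on
-- the weight, a digraph whose underlying graph has no K₅ minor can be made
-- acyclic by deleting at most a ninth of its weight in vertices: deleting v
-- loses 2 + deg v, sources and sinks are removed for free, and contracting the
-- only arc into (or out of) a vertex, when no digon arises, loses 3.  So a vertex
-- of degree at least 7 is deleted, and otherwise it suffices to find locally a
-- sequence of such steps that loses at least 9 for every deleted vertex.
-- This is a finite case analysis around a vertex of in-degree 1, then of degree 4,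
-- 5 and 6, given by decision trees that a checker, proved sound, evaluates.  The
-- only configuration it leaves is a K₅, in the case that all in- and out-degrees
-- are 3.
--
-- For a planar graph, merging the faces on the two sides of an edge shows that few
-- edges leave many classes of faces.  The darts of a class whose reversals lie in
-- other classes form a circulation.  Given a K₅ minor, keep ten edges between the
-- branch sets and a spanning tree of each branch set.  By Euler's formula at least
-- seven classes remain, but each class is a circulation that uses at least three
-- of the twenty darts of the ten edges, as one sees after contracting the branch
-- sets.

module Submission where

open import Defs

open import Level using (0ℓ)
open import Data.Bool as Bool using (Bool; true; false; not; _∧_; _∨_; if_then_else_; T)
open import Data.Bool.Properties using (∧-comm; ∧-zeroʳ)
open import Data.Empty using (⊥; ⊥-elim; ⊥-elim-irr)
open import Data.Fin as Fin using (Fin; zero; suc; toℕ; punchIn; punchOut)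
import Data.Fin.Properties as Fin
open import Data.List using (List; []; _∷_; _∷ʳ_; _++_; length; filter; allFin; cartesianProduct; map; concatMap; upTo)
open import Data.List.Properties using (length-++; filter-++; map-tabulate)
open import Data.List.Membership.Propositional using (_∈_)
open import Data.List.Membership.Propositional.Properties
  using (∈-map⁺; ∈-upTo⁺; ∈-concatMap⁺; ∈-filter⁺; ∈-filter⁻; ∈-cartesianProduct⁺; ∈-allFin; ∈-++⁺ˡ; ∈-++⁺ʳ)
open import Data.List.Relation.Unary.All using (All; []; _∷_)
open import Data.List.Relation.Unary.Any as Any using (here; there)
open import Data.List.Relation.Unary.Linked using (Linked; [-]; _∷_)
open import Data.Maybe using (Maybe; just; nothing; maybe)
open import Data.Maybe.Properties using (just-injective) renaming (≡-dec to maybe-≟)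
open import Data.Nat as ℕ using (ℕ; zero; suc; z≤n; s≤s)
open import Data.Nat.Induction using (<-wellFounded)
import Data.Nat.Properties as ℕ
open import Data.Nat.Tactic.RingSolver using (solve-∀)
open import Data.Product using (_×_; _,_; ∃; ∃₂; proj₁; proj₂; uncurry)
open import Data.Sum as Sum using (_⊎_; inj₁; inj₂; swap)
open import Data.Sum.Properties using (inj₁-injective; inj₂-injective)
open import Data.Unit using (tt)
open import Function using (_∘_; id)
open import Induction.WellFounded using (Acc; acc)
open import Relation.Binary using (Rel; tri<; tri≈; tri>)
open import Relation.Binary.Construct.Closure.Equivalence as Eq using (EqClosure)
open import Relation.Binary.Construct.Closure.ReflexiveTransitive as Star using (Star; ε; _◅_; _◅◅_)
open import Relation.Binary.Construct.Closure.Symmetric using (fwd; bwd)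
open import Relation.Binary.PropositionalEquality
open import Relation.Nullary using (Dec; yes; no; does; ¬_; ¬?; _×-dec_; _⊎-dec_; contradiction)
open import Relation.Unary using (Pred; Decidable)
open import Algebra.Properties.CommutativeMonoid.Sum ℕ.+-0-commutativeMonoid using (sum; sum-cong-≗; ∑-distrib-+; ∑-comm)

-- Contraction shapes the proof. It loses 3 units of weight without deleting a vertex, but it would
-- create a digon if the contracted arc lay on a directed triangle, and the bound fails for digons:
-- a single one has weight 6 and needs one deletion. So the hard configurations are those in which
-- the useful arcs lie on triangles. Contraction also dictates the class of graphs. A complete minor
-- pulls back along it by relabelling one vertex, whereas a rotation system would have to be rebuilt
-- after every step. Planarity therefore enters only at the end, to exclude K₅ and to bound m by 3n
-- - 6, which turns 2n + m into 5n - 6; small and tree-like graphs, where m ≤ n, are treated apart.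
-- Some restriction on the underlying graph is unavoidable: the Paley tournament on 7 vertices has
-- weight 35 but needs 4 deletions.

-- Digraphs, deletion and contraction, feedback vertex sets, complete minors

module Digraphs where
  open import Data.Nat using (_+_; _*_; _∸_; _≤_; _<_)
  open import Data.Nat.Properties

  variable
    n : ℕ

  ⟦_⟧ : Bool → ℕ
  ⟦ b ⟧ = if b then 1 else 0

  infix 5 _==_

  _==_ : Fin n → Fin n → Bool
  i == j = does (i Fin.≟ j)

  ==-refl : (i : Fin n) → (i == i) ≡ true
  ==-refl i with i Fin.≟ i
  ... | yes _ = refl
  ... | no ¬p = contradiction refl ¬p

  ==-≢ : {i j : Fin n} → i ≢ j → (i == j) ≡ false
  ==-≢ {i = i} {j} i≢j with i Fin.≟ j
  ... | yes p = contradiction p i≢j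
  ... | no _ = refl

  true≢false : {b : Bool} → b ≡ true → b ≡ false → ⊥
  true≢false refl ()

  ≢true : {b : Bool} → ¬ b ≡ true → b ≡ false
  ≢true {false} _ = refl
  ≢true {true} p = contradiction refl p

  ∧-true : ∀ {a b} → a ∧ b ≡ true → a ≡ true × b ≡ true
  ∧-true {true} {true} _ = refl , refl

  sum-mono : {f g : Fin n → ℕ} → (∀ i → f i ≤ g i) → sum f ≤ sum g
  sum-mono {n = zero} _ = z≤n
  sum-mono {n = suc _} p = +-mono-≤ (p zero) (sum-mono (p ∘ suc))

  sum-zero : sum {n} (λ _ → 0) ≡ 0
  sum-zero {zero} = refl
  sum-zero {suc n} = sum-zero {n}

  only : Fin n → (Fin n → ℕ) → Fin n → ℕ
  only x f u = if u == x then f u else 0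

  only-≢ : {x u : Fin n} {f : Fin n → ℕ} → u ≢ x → only x f u ≡ 0
  only-≢ u≢x rewrite ==-≢ u≢x = refl

  sum-only : (x : Fin n) (f : Fin n → ℕ) → sum (only x f) ≡ f x
  sum-only {suc n} zero f = trans (cong (f zero +_) (trans (sum-cong-≗ {n} (λ _ → refl)) (sum-zero {n}))) (+-identityʳ _)
  sum-only {suc n} (suc x) f = trans (sum-cong-≗ {n} go) (sum-only x (f ∘ suc))
    where
    go : ∀ u → only (suc x) f (suc u) ≡ only x (f ∘ suc) u
    go u with u Fin.≟ x
    ... | yes _ = refl
    ... | no _ = refl

  ≤-sum : (f : Fin n → ℕ) (x : Fin n) → f x ≤ sum f
  ≤-sum f zero = m≤m+n _ _
  ≤-sum f (suc x) = ≤-trans (≤-sum (f ∘ suc) x) (m≤n+m _ (f zero))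

  -- All digraphs of the induction share the vertex type `Fin n`; deleted and merged vertices are
  -- only marked dead. Labellings and branch sets then survive every step without reindexing.
  record Digraph (n : ℕ) : Set where
    field
      alive : Fin n → Bool
      arc   : Fin n → Fin n → Bool
      tail-alive : ∀ {u v} → arc u v ≡ true → alive u ≡ true
      head-alive : ∀ {u v} → arc u v ≡ true → alive v ≡ true
      asym  : ∀ {u v} → arc u v ≡ true → arc v u ≡ false

    irrefl : ∀ v → arc v v ≡ false
    irrefl v = ≢true λ p → true≢false p (asym p)

    indeg outdeg deg : Fin n → ℕ
    indeg v = sum (λ u → ⟦ arc u v ⟧)
    outdeg v = sum (λ w → ⟦ arc v w ⟧)
    deg v = indeg v + outdeg v

    order arcCount weight : ℕ
    order = sum (λ v → ⟦ alive v ⟧)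
    arcCount = sum outdeg
    weight = 2 * order + arcCount

    Edge : Fin n → Fin n → Set
    Edge u v = arc u v ≡ true ⊎ arc v u ≡ true

  open Digraph

  rev : Digraph n → Digraph n
  rev H = record
    { alive = alive H ; arc = λ u v → arc H v u
    ; tail-alive = head-alive H ; head-alive = tail-alive H ; asym = asym H }

  deg-rev : (H : Digraph n) (v : Fin n) → deg (rev H) v ≡ deg H v
  deg-rev H v = +-comm (indeg (rev H) v) _

  weight-rev : (H : Digraph n) → weight (rev H) ≡ weight H
  weight-rev H = cong (2 * order H +_) (∑-comm (λ u v → ⟦ arc H v u ⟧))

  module _ (H : Digraph n) (x : Fin n) where

    delete : Digraph n
    delete = record
      { alive = λ v → alive H v ∧ not (v == x)
      ; arc = λ u v → arc H u v ∧ not (u == x) ∧ not (v == x)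
      ; tail-alive = λ {u} {v} p → let q , r = ∧-true p in cong₂ _∧_ (tail-alive H q) (proj₁ (∧-true r))
      ; head-alive = λ {u} {v} p → let q , r = ∧-true p in cong₂ _∧_ (head-alive H q) (proj₂ (∧-true {not (u == x)} r))
      ; asym = λ {u} {v} p → cong (_∧ _) (asym H (proj₁ (∧-true p)))
      }

    arc-delete⁻ : ∀ {u v} → arc delete u v ≡ true → arc H u v ≡ true × u ≢ x × v ≢ x
    arc-delete⁻ {u} {v} p with u Fin.≟ x | v Fin.≟ x | ∧-true {arc H u v} p
    ... | yes _ | yes _ | _ , ()
    ... | yes _ | no _ | _ , ()
    ... | no _ | yes _ | _ , ()
    ... | no a | no b | q , _ = q , a , b

    arc-delete⁺ : ∀ {u v} → arc H u v ≡ true → u ≢ x → v ≢ x → arc delete u v ≡ true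
    arc-delete⁺ p a b rewrite p | ==-≢ a | ==-≢ b = refl

    private
      -- The two correction terms never count the same arc, as that would be a loop at `x`.
      split : ∀ u v → ⟦ arc H u v ⟧ ≡ ⟦ arc delete u v ⟧ + (only x (λ u → ⟦ arc H u v ⟧) u + only x (λ v → ⟦ arc H u v ⟧) v)
      split u v with u Fin.≟ x | v Fin.≟ x
      ... | yes refl | yes refl rewrite irrefl H x = refl
      ... | yes refl | no _ rewrite ∧-zeroʳ (arc H u v) = sym (+-identityʳ _)
      ... | no _ | yes refl rewrite ∧-zeroʳ (arc H u v) = refl
      ... | no _ | no _ with arc H u v
      ...   | true = refl
      ...   | false = refl

      alive-split : ∀ v → ⟦ alive H v ⟧ ≡ ⟦ alive delete v ⟧ + only x (λ v → ⟦ alive H v ⟧) v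
      alive-split v with v Fin.≟ x
      ... | yes refl rewrite ∧-zeroʳ (alive H v) = refl
      ... | no _ with alive H v
      ...   | true = refl
      ...   | false = refl

    indeg-delete : ∀ {a} → a ≢ x → indeg H a ≡ indeg delete a + ⟦ arc H x a ⟧
    indeg-delete {a} a≢x = begin
      indeg H a ≡⟨ sum-cong-≗ {n} go ⟩
      sum (λ u → ⟦ arc delete u a ⟧ + only x (λ u → ⟦ arc H u a ⟧) u) ≡⟨ ∑-distrib-+ {n} _ _ ⟩
      indeg delete a + sum (only x (λ u → ⟦ arc H u a ⟧)) ≡⟨ cong (indeg delete a +_) (sum-only x _) ⟩
      indeg delete a + ⟦ arc H x a ⟧ ∎
      where
      open ≡-Reasoning
      go : ∀ u → ⟦ arc H u a ⟧ ≡ ⟦ arc delete u a ⟧ + only x (λ u → ⟦ arc H u a ⟧) u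
      go u = trans (split u a) (cong (⟦ arc delete u a ⟧ +_) (trans (cong (only x (λ u → ⟦ arc H u a ⟧) u +_) (only-≢ {f = λ v → ⟦ arc H u v ⟧} a≢x)) (+-identityʳ _)))

    outdeg-delete : ∀ {a} → a ≢ x → outdeg H a ≡ outdeg delete a + ⟦ arc H a x ⟧
    outdeg-delete {a} a≢x = begin
      outdeg H a ≡⟨ sum-cong-≗ {n} go ⟩
      sum (λ v → ⟦ arc delete a v ⟧ + only x (λ v → ⟦ arc H a v ⟧) v) ≡⟨ ∑-distrib-+ {n} _ _ ⟩
      outdeg delete a + sum (only x (λ v → ⟦ arc H a v ⟧)) ≡⟨ cong (outdeg delete a +_) (sum-only x _) ⟩
      outdeg delete a + ⟦ arc H a x ⟧ ∎
      where
      open ≡-Reasoning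
      go : ∀ v → ⟦ arc H a v ⟧ ≡ ⟦ arc delete a v ⟧ + only x (λ v → ⟦ arc H a v ⟧) v
      go v = trans (split a v) (cong (λ k → ⟦ arc delete a v ⟧ + (k + only x (λ v → ⟦ arc H a v ⟧) v)) (only-≢ {f = λ u → ⟦ arc H u v ⟧} a≢x))

    private
      order-delete : alive H x ≡ true → order H ≡ order delete + 1
      order-delete ax = begin
        order H ≡⟨ sum-cong-≗ {n} alive-split ⟩
        sum (λ v → ⟦ alive delete v ⟧ + only x (λ v → ⟦ alive H v ⟧) v) ≡⟨ ∑-distrib-+ {n} _ _ ⟩
        order delete + sum (only x (λ v → ⟦ alive H v ⟧)) ≡⟨ cong (order delete +_) (trans (sum-only x _) (cong ⟦_⟧ ax)) ⟩
        order delete + 1 ∎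
        where open ≡-Reasoning

      arcCount-delete : arcCount H ≡ arcCount delete + deg H x
      arcCount-delete = begin
        sum (λ u → sum (λ v → ⟦ arc H u v ⟧))
          ≡⟨ sum-cong-≗ {n} (λ u → trans (sum-cong-≗ {n} (split u)) (trans (∑-distrib-+ {n} _ _) (cong (outdeg delete u +_) (∑-distrib-+ {n} _ _)))) ⟩
        sum (λ u → outdeg delete u + (sum (λ v → only x (λ u → ⟦ arc H u v ⟧) u) + sum (only x (λ v → ⟦ arc H u v ⟧))))
          ≡⟨ ∑-distrib-+ {n} _ _ ⟩
        arcCount delete + sum (λ u → sum (λ v → only x (λ u → ⟦ arc H u v ⟧) u) + sum (only x (λ v → ⟦ arc H u v ⟧)))
          ≡⟨ cong (arcCount delete +_) (∑-distrib-+ {n} _ _) ⟩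
        arcCount delete + (sum (λ u → sum (λ v → only x (λ u → ⟦ arc H u v ⟧) u)) + sum (λ u → sum (only x (λ v → ⟦ arc H u v ⟧))))
          ≡⟨ cong₂ (λ a b → arcCount delete + (a + b))
               (trans (∑-comm (λ u v → only x (λ u → ⟦ arc H u v ⟧) u)) (sum-cong-≗ {n} (λ v → sum-only x _)))
               (sum-cong-≗ {n} (λ u → sum-only x _)) ⟩
        arcCount delete + (outdeg H x + indeg H x) ≡⟨ cong (arcCount delete +_) (+-comm (outdeg H x) _) ⟩
        arcCount delete + deg H x ∎
        where open ≡-Reasoning

    weight-delete : alive H x ≡ true → weight H ≡ weight delete + (2 + deg H x)
    weight-delete ax = trans (cong₂ (λ a b → 2 * a + b) (order-delete ax) arcCount-delete) (lemma (order delete) _ _)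
      where
      lemma : ∀ a b d → 2 * (a + 1) + (b + d) ≡ 2 * a + b + (2 + d)
      lemma = solve-∀

    deg-delete : ∀ {a} → a ≢ x → deg H a ≡ deg delete a + (⟦ arc H x a ⟧ + ⟦ arc H a x ⟧)
    deg-delete {a} a≢x = trans (cong₂ _+_ (indeg-delete a≢x) (outdeg-delete a≢x)) (lemma (indeg delete a) _ (outdeg delete a) _)
      where
      lemma : ∀ a b c d → a + b + (c + d) ≡ a + c + (b + d)
      lemma = solve-∀

  -- Merging y into its unique in-neighbour z.  The last hypothesis says that
  -- no directed triangle passes through the arc z y, so no digon arises.
  module _ (H : Digraph n) (y z : Fin n) (zy : arc H z y ≡ true)
           (noTriangle : ∀ p → arc H y p ≡ true → arc H p z ≡ false) where

    private
      z≢y : z ≢ y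
      z≢y refl = true≢false zy (irrefl H z)

      arc′ : Fin n → Fin n → Bool
      arc′ u v = arc (delete H y) u v ∨ ((u == z) ∧ arc H y v)

      arc′⁻ : ∀ {u v} → arc′ u v ≡ true →
              (arc H u v ≡ true × u ≢ y × v ≢ y) ⊎ (u ≡ z × arc H y v ≡ true)
      arc′⁻ {u} {v} p with arc (delete H y) u v in eq | u Fin.≟ z
      ... | true | _ = inj₁ (arc-delete⁻ H y eq)
      ... | false | yes q = inj₂ (q , p)

      arc′⁺ : ∀ {u v} → arc H u v ≡ true → u ≢ y → v ≢ y → arc′ u v ≡ true
      arc′⁺ p a b rewrite arc-delete⁺ H y p a b = refl

      arc′⁺₂ : ∀ {v} → arc H y v ≡ true → arc′ z v ≡ true
      arc′⁺₂ {v} p rewrite ==-refl z | p with arc (delete H y) z v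
      ... | true = refl
      ... | false = refl

      y≢head : ∀ {v} → arc H y v ≡ true → v ≢ y
      y≢head p refl = true≢false p (irrefl H y)

      alive⁺ : ∀ {v} → alive H v ≡ true → v ≢ y → alive (delete H y) v ≡ true
      alive⁺ p q rewrite p | ==-≢ q = refl

      asym′ : ∀ {u v} → arc′ u v ≡ true → arc′ v u ≡ false
      asym′ p = ≢true λ q → go (arc′⁻ p) (arc′⁻ q)
        where
        Source : Fin n → Fin n → Set
        Source u v = (arc H u v ≡ true × u ≢ y × v ≢ y) ⊎ (u ≡ z × arc H y v ≡ true)
        go : ∀ {u v} → Source u v → Source v u → ⊥
        go {u} {v} (inj₁ (a , _)) (inj₁ (b , _)) = true≢false {arc H v u} b (asym H {u} {v} a)
        go {u} {v} (inj₁ (a , _)) (inj₂ (refl , b)) = true≢false {arc H u z} a (noTriangle u b)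
        go {u} {v} (inj₂ (refl , a)) (inj₁ (b , _)) = true≢false {arc H v z} b (noTriangle v a)
        go {u} {v} (inj₂ (refl , a)) (inj₂ (refl , b)) = true≢false {arc H y z} a (asym H zy)

    merge : Digraph n
    merge = record
      { alive = alive (delete H y)
      ; arc = arc′
      ; tail-alive = λ p → [ (λ (q , a , _) → alive⁺ (tail-alive H q) a) , (λ { (refl , _) → alive⁺ (tail-alive H zy) z≢y }) ]′ (arc′⁻ p)
      ; head-alive = λ p → [ (λ (q , _ , a) → alive⁺ (head-alive H q) a) , (λ (_ , q) → alive⁺ (head-alive H q) (y≢head q)) ]′ (arc′⁻ p)
      ; asym = asym′
      }
      where open import Data.Sum using ([_,_]′)

    arc-merge⁻ : ∀ {u v} → arc merge u v ≡ true →
              (arc H u v ≡ true × u ≢ y × v ≢ y) ⊎ (u ≡ z × arc H y v ≡ true)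
    arc-merge⁻ = arc′⁻

    arc-merge⁺ : ∀ {u v} → arc H u v ≡ true → u ≢ y → v ≢ y → arc merge u v ≡ true
    arc-merge⁺ = arc′⁺

    arc-merge⁺₂ : ∀ {v} → arc H y v ≡ true → arc merge z v ≡ true
    arc-merge⁺₂ = arc′⁺₂

    private
      arc≤ : ∀ u v → ⟦ arc merge u v ⟧ ≤ ⟦ arc (delete H y) u v ⟧ + only z (λ _ → ⟦ arc H y v ⟧) u
      arc≤ u v with arc (delete H y) u v | u Fin.≟ z
      ... | true | _ = s≤s z≤n
      ... | false | yes _ = ≤-refl
      ... | false | no _ = z≤n

      arcCount-merge : arcCount merge ≤ arcCount (delete H y) + outdeg H y
      arcCount-merge = begin
        arcCount merge ≤⟨ sum-mono (λ u → sum-mono (arc≤ u)) ⟩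
        sum (λ u → sum (λ v → ⟦ arc (delete H y) u v ⟧ + only z (λ _ → ⟦ arc H y v ⟧) u))
          ≡⟨ sum-cong-≗ {n} (λ u → ∑-distrib-+ {n} _ _) ⟩
        sum (λ u → outdeg (delete H y) u + sum (λ v → only z (λ _ → ⟦ arc H y v ⟧) u))
          ≡⟨ ∑-distrib-+ {n} _ _ ⟩
        arcCount (delete H y) + sum (λ u → sum (λ v → only z (λ _ → ⟦ arc H y v ⟧) u))
          ≡⟨ cong (arcCount (delete H y) +_) (trans (∑-comm (λ u v → only z (λ _ → ⟦ arc H y v ⟧) u)) (sum-cong-≗ {n} (λ v → sum-only z _))) ⟩
        arcCount (delete H y) + outdeg H y ∎
        where open ≤-Reasoning

    -- The vertex `y` accounts for 2 and the arc from `z` to `y` for 1. The arcs out of `y` move to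
    -- `z`, where coinciding ones only lower the weight further.
    weight-merge : weight merge + 3 ≤ weight H
    weight-merge = begin
      2 * order merge + arcCount merge + 3
        ≤⟨ +-monoˡ-≤ 3 (+-monoʳ-≤ (2 * order merge) arcCount-merge) ⟩
      2 * order merge + (arcCount (delete H y) + outdeg H y) + 3
        ≡⟨ lemma (order merge) _ _ ⟩
      weight (delete H y) + (2 + (1 + outdeg H y))
        ≤⟨ +-monoʳ-≤ (weight (delete H y)) (+-monoʳ-≤ 2 (+-monoˡ-≤ (outdeg H y) 1≤indeg)) ⟩
      weight (delete H y) + (2 + deg H y)
        ≡⟨ weight-delete H y (head-alive H zy) ⟨
      weight H ∎
      where
      open ≤-Reasoning
      1≤indeg : 1 ≤ indeg H y
      1≤indeg = subst (λ b → ⟦ b ⟧ ≤ indeg H y) zy (≤-sum (λ u → ⟦ arc H u y ⟧) z)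
      lemma : ∀ a b c → 2 * a + (b + c) + 3 ≡ 2 * a + b + (2 + (1 + c))
      lemma = solve-∀

    private
      delete≤merge : ∀ u v → ⟦ arc (delete H y) u v ⟧ ≤ ⟦ arc merge u v ⟧
      delete≤merge u v with arc (delete H y) u v
      ... | true = ≤-refl
      ... | false = z≤n

    -- At `z` only the arc to `y` disappears; arcs inherited from `y` can only raise the degree.
    deg-merge-z : deg H z ≤ deg merge z + 1
    deg-merge-z = begin
      deg H z ≡⟨ deg-delete H y z≢y ⟩
      deg (delete H y) z + (⟦ arc H y z ⟧ + ⟦ arc H z y ⟧) ≡⟨ cong₂ (λ a b → deg (delete H y) z + (⟦ a ⟧ + ⟦ b ⟧)) (asym H zy) zy ⟩
      deg (delete H y) z + 1 ≤⟨ +-monoˡ-≤ 1 (+-mono-≤ (sum-mono (λ u → delete≤merge u z)) (sum-mono (λ v → delete≤merge z v))) ⟩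
      deg merge z + 1 ∎
      where open ≤-Reasoning

    -- Away from `y` and `z`, a degree drops only where arcs from `y` and from `z` to the same head
    -- become one. Since `z` is the only in-neighbour of `y`, no arc from `a` to `y` is lost.
    deg-merge : (∀ u → arc H u y ≡ true → u ≡ z) → ∀ {a} → a ≢ y → a ≢ z →
                deg H a ≤ deg merge a + ⟦ arc H y a ∧ arc H z a ⟧
    deg-merge unique {a} a≢y a≢z = begin
      deg H a ≡⟨ deg-delete H y a≢y ⟩
      deg (delete H y) a + (⟦ arc H y a ⟧ + ⟦ arc H a y ⟧)
        ≡⟨ cong (λ b → deg (delete H y) a + (⟦ arc H y a ⟧ + ⟦ b ⟧)) (≢true (a≢z ∘ unique a)) ⟩
      indeg (delete H y) a + outdeg (delete H y) a + (⟦ arc H y a ⟧ + 0)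
        ≡⟨ cong (λ b → indeg (delete H y) a + outdeg (delete H y) a + (b + 0)) (bit (arc H y a) (arc H z a)) ⟩
      indeg (delete H y) a + outdeg (delete H y) a + (fresh + both + 0)
        ≡⟨ lemma (indeg (delete H y) a) (outdeg (delete H y) a) fresh both ⟩
      indeg (delete H y) a + fresh + outdeg (delete H y) a + both
        ≤⟨ +-monoˡ-≤ both (+-mono-≤ in≤ (sum-mono (λ v → delete≤merge a v))) ⟩
      deg merge a + both ∎
      where
      open ≤-Reasoning
      -- An arc from `y` to `a` either becomes a new arc out of `z` (`fresh`) or falls together with
      -- an old one (`both`).
      fresh both : ℕ
      fresh = ⟦ arc H y a ∧ not (arc H z a) ⟧
      both = ⟦ arc H y a ∧ arc H z a ⟧
      bit : ∀ p q → ⟦ p ⟧ ≡ ⟦ p ∧ not q ⟧ + ⟦ p ∧ q ⟧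
      bit true true = refl
      bit true false = refl
      bit false _ = refl
      lemma : ∀ i o f b → i + o + (f + b + 0) ≡ i + f + o + b
      lemma = solve-∀
      pointwise : ∀ u → ⟦ arc (delete H y) u a ⟧ + only z (λ _ → fresh) u ≤ ⟦ arc merge u a ⟧
      pointwise u with u Fin.≟ z
      pointwise u | no _ = ≤-trans (≤-reflexive (+-identityʳ _)) (≤-trans (m≤m (arc (delete H y) u a)) ≤-refl)
        where
        m≤m : ∀ b → ⟦ b ⟧ ≤ ⟦ b ∨ false ⟧
        m≤m true = ≤-refl
        m≤m false = z≤n
      pointwise u | yes refl rewrite ==-≢ z≢y | ==-≢ a≢y with arc H z a | arc H y a
      ... | true | true = ≤-refl
      ... | true | false = ≤-refl
      ... | false | true = ≤-refl
      ... | false | false = ≤-refl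
      in≤ : indeg (delete H y) a + fresh ≤ indeg merge a
      in≤ = begin
        indeg (delete H y) a + fresh ≡⟨ cong (indeg (delete H y) a +_) (sym (sum-only z (λ _ → fresh))) ⟩
        indeg (delete H y) a + sum (only z (λ _ → fresh)) ≡⟨ ∑-distrib-+ {n} _ _ ⟨
        sum (λ u → ⟦ arc (delete H y) u a ⟧ + only z (λ _ → fresh) u) ≤⟨ sum-mono pointwise ⟩
        indeg merge a ∎

  -- H has a feedback vertex set S with 9 |S| ≤ b; acyclicity of H - S is
  -- witnessed by a numbering that increases along the arcs.
  Bounded : Digraph n → ℕ → Set
  Bounded {n} H b = ∃ λ (S : Fin n → Bool) → ∃ λ (rank : Fin n → ℕ) →
    (∀ {u v} → arc H u v ≡ true → S u ≡ false → S v ≡ false → rank u < rank v) ×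
    9 * sum (λ v → ⟦ S v ⟧) ≤ b

  bounded-weaken : (H : Digraph n) {a b : ℕ} → a ≤ b → Bounded H a → Bounded H b
  bounded-weaken _ a≤b (S , r , inc , le) = S , r , inc , ≤-trans le a≤b

  -- The numbering is turned upside down; `sum r` exceeds or equals every rank, so the truncated
  -- subtraction stays strictly decreasing.
  bounded-rev : (H : Digraph n) {b : ℕ} → Bounded (rev H) b → Bounded H b
  bounded-rev H (S , r , inc , le) =
    S , (λ v → sum r ∸ r v) , (λ p su sv → ∸-monoʳ-< (inc p sv su) (≤-sum r _)) , le

  ∨-false : ∀ {a b} → a ∨ b ≡ false → a ≡ false × b ≡ false
  ∨-false {false} {false} _ = refl , refl

  ==-false : {i j : Fin n} → (i == j) ≡ false → i ≢ j
  ==-false {i = i} p refl = true≢false (==-refl i) p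

  bounded-delete : (H : Digraph n) (x : Fin n) {b : ℕ} → Bounded (delete H x) b → Bounded H (b + 9)
  bounded-delete {n} H x {b} (S , r , inc , le) = S′ , r ,
    (λ p su sv → inc (arc-delete⁺ H x p (==-false (proj₂ (∨-false {S _} su))) (==-false (proj₂ (∨-false {S _} sv))))
                     (proj₁ (∨-false su)) (proj₁ (∨-false sv))) ,
    (begin
      9 * sum (λ v → ⟦ S′ v ⟧) ≤⟨ *-monoʳ-≤ 9 (sum-mono S′≤) ⟩
      9 * sum (λ v → ⟦ S v ⟧ + only x (λ _ → 1) v) ≡⟨ cong (9 *_) (∑-distrib-+ {n} _ _) ⟩
      9 * (sum (λ v → ⟦ S v ⟧) + sum (only x (λ _ → 1))) ≡⟨ cong (λ k → 9 * (sum (λ v → ⟦ S v ⟧) + k)) (sum-only x _) ⟩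
      9 * (sum (λ v → ⟦ S v ⟧) + 1) ≡⟨ *-distribˡ-+ 9 (sum (λ v → ⟦ S v ⟧)) 1 ⟩
      9 * sum (λ v → ⟦ S v ⟧) + 9 ≤⟨ +-monoˡ-≤ 9 le ⟩
      b + 9 ∎)
    where
    open ≤-Reasoning
    S′ : Fin n → Bool
    S′ v = S v ∨ (v == x)
    S′≤ : ∀ v → ⟦ S′ v ⟧ ≤ ⟦ S v ⟧ + only x (λ _ → 1) v
    S′≤ v with S v | v == x
    ... | true | _ = s≤s z≤n
    ... | false | true = ≤-refl
    ... | false | false = ≤-refl

  drop : Fin n → (Fin n → Bool) → Fin n → Bool
  drop y S v = S v ∧ not (v == y)

  drop-≤ : (y : Fin n) (S : Fin n → Bool) → sum (λ v → ⟦ drop y S v ⟧) ≤ sum (λ v → ⟦ S v ⟧)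
  drop-≤ y S = sum-mono go
    where
    go : ∀ v → ⟦ drop y S v ⟧ ≤ ⟦ S v ⟧
    go v with S v | v == y
    ... | true | true = z≤n
    ... | true | false = ≤-refl
    ... | false | _ = z≤n

  drop-false : {y v : Fin n} {S : Fin n → Bool} → v ≢ y → drop y S v ≡ false → S v ≡ false
  drop-false {v = v} {S} v≢y p with S v
  ... | false = refl
  ... | true rewrite ==-≢ v≢y with () ← p

  bounded-source : (H : Digraph n) (y : Fin n) → (∀ u → arc H u y ≡ false) →
                   ∀ {b} → Bounded (delete H y) b → Bounded H b
  bounded-source {n} H y source (S , r , inc , le) =
    drop y S , r′ , inc′ , ≤-trans (*-monoʳ-≤ 9 (drop-≤ y S)) le
    where
    r′ : Fin n → ℕ
    r′ v = if v == y then 0 else suc (r v)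
    inc′ : ∀ {u v} → arc H u v ≡ true → drop y S u ≡ false → drop y S v ≡ false → r′ u < r′ v
    inc′ {u} {v} p su sv with u Fin.≟ y | v Fin.≟ y
    ... | _ | yes refl = ⊥-elim (true≢false p (source u))
    ... | yes refl | no _ = s≤s z≤n
    ... | no a | no b = s≤s (inc (arc-delete⁺ H y p a b) (drop-false {S = S} a su′) (drop-false {S = S} b sv′))
      where
      su′ : drop y S u ≡ false
      su′ rewrite ==-≢ a = su
      sv′ : drop y S v ≡ false
      sv′ rewrite ==-≢ b = sv

  module _ (H : Digraph n) (y z : Fin n) (zy : arc H z y ≡ true)
           (noTriangle : ∀ p → arc H y p ≡ true → arc H p z ≡ false)
           (unique : ∀ u → arc H u y ≡ true → u ≡ z) where

    private
      z≢y : z ≢ y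
      z≢y refl = true≢false zy (irrefl H z)

    -- If `z` is in the feedback vertex set, `y` has lost its only in-neighbour and may come first.
    -- Otherwise `y` is placed directly after `z`: doubling all ranks frees the odd number just
    -- above that of `z`, and every head of an arc out of `y` already lies after `z` in the merged
    -- digraph.
    bounded-merge : ∀ {b} → Bounded (merge H y z zy noTriangle) b → Bounded H b
    bounded-merge (S , r , inc , le) =
      drop y S , r′ (S z) , (λ {u} {v} → inc′ u v) , ≤-trans (*-monoʳ-≤ 9 (drop-≤ y S)) le
      where
      r′ : Bool → Fin n → ℕ
      r′ true v = if v == y then 0 else suc (r v)
      r′ false v = if v == y then 1 + 2 * r z else 2 * r v

      old : ∀ {u v} → arc H u v ≡ true → u ≢ y → v ≢ y → drop y S u ≡ false → drop y S v ≡ false → r u < r v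
      old p a b su sv = inc (arc-merge⁺ H y z zy noTriangle p a b) (drop-false {S = S} a su) (drop-false {S = S} b sv)

      odd<even : ∀ {a b} → a < b → 1 + 2 * a < 2 * b
      odd<even {a} {b} a<b = begin-strict
        1 + 2 * a <⟨ ≤-refl ⟩
        2 + 2 * a ≡⟨ *-suc 2 a ⟨
        2 * suc a ≤⟨ *-monoʳ-≤ 2 a<b ⟩
        2 * b ∎
        where open ≤-Reasoning

      into : ∀ u → arc H u y ≡ true → drop y S u ≡ false → ∀ b → S z ≡ b → r′ b u < r′ b y
      into u p su b eq with unique u p
      into u p su true eq | refl = ⊥-elim (true≢false eq (drop-false {S = S} z≢y su))
      into u p su false eq | refl rewrite ==-refl y | ==-≢ z≢y = ≤-refl

      from : ∀ v → arc H y v ≡ true → v ≢ y → S v ≡ false → ∀ b → S z ≡ b → r′ b y < r′ b v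
      from v p b sv true eq rewrite ==-refl y | ==-≢ b = s≤s z≤n
      from v p b sv false eq rewrite ==-refl y | ==-≢ b =
        odd<even (inc (arc-merge⁺₂ H y z zy noTriangle p) eq sv)

      rest : ∀ {u v} → u ≢ y → v ≢ y → r u < r v → ∀ b → r′ b u < r′ b v
      rest a b lt true rewrite ==-≢ a | ==-≢ b = s≤s lt
      rest a b lt false rewrite ==-≢ a | ==-≢ b = *-monoʳ-< 2 lt

      inc′ : ∀ u v → arc H u v ≡ true → drop y S u ≡ false → drop y S v ≡ false → r′ (S z) u < r′ (S z) v
      inc′ u v p su sv = go (v Fin.≟ y) (u Fin.≟ y)
        where
        go : Dec (v ≡ y) → Dec (u ≡ y) → r′ (S z) u < r′ (S z) v
        go (yes refl) _ = into u p su (S z) refl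
        go (no b) (yes refl) = from v p b (drop-false {S = S} b sv) (S z) refl
        go (no b) (no a) = rest a b (old p a b su sv) (S z)

  -- The branch sets are the fibres of a partial labelling; vertices sent to `nothing` belong to
  -- none. For k ≥ 2, `touching` also makes them nonempty.
  record CompleteMinor (k : ℕ) (H : Digraph n) : Set where
    field
      branch : Fin n → Maybe (Fin k)

    Within : Fin k → Fin n → Fin n → Set
    Within i u v = Edge H u v × branch u ≡ just i × branch v ≡ just i

    field
      touching  : ∀ {i j} → i ≢ j → ∃₂ λ u v → branch u ≡ just i × branch v ≡ just j × Edge H u v
      connected : ∀ {i u v} → branch u ≡ just i → branch v ≡ just i → Star (Within i) u v

  module _ {k : ℕ} where

    open CompleteMinor

    minor-mono : {H H′ : Digraph n} → (∀ {u v} → Edge H′ u v → Edge H u v) →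
                 CompleteMinor k H′ → CompleteMinor k H
    minor-mono emb M = record
      { branch = branch M
      ; touching = λ i≢j → let u , v , p , q , e = touching M i≢j in u , v , p , q , emb e
      ; connected = λ p q → Star.gmap id (λ (e , r) → emb e , r) (connected M p q)
      }

    minor-rev : {H : Digraph n} → CompleteMinor k (rev H) → CompleteMinor k H
    minor-rev {H = H} = minor-mono {H = H} {H′ = rev H} swap

    minor-delete : {H : Digraph n} {x : Fin n} → CompleteMinor k (delete H x) → CompleteMinor k H
    minor-delete {H = H} {x} = minor-mono {H = H} {H′ = delete H x} (Sum.map (proj₁ ∘ arc-delete⁻ H x) (proj₁ ∘ arc-delete⁻ H x))

    module _ (H : Digraph n) (y z : Fin n) (zy : arc H z y ≡ true)
             (noTriangle : ∀ p → arc H y p ≡ true → arc H p z ≡ false) where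

      -- The branch set of `z` absorbs `y`. An edge at `z` in the merged digraph may stem from an
      -- edge at `y`; a path using it takes a detour over the arc from `z` to `y`.
      minor-merge : CompleteMinor k (merge H y z zy noTriangle) → CompleteMinor k H
      minor-merge M = record { branch = branch′ ; touching = touching′ ; connected = connected′ }
        where
        H′ : Digraph n
        H′ = merge H y z zy noTriangle

        z≢y : z ≢ y
        z≢y refl = true≢false zy (irrefl H z)

        branch′ : Fin n → Maybe (Fin k)
        branch′ v = if v == y then branch M z else branch M v

        branch-y : branch′ y ≡ branch M z
        branch-y rewrite ==-refl y = refl

        branch-≢ : ∀ {v} → v ≢ y → branch′ v ≡ branch M v
        branch-≢ p rewrite ==-≢ p = refl

        W : Fin k → Fin n → Fin n → Set
        W i u v = Edge H u v × branch′ u ≡ just i × branch′ v ≡ just i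

        data Lift (u v : Fin n) : Set where
          direct : Edge H u v → u ≢ y → v ≢ y → Lift u v
          out    : u ≡ z → Edge H y v → v ≢ y → Lift u v
          into   : v ≡ z → Edge H u y → u ≢ y → Lift u v

        y≢head : ∀ {v} → arc H y v ≡ true → v ≢ y
        y≢head p refl = true≢false p (irrefl H y)

        lift : ∀ {u v} → Edge H′ u v → Lift u v
        lift (inj₁ p) with arc-merge⁻ H y z zy noTriangle p
        ... | inj₁ (q , a , b) = direct (inj₁ q) a b
        ... | inj₂ (r , q) = out r (inj₁ q) (y≢head q)
        lift (inj₂ p) with arc-merge⁻ H y z zy noTriangle p
        ... | inj₁ (q , a , b) = direct (inj₂ q) b a
        ... | inj₂ (r , q) = into r (inj₂ q) (y≢head q)

        touching′ : ∀ {i j} → i ≢ j → ∃₂ λ u v → branch′ u ≡ just i × branch′ v ≡ just j × Edge H u v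
        touching′ i≢j with touching M i≢j
        ... | u , v , p , q , e with lift e
        ...   | direct e′ a b = u , v , trans (branch-≢ a) p , trans (branch-≢ b) q , e′
        ...   | out refl e′ b = y , v , trans branch-y p , trans (branch-≢ b) q , e′
        ...   | into refl e′ a = u , y , trans (branch-≢ a) p , trans branch-y q , e′

        step : ∀ {i u v} → Within M i u v → Star (W i) u v
        step (e , p , q) with lift e
        ... | direct e′ a b = (e′ , trans (branch-≢ a) p , trans (branch-≢ b) q) ◅ ε
        ... | out refl e′ b = (inj₁ zy , trans (branch-≢ z≢y) p , trans branch-y p) ◅ (e′ , trans branch-y p , trans (branch-≢ b) q) ◅ ε
        ... | into refl e′ a = (e′ , trans (branch-≢ a) p , trans branch-y q) ◅ (inj₂ zy , trans branch-y q , trans (branch-≢ z≢y) q) ◅ ε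

        path : ∀ {i u v} → branch M u ≡ just i → branch M v ≡ just i → Star (W i) u v
        path p q = Star.concat (Star.gmap id step (connected M p q))

        connected′ : ∀ {i u v} → branch′ u ≡ just i → branch′ v ≡ just i → Star (W i) u v
        connected′ {i} {u} {v} p q = go (u Fin.≟ y) (v Fin.≟ y)
          where
          go : Dec (u ≡ y) → Dec (v ≡ y) → Star (W i) u v
          go (yes refl) (yes refl) = ε
          go (yes refl) (no b) = (inj₂ zy , p , trans (branch-≢ z≢y) (trans (sym branch-y) p)) ◅ path (trans (sym branch-y) p) (trans (sym (branch-≢ b)) q)
          go (no a) (yes refl) = path (trans (sym (branch-≢ a)) p) (trans (sym branch-y) q) ◅◅ (inj₁ zy , trans (branch-≢ z≢y) (trans (sym branch-y) q) , q) ◅ ε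
          go (no a) (no b) = path (trans (sym (branch-≢ a)) p) (trans (sym (branch-≢ b)) q)

open Digraphs

-- Reduction sequences and their soundness

module Certificates where
  open import Data.Nat using (_+_; _*_; _∸_; _⊔_; _≤_; _<_; _≡ᵇ_; _<ᵇ_; _≤ᵇ_; _≟_)
  open import Data.Nat.Properties
  open Digraph

  ≡ᵇ-true : ∀ a b → (a ≡ᵇ b) ≡ true → a ≡ b
  ≡ᵇ-true a b p = ≡ᵇ⇒≡ a b (subst T (sym p) tt)

  ≡ᵇ-refl : ∀ a → (a ≡ᵇ a) ≡ true
  ≡ᵇ-refl zero = refl
  ≡ᵇ-refl (suc a) = ≡ᵇ-refl a

  ≡ᵇ-false : ∀ {a b} → (a ≡ᵇ b) ≡ false → a ≢ b
  ≡ᵇ-false {a} p refl = true≢false (≡ᵇ-refl a) p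

  ≢⇒≡ᵇ : ∀ {a b} → a ≢ b → (a ≡ᵇ b) ≡ false
  ≢⇒≡ᵇ {a} {b} p = ≢true (λ q → p (≡ᵇ-true a b q))

  <ᵇ-true : ∀ a b → (a <ᵇ b) ≡ true → a < b
  <ᵇ-true a b p = <ᵇ⇒< a b (subst T (sym p) tt)

  ≤ᵇ-true : ∀ a b → (a ≤ᵇ b) ≡ true → a ≤ b
  ≤ᵇ-true a b p = ≤ᵇ⇒≤ a b (subst T (sym p) tt)

  ∨-true : ∀ {a b} → a ∨ b ≡ true → a ≡ true ⊎ b ≡ true
  ∨-true {true} _ = inj₁ refl
  ∨-true {false} p = inj₂ p

  not-true : ∀ {a} → not a ≡ true → a ≡ false
  not-true {false} _ = refl

  all any : ℕ → (ℕ → Bool) → Bool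
  all zero p = true
  all (suc k) p = p k ∧ all k p
  any zero p = false
  any (suc k) p = p k ∨ any k p

  all-sound : ∀ k p → all k p ≡ true → ∀ {a} → a < k → p a ≡ true
  all-sound (suc k) p q {a} a<k with m≤n⇒m<n∨m≡n (≤-pred a<k)
  ... | inj₁ lt = all-sound k p (proj₂ (∧-true {p k} q)) lt
  ... | inj₂ refl = proj₁ (∧-true q)

  any-sound : ∀ k p → any k p ≡ true → ∃ λ a → a < k × p a ≡ true
  any-sound (suc k) p q with ∨-true {p k} q
  ... | inj₁ r = k , ≤-refl , r
  ... | inj₂ r = let a , lt , s = any-sound k p r in a , m≤n⇒m≤1+n lt , s

  lower : ∀ {l d} d′ k j → l ≤ d → d ≤ d′ + k → k ≤ j → l ∸ j ≤ d′
  lower {l} {d} d′ k j p q r = begin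
    l ∸ j ≤⟨ ∸-monoˡ-≤ j (≤-trans p q) ⟩
    (d′ + k) ∸ j ≤⟨ ∸-monoʳ-≤ (d′ + k) r ⟩
    (d′ + k) ∸ k ≡⟨ m+n∸n≡m d′ k ⟩
    d′ ∎
    where open ≤-Reasoning

  data Status : Set where
    present absent unknown : Status

  isPresent isAbsent : Status → Bool
  isPresent present = true
  isPresent _ = false
  isAbsent absent = true
  isAbsent _ = false

  present-sound : ∀ s → isPresent s ≡ true → s ≡ present
  present-sound present _ = refl

  absent-sound : ∀ s → isAbsent s ≡ true → s ≡ absent
  absent-sound absent _ = refl

  either : Status → Status → Status
  either present _ = present
  either _ present = present
  either absent absent = absent
  either _ _ = unknown

  -- What is known about some labelled vertices of a digraph; `low` bounds
  -- their degrees from below, and a label is in-closed if all the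
  -- in-neighbours of its vertex are labelled.
  record View : Set where
    field
      live : ℕ → Bool
      know : ℕ → ℕ → Status
      inClosed outClosed : ℕ → Bool
      low : ℕ → ℕ

  open View

  flip : View → View
  flip V = record
    { live = live V ; know = λ a b → know V b a
    ; inClosed = outClosed V ; outClosed = inClosed V ; low = low V }

  -- Without digons, a neighbour of `x` loses exactly one arc. Closed neighbourhoods stay closed,
  -- because `x` itself is all that disappears from them.
  forget : ℕ → View → View
  forget x V = record
    { live = λ a → live V a ∧ not (a ≡ᵇ x)
    ; know = know V ; inClosed = inClosed V ; outClosed = outClosed V
    ; low = λ a → low V a ∸ (if isAbsent (know V a x) ∧ isAbsent (know V x a) then 0 else 1) }

  -- Arcs change only in the row of `z`, which takes over the arcs out of `y`. In-neighbourhoods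
  -- stay labelled, since at most the label `z` joins them, whereas the out-neighbourhood of `z` now
  -- includes that of `y`.
  mergeView : ℕ → ℕ → View → View
  mergeView y z V = record
    { live = λ a → live V a ∧ not (a ≡ᵇ y)
    ; know = λ a b → if a ≡ᵇ z then either (know V z b) (know V y b) else know V a b
    ; inClosed = inClosed V
    ; outClosed = λ a → if a ≡ᵇ z then outClosed V z ∧ outClosed V y else outClosed V a
    ; low = λ a → if a ≡ᵇ z then low V a ∸ 1
                  else low V a ∸ (if isAbsent (know V y a) ∨ isAbsent (know V z a) then 0 else 1) }

  data Op : Set where
    cut source sink : ℕ → Op
    mergeIn mergeOut : ℕ → ℕ → Op

  -- The labels are the numbers below k.
  module _ (k : ℕ) where

    sourceOk : View → ℕ → Bool
    sourceOk V y = live V y ∧ inClosed V y ∧ all k (λ b → not (live V b) ∨ isAbsent (know V b y))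

    -- After the liveness tests: `z` is the only in-neighbour of `y`, the third vertex of a triangle
    -- through both would be labelled, and no labelled vertex is one. For the middle condition
    -- either flag suffices, as such a vertex is an out-neighbour of `y` and an in-neighbour of `z`.
    mergeOk : View → ℕ → ℕ → Bool
    mergeOk V y z = live V y ∧ live V z ∧ isPresent (know V z y) ∧ inClosed V y ∧
      all k (λ b → not (live V b) ∨ (b ≡ᵇ z) ∨ isAbsent (know V b y)) ∧
      (outClosed V y ∨ inClosed V z) ∧
      all k (λ p → not (live V p) ∨ isAbsent (know V y p) ∨ isAbsent (know V p z))

    -- The weight lost so far is at least c, and d is nine times the number of
    -- vertices put into the feedback vertex set.
    run : View → List Op → ℕ → ℕ → Bool
    run V [] c d = (0 <ᵇ c) ∧ (d ≤ᵇ c)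
    run V (cut x ∷ ops) c d = live V x ∧ run (forget x V) ops (c + (2 + low V x)) (d + 9)
    run V (source y ∷ ops) c d = sourceOk V y ∧ run (forget y V) ops (c + (2 + low V y)) d
    run V (sink y ∷ ops) c d = sourceOk (flip V) y ∧ run (forget y V) ops (c + (2 + low V y)) d
    run V (mergeIn y z ∷ ops) c d = mergeOk V y z ∧ run (mergeView y z V) ops (c + 3) d
    run V (mergeOut y z ∷ ops) c d = mergeOk (flip V) y z ∧ run (flip (mergeView y z (flip V))) ops (c + 3) d

    module _ {n : ℕ} (ρ : ℕ → Fin n) (ρ-injective : ∀ {a b} → a < k → b < k → ρ a ≡ ρ b → a ≡ b) where

      -- The invariant of a run. It constrains live labels only, because a view keeps stale entries
      -- for labels that have been removed.
      record Sees (H : Digraph n) (V : View) : Set where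
        field
          live-<   : ∀ {a} → live V a ≡ true → a < k
          live-ok  : ∀ {a} → live V a ≡ true → alive H (ρ a) ≡ true
          present-ok : ∀ {a b} → live V a ≡ true → live V b ≡ true → know V a b ≡ present → arc H (ρ a) (ρ b) ≡ true
          absent-ok  : ∀ {a b} → live V a ≡ true → live V b ≡ true → know V a b ≡ absent → arc H (ρ a) (ρ b) ≡ false
          in-ok  : ∀ {a} → live V a ≡ true → inClosed V a ≡ true → ∀ u → arc H u (ρ a) ≡ true → ∃ λ b → live V b ≡ true × u ≡ ρ b
          out-ok : ∀ {a} → live V a ≡ true → outClosed V a ≡ true → ∀ u → arc H (ρ a) u ≡ true → ∃ λ b → live V b ≡ true × u ≡ ρ b
          low-ok : ∀ {a} → live V a ≡ true → low V a ≤ deg H (ρ a)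

      open Sees

      sees-flip : ∀ {H V} → Sees H V → Sees (rev H) (flip V)
      sees-flip {H} s = record
        { live-< = live-< s ; live-ok = live-ok s
        ; present-ok = λ a b → present-ok s b a ; absent-ok = λ a b → absent-ok s b a
        ; in-ok = out-ok s ; out-ok = in-ok s
        ; low-ok = λ a → ≤-trans (low-ok s a) (≤-reflexive (sym (deg-rev H _))) }

      private
        live-forget : ∀ {V x a} → live (forget x V) a ≡ true → live V a ≡ true × a ≢ x
        live-forget {a = a} p = let q , r = ∧-true p in q , ≡ᵇ-false (not-true r)

        live-forget⁺ : ∀ {V x a} → live V a ≡ true → a ≢ x → live (forget x V) a ≡ true
        live-forget⁺ {a = a} p q rewrite p | ≢⇒≡ᵇ q = refl

      module _ {H : Digraph n} {V : View} (s : Sees H V) where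

        private
          ρ≢ : ∀ {a b} → live V a ≡ true → live V b ≡ true → a ≢ b → ρ a ≢ ρ b
          ρ≢ p q a≢b eq = a≢b (ρ-injective (live-< s p) (live-< s q) eq)

        sees-delete : ∀ {x} → live V x ≡ true → Sees (delete H (ρ x)) (forget x V)
        sees-delete {x} lx = record
          { live-< = λ p → live-< s (proj₁ (live-forget {V} p))
          ; live-ok = λ p → let q , r = live-forget {V} p in alive-≢ (live-ok s q) (ρ≢ q lx r)
          ; present-ok = λ p p′ e → let q , r = live-forget {V} p ; q′ , r′ = live-forget {V} p′ in
              arc-delete⁺ H (ρ x) (present-ok s q q′ e) (ρ≢ q lx r) (ρ≢ q′ lx r′)
          ; absent-ok = λ {a} {b} p p′ e → cong (_∧ (not (ρ a == ρ x) ∧ not (ρ b == ρ x)))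
              (absent-ok s (proj₁ (live-forget {V} p)) (proj₁ (live-forget {V} p′)) e)
          ; in-ok = λ p c u e → let e′ , u≢ , _ = arc-delete⁻ H (ρ x) e
                                    b , lb , eq = in-ok s (proj₁ (live-forget {V} p)) c u e′
                                in b , live-forget⁺ {V} lb (λ q → u≢ (trans eq (cong ρ q))) , eq
          ; out-ok = λ p c u e → let e′ , _ , u≢ = arc-delete⁻ H (ρ x) e
                                     b , lb , eq = out-ok s (proj₁ (live-forget {V} p)) c u e′
                                 in b , live-forget⁺ {V} lb (λ q → u≢ (trans eq (cong ρ q))) , eq
          ; low-ok = λ p → let q , r = live-forget {V} p in low′ q r
          }
          where
          alive-≢ : ∀ {v} → alive H v ≡ true → v ≢ ρ x → alive (delete H (ρ x)) v ≡ true
          alive-≢ p q rewrite p | ==-≢ q = refl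
          low′ : ∀ {a} → live V a ≡ true → a ≢ x → low (forget x V) a ≤ deg (delete H (ρ x)) (ρ a)
          low′ {a} la a≢x = lower (deg (delete H (ρ x)) (ρ a)) (⟦ arc H (ρ x) (ρ a) ⟧ + ⟦ arc H (ρ a) (ρ x) ⟧)
              (if isAbsent (know V a x) ∧ isAbsent (know V x a) then 0 else 1)
              (low-ok s la) (≤-reflexive (deg-delete H (ρ x) (ρ≢ la lx a≢x))) bits
            where
            bits : ⟦ arc H (ρ x) (ρ a) ⟧ + ⟦ arc H (ρ a) (ρ x) ⟧ ≤ (if isAbsent (know V a x) ∧ isAbsent (know V x a) then 0 else 1)
            bits with isAbsent (know V a x) in e₁ | isAbsent (know V x a) in e₂
            ... | true | true rewrite absent-ok s la lx (absent-sound _ e₁) | absent-ok s lx la (absent-sound _ e₂) = z≤n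
            ... | true | false rewrite absent-ok s la lx (absent-sound _ e₁) = ≤1 (arc H (ρ x) (ρ a))
              where
              ≤1 : ∀ b → ⟦ b ⟧ + 0 ≤ 1
              ≤1 true = ≤-refl
              ≤1 false = z≤n
            ... | false | _ with arc H (ρ x) (ρ a) in e
            ...   | true rewrite asym H e = ≤-refl
            ...   | false with arc H (ρ a) (ρ x)
            ...     | true = ≤-refl
            ...     | false = z≤n

        weight-cut : ∀ {x} → live V x ≡ true → weight (delete H (ρ x)) + (2 + low V x) ≤ weight H
        weight-cut {x} lx = ≤-trans (+-monoʳ-≤ (weight (delete H (ρ x))) (+-monoʳ-≤ 2 (low-ok s lx)))
          (≤-reflexive (sym (weight-delete H (ρ x) (live-ok s lx))))

        sourceOk-sound : ∀ y → sourceOk V y ≡ true → live V y ≡ true × (∀ u → arc H u (ρ y) ≡ false)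
        sourceOk-sound y ok with ly , ok₁ ← ∧-true {live V y} ok
                               with cy , ok₂ ← ∧-true {inClosed V y} ok₁ = ly , λ u → ≢true (none u)
          where
          none : ∀ u → ¬ arc H u (ρ y) ≡ true
          none u e with in-ok s ly cy u e
          ... | b , lb , refl with ∨-true (all-sound k _ ok₂ (live-< s lb))
          ...   | inj₁ p = true≢false lb (not-true p)
          ...   | inj₂ p = true≢false e (absent-ok s lb ly (absent-sound _ p))

        module _ {y z : ℕ} (ok : mergeOk V y z ≡ true) where

          private
            o₁ = ∧-true {live V y} ok
            o₂ = ∧-true {live V z} (proj₂ o₁)
            o₃ = ∧-true {isPresent (know V z y)} (proj₂ o₂)
            o₄ = ∧-true {inClosed V y} (proj₂ o₃)
            o₅ = ∧-true {all k _} (proj₂ o₄)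
            o₆ = ∧-true {outClosed V y ∨ inClosed V z} (proj₂ o₅)
            ly : live V y ≡ true
            ly = proj₁ o₁
            lz : live V z ≡ true
            lz = proj₁ o₂

          mergeArc : arc H (ρ z) (ρ y) ≡ true
          mergeArc = present-ok s lz ly (present-sound _ (proj₁ o₃))

          private
            y≢z : y ≢ z
            y≢z refl = true≢false mergeArc (irrefl H (ρ z))

          mergeUnique : ∀ u → arc H u (ρ y) ≡ true → u ≡ ρ z
          mergeUnique u e with in-ok s ly (proj₁ o₄) u e
          ... | b , lb , refl with ∨-true {not (live V b)} (all-sound k _ (proj₁ o₅) (live-< s lb))
          ...   | inj₁ p = ⊥-elim (true≢false lb (not-true p))
          ...   | inj₂ p with ∨-true {b ≡ᵇ z} p
          ...     | inj₁ q = cong ρ (≡ᵇ-true b z q)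
          ...     | inj₂ q = ⊥-elim (true≢false e (absent-ok s lb ly (absent-sound _ q)))

          mergeNoTriangle : ∀ p → arc H (ρ y) p ≡ true → arc H p (ρ z) ≡ false
          mergeNoTriangle p e = ≢true λ e′ → label e′ (closed e′)
            where
            closed : arc H p (ρ z) ≡ true → ∃ λ b → live V b ≡ true × p ≡ ρ b
            closed e′ with ∨-true {outClosed V y} (proj₁ o₆)
            ... | inj₁ c = out-ok s ly c p e
            ... | inj₂ c = in-ok s lz c p e′
            label : arc H p (ρ z) ≡ true → (∃ λ b → live V b ≡ true × p ≡ ρ b) → ⊥
            label e′ (b , lb , refl) with ∨-true {not (live V b)} (all-sound k _ (proj₂ o₆) (live-< s lb))
            ... | inj₁ q = true≢false lb (not-true q)
            ... | inj₂ q with ∨-true {isAbsent (know V y b)} q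
            ...   | inj₁ r = true≢false e (absent-ok s ly lb (absent-sound _ r))
            ...   | inj₂ r = true≢false e′ (absent-ok s lb lz (absent-sound _ r))

          merged : Digraph n
          merged = merge H (ρ y) (ρ z) mergeArc mergeNoTriangle

          private
            arc⁺ : ∀ {u v} → arc H u v ≡ true → u ≢ ρ y → v ≢ ρ y → arc merged u v ≡ true
            arc⁺ = arc-merge⁺ H (ρ y) (ρ z) mergeArc mergeNoTriangle

            arc⁻ : ∀ {u v} → arc merged u v ≡ true → (arc H u v ≡ true × u ≢ ρ y × v ≢ ρ y) ⊎ (u ≡ ρ z × arc H (ρ y) v ≡ true)
            arc⁻ = arc-merge⁻ H (ρ y) (ρ z) mergeArc mergeNoTriangle

            L : View
            L = mergeView y z V

            alive-≢ : ∀ {v} → alive H v ≡ true → v ≢ ρ y → alive merged v ≡ true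
            alive-≢ p q rewrite p | ==-≢ q = refl

            either-present : ∀ s t → either s t ≡ present → s ≡ present ⊎ t ≡ present
            either-present present _ _ = inj₁ refl
            either-present absent present _ = inj₂ refl
            either-present unknown present _ = inj₂ refl

            either-absent : ∀ s t → either s t ≡ absent → s ≡ absent × t ≡ absent
            either-absent absent absent _ = refl , refl
            either-absent present _ ()
            either-absent absent present ()
            either-absent absent unknown ()
            either-absent unknown present ()
            either-absent unknown absent ()
            either-absent unknown unknown ()

            present′ : ∀ {a b} → live V a ≡ true → a ≢ y → live V b ≡ true → b ≢ y → know L a b ≡ present → arc merged (ρ a) (ρ b) ≡ true
            present′ {a} {b} la a≢ lb b≢ e with a ≡ᵇ z in az
            ... | false = arc⁺ (present-ok s la lb e) (ρ≢ la ly a≢) (ρ≢ lb ly b≢)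
            ... | true with refl ← ≡ᵇ-true a z az with either-present (know V z b) _ e
            ...   | inj₁ q = arc⁺ (present-ok s la lb q) (ρ≢ la ly a≢) (ρ≢ lb ly b≢)
            ...   | inj₂ q = arc-merge⁺₂ H (ρ y) (ρ z) mergeArc mergeNoTriangle (present-ok s ly lb q)

            absent′ : ∀ {a b} → live V a ≡ true → live V b ≡ true → know L a b ≡ absent → arc merged (ρ a) (ρ b) ≡ false
            absent′ {a} {b} la lb e = ≢true (go (a ≡ᵇ z) refl e)
              where
              go : ∀ c → (a ≡ᵇ z) ≡ c → (if c then either (know V z b) (know V y b) else know V a b) ≡ absent → ¬ arc merged (ρ a) (ρ b) ≡ true
              go false az e p with arc⁻ p
              ... | inj₁ (q , _) = true≢false q (absent-ok s la lb e)
              ... | inj₂ (q , _) = ≡ᵇ-false {a} {z} az (ρ-injective (live-< s la) (live-< s lz) q)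
              go true az e p with refl ← ≡ᵇ-true a z az with ez , ey ← either-absent (know V z b) _ e with arc⁻ p
              ... | inj₁ (q , _) = true≢false q (absent-ok s la lb ez)
              ... | inj₂ (_ , q) = true≢false q (absent-ok s ly lb ey)

            in′ : ∀ {a} → live V a ≡ true → inClosed V a ≡ true → ∀ u → arc merged u (ρ a) ≡ true → ∃ λ b → live L b ≡ true × u ≡ ρ b
            in′ la c u e with arc⁻ e
            ... | inj₁ (q , u≢ , _) = let b , lb , eq = in-ok s la c u q in b , live-forget⁺ {V} lb (λ q → u≢ (trans eq (cong ρ q))) , eq
            ... | inj₂ (refl , _) = z , live-forget⁺ {V} lz (λ eq → y≢z (sym eq)) , refl

            out′ : ∀ {a} → live V a ≡ true → outClosed L a ≡ true → ∀ u → arc merged (ρ a) u ≡ true → ∃ λ b → live L b ≡ true × u ≡ ρ b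
            out′ {a} la c u e with a ≡ᵇ z in az
            out′ {a} la c u e | false with arc⁻ e
            ... | inj₁ (q , _ , u≢) = let b , lb , eq = out-ok s la c u q in b , live-forget⁺ {V} lb (λ q → u≢ (trans eq (cong ρ q))) , eq
            ... | inj₂ (q , _) = ⊥-elim (≡ᵇ-false {a} {z} az (ρ-injective (live-< s la) (live-< s lz) q))
            out′ {a} la c u e | true with refl ← ≡ᵇ-true a z az with cz , cy ← ∧-true {outClosed V z} c with arc⁻ e
            ... | inj₁ (q , _ , u≢) = let b , lb , eq = out-ok s la cz u q in b , live-forget⁺ {V} lb (λ q → u≢ (trans eq (cong ρ q))) , eq
            ... | inj₂ (_ , q) = let b , lb , eq = out-ok s ly cy u q in
                  b , live-forget⁺ {V} lb (λ r → true≢false (subst (λ w → arc H (ρ y) w ≡ true) (trans eq (cong ρ r)) q) (irrefl H (ρ y))) , eq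

            low′ : ∀ {a} → live V a ≡ true → a ≢ y → low L a ≤ deg merged (ρ a)
            low′ {a} la a≢y with a ≡ᵇ z in az
            ... | true with refl ← ≡ᵇ-true a z az =
                  lower (deg merged (ρ z)) 1 1 (low-ok s la) (deg-merge-z H (ρ y) (ρ z) mergeArc mergeNoTriangle) ≤-refl
            ... | false = lower (deg merged (ρ a)) both (if isAbsent (know V y a) ∨ isAbsent (know V z a) then 0 else 1) (low-ok s la)
                    (deg-merge H (ρ y) (ρ z) mergeArc mergeNoTriangle mergeUnique (ρ≢ la ly a≢y) (ρ≢ la lz (≡ᵇ-false {a} {z} az))) bits
              where
              both : ℕ
              both = ⟦ arc H (ρ y) (ρ a) ∧ arc H (ρ z) (ρ a) ⟧
              bits : both ≤ (if isAbsent (know V y a) ∨ isAbsent (know V z a) then 0 else 1)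
              bits with isAbsent (know V y a) in e₁ | isAbsent (know V z a) in e₂
              ... | true | _ rewrite absent-ok s ly la (absent-sound _ e₁) = z≤n
              ... | false | true rewrite absent-ok s lz la (absent-sound _ e₂) with arc H (ρ y) (ρ a)
              ...   | true = z≤n
              ...   | false = z≤n
              bits | false | false with arc H (ρ y) (ρ a) ∧ arc H (ρ z) (ρ a)
              ... | true = ≤-refl
              ... | false = z≤n

          sees-merge : Sees merged L
          sees-merge = record
            { live-< = λ p → live-< s (proj₁ (live-forget {V} p))
            ; live-ok = λ p → let q , r = live-forget {V} p in alive-≢ (live-ok s q) (ρ≢ q ly r)
            ; present-ok = λ p p′ → let q , r = live-forget {V} p ; q′ , r′ = live-forget {V} p′ in present′ q r q′ r′
            ; absent-ok = λ p p′ → absent′ (proj₁ (live-forget {V} p)) (proj₁ (live-forget {V} p′))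
            ; in-ok = λ p → in′ (proj₁ (live-forget {V} p))
            ; out-ok = λ p → out′ (proj₁ (live-forget {V} p))
            ; low-ok = λ p → let q , r = live-forget {V} p in low′ q r
            }

      module _ {W m : ℕ} (ih : ∀ (H : Digraph n) → weight H < W → ¬ CompleteMinor m H → Bounded H (weight H)) where

        -- `W` is the weight at the outset. The hypothesis on weights says that at least `c` of it
        -- has been used up, and the conclusion leaves room for the amount `d` owed for the vertices
        -- deleted so far.
        run-sound : ∀ ops {H V} c d → run V ops c d ≡ true → Sees H V → ¬ CompleteMinor m H →
                    weight H + c ≤ W → ∃ λ b → b + d ≤ W × Bounded H b
        -- The test `0 <ᵇ c` makes the remaining weight strictly smaller than `W`, as the induction
        -- hypothesis requires; `d ≤ᵇ c` pays for the deletions.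
        run-sound [] {H} c d ok s free le with pos , d≤c ← ∧-true {0 <ᵇ c} ok =
          weight H , ≤-trans (+-monoʳ-≤ (weight H) (≤ᵇ-true d c d≤c)) le ,
          ih H (<-≤-trans (m<m+n (weight H) (<ᵇ-true 0 c pos)) le) free
        run-sound (cut x ∷ ops) {H} {V} c d ok s free le with lx , ok′ ← ∧-true {live V x} ok =
          let b , b≤ , B = run-sound ops (c + (2 + low V x)) (d + 9) ok′ (sees-delete s lx) (λ M → free (minor-delete {H = H} M))
                             (≤-trans (≤-reflexive (shift (weight (delete H (ρ x))) c _)) (≤-trans (+-monoˡ-≤ c (weight-cut s lx)) le))
          in b + 9 , ≤-trans (≤-reflexive (shift′ b d)) b≤ , bounded-delete H (ρ x) B
          where
          shift : ∀ a b c → a + (b + c) ≡ a + c + b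
          shift = solve-∀
          shift′ : ∀ b d → b + 9 + d ≡ b + (d + 9)
          shift′ = solve-∀
        run-sound (source y ∷ ops) {H} {V} c d ok s free le with oy , ok′ ← ∧-true {sourceOk V y} ok
                                                           with ly , none ← sourceOk-sound s y oy =
          let b , b≤ , B = run-sound ops (c + (2 + low V y)) d ok′ (sees-delete s ly) (λ M → free (minor-delete {H = H} M))
                             (≤-trans (≤-reflexive (shift (weight (delete H (ρ y))) c _)) (≤-trans (+-monoˡ-≤ c (weight-cut s ly)) le))
          in b , b≤ , bounded-source H (ρ y) none B
          where
          shift : ∀ a b c → a + (b + c) ≡ a + c + b
          shift = solve-∀
        run-sound (sink y ∷ ops) {H} {V} c d ok s free le with oy , ok′ ← ∧-true {sourceOk (flip V) y} ok
                                                         with ly , none ← sourceOk-sound (sees-flip s) y oy =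
          let b , b≤ , B = run-sound ops (c + (2 + low V y)) d ok′ (sees-delete s ly) (λ M → free (minor-delete {H = H} M))
                             (≤-trans (≤-reflexive (shift (weight (delete H (ρ y))) c _)) (≤-trans (+-monoˡ-≤ c (weight-cut s ly)) le))
          in b , b≤ , bounded-rev H (bounded-source (rev H) (ρ y) none (bounded-rev-delete B))
          where
          shift : ∀ a b c → a + (b + c) ≡ a + c + b
          shift = solve-∀
          -- Reversal and deletion commute only up to the order of two conjuncts in the arc
          -- relation, so arcs are transported one at a time.
          bounded-rev-delete : ∀ {b} → Bounded (delete H (ρ y)) b → Bounded (delete (rev H) (ρ y)) b
          bounded-rev-delete (S , r , inc , le) = bounded-rev (delete (rev H) (ρ y))
            (S , r , (λ {u} {v} p → inc (let q , a , b = arc-delete⁻ (rev H) (ρ y) p in arc-delete⁺ H (ρ y) q b a)) , le)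
        run-sound (mergeIn y z ∷ ops) {H} {V} c d ok s free le with o , ok′ ← ∧-true {mergeOk V y z} ok =
          let b , b≤ , B = run-sound ops (c + 3) d ok′ (sees-merge s o)
                             (λ M → free (minor-merge H (ρ y) (ρ z) (mergeArc s o) (mergeNoTriangle s o) M))
                             (≤-trans (≤-reflexive (shift (weight (merged s o)) c)) (≤-trans (+-monoˡ-≤ c (weight-merge H (ρ y) (ρ z) (mergeArc s o) (mergeNoTriangle s o))) le))
          in b , b≤ , bounded-merge H (ρ y) (ρ z) (mergeArc s o) (mergeNoTriangle s o) (mergeUnique s o) B
          where
          shift : ∀ a b → a + (b + 3) ≡ a + 3 + b
          shift = solve-∀
        run-sound (mergeOut y z ∷ ops) {H} {V} c d ok s free le with o , ok′ ← ∧-true {mergeOk (flip V) y z} ok =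
          let s′ = sees-flip s
              H′ = merged s′ o
              b , b≤ , B = run-sound ops {rev H′} (c + 3) d ok′ (sees-flip (sees-merge s′ o))
                             (λ M → free (minor-rev {H = H} (minor-merge (rev H) (ρ y) (ρ z) (mergeArc s′ o) (mergeNoTriangle s′ o) (minor-rev {H = H′} M))))
                             (≤-trans (≤-reflexive (trans (cong (_+ (c + 3)) (weight-rev H′)) (shift (weight H′) c)))
                               (≤-trans (+-monoˡ-≤ c (≤-trans (weight-merge (rev H) (ρ y) (ρ z) (mergeArc s′ o) (mergeNoTriangle s′ o)) (≤-reflexive (weight-rev H)))) le))
          in b , b≤ , bounded-rev H (bounded-merge (rev H) (ρ y) (ρ z) (mergeArc s′ o) (mergeNoTriangle s′ o) (mergeUnique s′ o) (bounded-rev H′ B))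
          where
          shift : ∀ a b → a + (b + 3) ≡ a + 3 + b
          shift = solve-∀

  -- Counting labelled and unlabelled neighbours

  count : ℕ → (ℕ → Bool) → ℕ
  count zero q = 0
  count (suc k) q = ⟦ q k ⟧ + count k q

  module _ (P : Fin n → Bool) (ρ : ℕ → Fin n) (q : ℕ → Bool) where

    -- The part of `P` not hit by the marked labels below the bound. As labels are injective, each
    -- marked one removes exactly one element.
    residual : ℕ → Fin n → Bool
    residual zero u = P u
    residual (suc k) u = residual k u ∧ not (q k ∧ (u == ρ k))

    residual⁺ : ∀ k {u} → P u ≡ true → (∀ {a} → a < k → q a ≡ true → u ≢ ρ a) → residual k u ≡ true
    residual⁺ zero p _ = p
    residual⁺ (suc k) {u} p new rewrite residual⁺ k p (new ∘ m≤n⇒m≤1+n) with q k in eq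
    ... | false = refl
    ... | true rewrite ==-≢ (new ≤-refl eq) = refl

    residual⁻ : ∀ k {u} → residual k u ≡ true → P u ≡ true × (∀ {a} → a < k → q a ≡ true → u ≢ ρ a)
    residual⁻ zero p = p , λ ()
    residual⁻ (suc k) {u} p with r , s ← ∧-true {residual k u} p with pu , new ← residual⁻ k r = pu , λ a<k → go (m≤n⇒m<n∨m≡n (≤-pred a<k))
      where
      go : ∀ {a} → a < k ⊎ a ≡ k → q a ≡ true → u ≢ ρ a
      go (inj₁ lt) qa = new lt qa
      go (inj₂ refl) qa refl = true≢false (cong₂ _∧_ qa (==-refl u)) (not-true s)

    module _ (K : ℕ) (ρ-injective : ∀ {a b} → a < K → b < K → ρ a ≡ ρ b → a ≡ b)
             (q-P : ∀ {a} → a < K → q a ≡ true → P (ρ a) ≡ true) where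

      sum-residual : ∀ k → k ≤ K → sum (λ u → ⟦ P u ⟧) ≡ sum (λ u → ⟦ residual k u ⟧) + count k q
      sum-residual zero _ = sym (+-identityʳ _)
      sum-residual (suc k) k<K = begin
        sum (λ u → ⟦ P u ⟧) ≡⟨ sum-residual k (<⇒≤ k<K) ⟩
        sum (λ u → ⟦ residual k u ⟧) + count k q ≡⟨ cong (_+ count k q) (trans (sum-cong-≗ {n} pointwise) (∑-distrib-+ {n} _ _)) ⟩
        sum (λ u → ⟦ residual (suc k) u ⟧) + sum (only (ρ k) (λ _ → ⟦ q k ⟧)) + count k q
          ≡⟨ cong (λ m → sum (λ u → ⟦ residual (suc k) u ⟧) + m + count k q) (sum-only (ρ k) _) ⟩
        sum (λ u → ⟦ residual (suc k) u ⟧) + ⟦ q k ⟧ + count k q ≡⟨ +-assoc (sum (λ u → ⟦ residual (suc k) u ⟧)) _ _ ⟩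
        sum (λ u → ⟦ residual (suc k) u ⟧) + count (suc k) q ∎
        where
        open ≡-Reasoning
        pointwise : ∀ u → ⟦ residual k u ⟧ ≡ ⟦ residual (suc k) u ⟧ + only (ρ k) (λ _ → ⟦ q k ⟧) u
        pointwise u with q k in eq
        pointwise u | false with residual k u | u == ρ k
        ... | true | true = refl
        ... | true | false = refl
        ... | false | true = refl
        ... | false | false = refl
        pointwise u | true with u Fin.≟ ρ k
        ... | no _ with residual k u
        ...   | true = refl
        ...   | false = refl
        pointwise u | true | yes refl rewrite residual⁺ k (q-P k<K eq) (λ a<k _ e → <⇒≢ a<k (sym (ρ-injective k<K (<-trans a<k k<K) e))) = refl

      count-≤ : count K q ≤ sum (λ u → ⟦ P u ⟧)
      count-≤ = ≤-trans (m≤n+m _ _) (≤-reflexive (sym (sum-residual K ≤-refl)))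

      -- Applied to a neighbourhood `P`: once as many neighbours are recorded as the known degree
      -- allows, the residual is empty and every neighbour is labelled.
      exhausted : sum (λ u → ⟦ P u ⟧) ≤ count K q → ∀ u → P u ≡ true → ∃ λ a → a < K × q a ≡ true × u ≡ ρ a
      exhausted le u pu = search K ≤-refl none
        where
        zeroSum : sum (λ u → ⟦ residual K u ⟧) ≡ 0
        zeroSum = n≤0⇒n≡0 (+-cancelʳ-≤ (count K q) _ 0 (≤-trans (≤-reflexive (sym (sum-residual K ≤-refl))) le))
        none : residual K u ≡ false
        none with residual K u in eq
        ... | false = refl
        ... | true with () ← ≤-trans (≤-trans (≤-reflexive (sym (cong ⟦_⟧ eq))) (≤-sum (λ u → ⟦ residual K u ⟧) u)) (≤-reflexive zeroSum)
        search : ∀ k → k ≤ K → residual k u ≡ false → ∃ λ a → a < K × q a ≡ true × u ≡ ρ a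
        search zero _ r = ⊥-elim (true≢false pu r)
        search (suc k) k<K r with residual k u in e₁ | q k in e₂ | u Fin.≟ ρ k
        ... | false | _ | _ = search k (<⇒≤ k<K) e₁
        ... | true | true | yes p = k , k<K , e₂ , p
        ... | true | true | no _ with () ← r
        ... | true | false | _ with () ← r

      -- The complementary case: a degree above the number of recorded neighbours supplies the
      -- vertex for a new label.
      another : count K q < sum (λ u → ⟦ P u ⟧) → ∃ λ u → P u ≡ true × (∀ {a} → a < K → q a ≡ true → u ≢ ρ a)
      another lt with Fin.any? (λ u → residual K u Bool.≟ true)
      ... | yes (u , r) = u , residual⁻ K r
      ... | no none = ⊥-elim (<-irrefl (sym total) lt)
        where
        total : sum (λ u → ⟦ P u ⟧) ≡ count K q
        total = trans (sum-residual K ≤-refl) (cong (_+ count K q)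
          (trans (sum-cong-≗ {n} (λ u → cong ⟦_⟧ (≢true (λ r → none (u , r))))) (sum-zero {n})))

  -- Configurations and decision trees

  module _ {A : Set} where

    -- Functions with finitely many non-default values, kept as lists so that the checker computes
    -- on plain data.
    at : A → List A → ℕ → A
    at d [] _ = d
    at d (x ∷ _) zero = x
    at d (_ ∷ xs) (suc i) = at d xs i

    put : A → ℕ → A → List A → List A
    put d zero v [] = v ∷ []
    put d zero v (_ ∷ xs) = v ∷ xs
    put d (suc i) v [] = d ∷ put d i v []
    put d (suc i) v (x ∷ xs) = x ∷ put d i v xs

    at-put : ∀ d i v xs → at d (put d i v xs) i ≡ v
    at-put d zero v [] = refl
    at-put d zero v (_ ∷ _) = refl
    at-put d (suc i) v [] = at-put d i v []
    at-put d (suc i) v (_ ∷ xs) = at-put d i v xs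

    at-put-≢ : ∀ d i v xs {j} → j ≢ i → at d (put d i v xs) j ≡ at d xs j
    at-put-≢ d zero v xs {zero} p = ⊥-elim (p refl)
    at-put-≢ d zero v [] {suc _} _ = refl
    at-put-≢ d zero v (_ ∷ _) {suc _} _ = refl
    at-put-≢ d (suc i) v [] {zero} _ = refl
    at-put-≢ d (suc i) v (_ ∷ _) {zero} _ = refl
    at-put-≢ d (suc i) v [] {suc j} p = at-put-≢ d i v [] {j} (λ e → p (cong suc e))
    at-put-≢ d (suc i) v (_ ∷ xs) {suc j} p = at-put-≢ d i v xs (λ e → p (cong suc e))

  -- Partial knowledge about the vertices labelled by the numbers below size:
  -- their adjacency table, some of the pairs (in-degree, out-degree), and the
  -- labels whose in- or out-neighbours are all recorded in the table.
  record Config : Set where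
    constructor config
    field
      size  : ℕ
      table : List (List Status)
      kinds : List (Maybe (ℕ × ℕ))
      ins outs : List Bool

  open Config

  entry : Config → ℕ → ℕ → Status
  entry c a b = at unknown (at [] (table c) a) b

  kind : Config → ℕ → Maybe (ℕ × ℕ)
  kind c = at nothing (kinds c)

  setEntry : Config → ℕ → ℕ → Status → Config
  setEntry c a b s = record c { table = put [] a (put unknown b s (at [] (table c) a)) (table c) }

  setKind : Config → ℕ → ℕ × ℕ → Config
  setKind c x κ = record c { kinds = put nothing x (just κ) (kinds c) }

  entry-set : ∀ c a b s → entry (setEntry c a b s) a b ≡ s
  entry-set c a b s rewrite at-put [] a (put unknown b s (at [] (table c) a)) (table c) = at-put unknown b s _

  entry-set-≢ : ∀ c a b s {a′ b′} → a′ ≢ a ⊎ b′ ≢ b → entry (setEntry c a b s) a′ b′ ≡ entry c a′ b′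
  entry-set-≢ c a b s {a′} {b′} p with a′ ≟ a
  entry-set-≢ c a b s {a′} {b′} p | no q rewrite at-put-≢ [] a (put unknown b s (at [] (table c) a)) (table c) q = refl
  entry-set-≢ c a b s {a′} {b′} (inj₁ p) | yes q = ⊥-elim (p q)
  entry-set-≢ c a b s {a′} {b′} (inj₂ p) | yes refl rewrite at-put [] a (put unknown b s (at [] (table c) a)) (table c) = at-put-≢ unknown b s _ p

  indegree outdegree : Config → ℕ → ℕ
  indegree c x = count (size c) (λ a → isPresent (entry c a x))
  outdegree c x = count (size c) (λ a → isPresent (entry c x a))

  -- An unrecorded arc is absent if its reverse is present (no digons), if it would be a loop, or if
  -- it would belong to a neighbourhood known to be completely recorded.
  infer : Config → ℕ → ℕ → Status
  infer c a b with entry c a b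
  ... | present = present
  ... | absent = absent
  ... | unknown = if isPresent (entry c b a) ∨ (a ≡ᵇ b) ∨ at false (ins c) b ∨ at false (outs c) a then absent else unknown

  -- `ask` branches on an arc, absence first; `split` branches on the degrees of a vertex. `newIn`
  -- and `newOut` label a further neighbour whose existence the known degree guarantees, `closeIn`
  -- and `closeOut` declare a neighbourhood complete. A leaf is a reduction sequence or a case that
  -- is impossible or already excluded.
  data Tree : Set where
    reduce : List Op → Tree
    clash : ℕ → Tree
    ask : ℕ → ℕ → Tree → Tree → Tree
    split : ℕ → List Tree → Tree
    newIn newOut closeIn closeOut : ℕ → Tree → Tree

  kindsOfDegree : ℕ → List (ℕ × ℕ)
  kindsOfDegree t = map (λ a → a , t ∸ a) (upTo (suc t))

  -- Degrees stop at 6, since vertices of degree 7 and more are deleted beforehand.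
  allKinds : List (ℕ × ℕ)
  allKinds = concatMap kindsOfDegree (upTo 7)

  ∈-allKinds : ∀ i o → i + o ≤ 6 → (i , o) ∈ allKinds
  ∈-allKinds i o le = ∈-concatMap⁺ kindsOfDegree {xs = upTo 7} (Any.map (λ { refl → own }) (∈-upTo⁺ {7} {i + o} (s≤s le)))
    where
    own : (i , o) ∈ kindsOfDegree (i + o)
    own = subst (λ m → (i , m) ∈ kindsOfDegree (i + o)) (m+n∸m≡n i o)
            (∈-map⁺ (λ a → a , (i + o) ∸ a) (∈-upTo⁺ (s≤s (m≤m+n i o))))

  elem : ℕ → ℕ → List (ℕ × ℕ) → Bool
  elem i o [] = false
  elem i o ((i′ , o′) ∷ κs) = ((i ≡ᵇ i′) ∧ (o ≡ᵇ o′)) ∨ elem i o κs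

  -- `lo` bounds in- and out-degrees from below, `dmin` degrees; both grow as the global case
  -- distinction proceeds. `bad` lists the kinds already excluded for in-neighbours of vertices of
  -- kind (2 , 2) and, with the entries swapped, for their out-neighbours.
  module _ (lo dmin : ℕ) (bad : List (ℕ × ℕ)) where

    lowest : Config → ℕ → ℕ
    lowest c x with kind c x
    ... | just (i , o) = i + o
    ... | nothing = dmin ⊔ ((lo ⊔ indegree c x) + (lo ⊔ outdegree c x))

    view : Config → View
    view c = record
      { live = _<ᵇ size c ; know = infer c
      ; inClosed = at false (ins c) ; outClosed = at false (outs c) ; low = lowest c }

    overfull : Config → ℕ → Bool
    overfull c x with kind c x
    ... | just (i , o) = (i <ᵇ indegree c x) ∨ (o <ᵇ outdegree c x)
    ... | nothing = false

    badKinds : Maybe (ℕ × ℕ) → Maybe (ℕ × ℕ) → Bool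
    badKinds (just (i , o)) (just (i′ , o′)) =
      ((i′ ≡ᵇ 2) ∧ (o′ ≡ᵇ 2) ∧ elem i o bad) ∨ ((i ≡ᵇ 2) ∧ (o ≡ᵇ 2) ∧ elem o′ i′ bad)
    badKinds _ _ = false

    badArc : Config → ℕ → ℕ → Bool
    badArc c p q = isPresent (entry c p q) ∧ badKinds (kind c p) (kind c q)

    clashes : Config → ℕ → Bool
    clashes c x = (x <ᵇ size c) ∧ (overfull c x ∨ any (size c) (λ a → badArc c x a ∨ badArc c a x))

    fits : ℕ → ℕ → Bool
    fits i o = (lo ≤ᵇ i) ∧ (lo ≤ᵇ o) ∧ (dmin ≤ᵇ i + o)

    isUnknown : Status → Bool
    isUnknown unknown = true
    isUnknown _ = false

    isNothing : Maybe (ℕ × ℕ) → Bool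
    isNothing nothing = true
    isNothing _ = false

    -- The lists might hold data beyond `size`, which would turn into assertions about the new
    -- vertex when the configuration grows.
    isFresh : Config → Bool
    isFresh c = isNothing (kind c (size c)) ∧ not (at false (ins c) (size c)) ∧ not (at false (outs c) (size c)) ∧
      all (suc (size c)) (λ a → isUnknown (entry c a (size c)) ∧ isUnknown (entry c (size c) a))

    roomIn roomOut : Config → ℕ → Bool
    roomIn c x with kind c x
    ... | just (i , _) = indegree c x <ᵇ i
    ... | nothing = false
    roomOut c x with kind c x
    ... | just (_ , o) = outdegree c x <ᵇ o
    ... | nothing = false

    fullIn fullOut : Config → ℕ → Bool
    fullIn c x with kind c x
    ... | just (i , _) = i ≤ᵇ indegree c x
    ... | nothing = false
    fullOut c x with kind c x
    ... | just (_ , o) = o ≤ᵇ outdegree c x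
    ... | nothing = false

    grow : Config → Config
    grow c = record c { size = suc (size c) }

    setIn setOut : Config → ℕ → Config
    setIn c x = record c { ins = put false x true (ins c) }
    setOut c x = record c { outs = put false x true (outs c) }

    check : Config → Tree → Bool
    checkKinds : Config → ℕ → List (ℕ × ℕ) → List Tree → Bool

    check c (reduce ops) = run (size c) (view c) ops 0 0
    check c (clash x) = clashes c x
    check c (ask a b t t′) = (a <ᵇ size c) ∧ (b <ᵇ size c) ∧ isUnknown (entry c a b) ∧ check (setEntry c a b absent) t ∧ check (setEntry c a b present) t′
    check c (split x ts) = (x <ᵇ size c) ∧ checkKinds c x allKinds ts
    -- Every labelled vertex must already be known to be or not to be an in-neighbour of `x`; only
    -- then does a further in-neighbour differ from all labels.
    check c (newIn x t) = (x <ᵇ size c) ∧ roomIn c x ∧ all (size c) (λ a → not (isUnknown (infer c a x))) ∧ isFresh c ∧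
      check (setEntry (grow c) (size c) x present) t
    check c (newOut x t) = (x <ᵇ size c) ∧ roomOut c x ∧ all (size c) (λ a → not (isUnknown (infer c x a))) ∧ isFresh c ∧
      check (setEntry (grow c) x (size c) present) t
    check c (closeIn x t) = (x <ᵇ size c) ∧ fullIn c x ∧ check (setIn c x) t
    check c (closeOut x t) = (x <ᵇ size c) ∧ fullOut c x ∧ check (setOut c x) t

    checkKinds c x [] ts = true
    -- With the subtrees used up, every remaining kind has to be dismissed as inadmissible or
    -- clashing.
    checkKinds c x (κ ∷ κs) [] =
      (not (fits (proj₁ κ) (proj₂ κ)) ∨ clashes (setKind c x κ) x) ∧ checkKinds c x κs []
    checkKinds c x (κ ∷ κs) (t ∷ ts) =
      if not (fits (proj₁ κ) (proj₂ κ)) ∨ clashes (setKind c x κ) x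
      then checkKinds c x κs (t ∷ ts)
      else (check (setKind c x κ) t ∧ checkKinds c x κs ts)

    -- Stronger than `Sees` on closed neighbourhoods: their arcs are recorded in the table, which is
    -- what allows `infer` to conclude absence from a missing entry.
    record Realizes {n : ℕ} (H : Digraph n) (c : Config) (ρ : ℕ → Fin n) : Set where
      field
        injective : ∀ {a b} → a < size c → b < size c → ρ a ≡ ρ b → a ≡ b
        alive-ok : ∀ {a} → a < size c → alive H (ρ a) ≡ true
        present-ok : ∀ {a b} → a < size c → b < size c → entry c a b ≡ present → arc H (ρ a) (ρ b) ≡ true
        absent-ok : ∀ {a b} → a < size c → b < size c → entry c a b ≡ absent → arc H (ρ a) (ρ b) ≡ false
        kind-ok : ∀ {a i o} → a < size c → kind c a ≡ just (i , o) → indeg H (ρ a) ≡ i × outdeg H (ρ a) ≡ o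
        in-ok : ∀ {a} → a < size c → at false (ins c) a ≡ true → ∀ u → arc H u (ρ a) ≡ true →
                ∃ λ b → b < size c × entry c b a ≡ present × u ≡ ρ b
        out-ok : ∀ {a} → a < size c → at false (outs c) a ≡ true → ∀ u → arc H (ρ a) u ≡ true →
                ∃ λ b → b < size c × entry c a b ≡ present × u ≡ ρ b

    open Realizes

    module _ {n : ℕ} (H : Digraph n) (m : ℕ)
      (ih : ∀ (H′ : Digraph n) → weight H′ < weight H → ¬ CompleteMinor m H′ → Bounded H′ (weight H′))
      (free : ¬ CompleteMinor m H)
      (tame : ∀ v → alive H v ≡ true → lo ≤ indeg H v × lo ≤ outdeg H v × dmin ≤ deg H v × deg H v ≤ 6)
      (bad-out : ∀ u v → arc H u v ≡ true → elem (indeg H u) (outdeg H u) bad ≡ true →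
                 indeg H v ≡ 2 → outdeg H v ≡ 2 → Bounded H (weight H))
      (bad-in : ∀ u v → arc H u v ≡ true → indeg H u ≡ 2 → outdeg H u ≡ 2 →
                elem (outdeg H v) (indeg H v) bad ≡ true → Bounded H (weight H))
      where

      private
        Goal : Set
        Goal = Bounded H (weight H)

      module _ {c : Config} {ρ : ℕ → Fin n} (r : Realizes H c ρ) where

        infer-present : ∀ {a b} → a < size c → b < size c → infer c a b ≡ present → arc H (ρ a) (ρ b) ≡ true
        infer-present {a} {b} la lb e with entry c a b in eq
        ... | present = present-ok r la lb eq
        ... | unknown with isPresent (entry c b a) ∨ (a ≡ᵇ b) ∨ at false (ins c) b ∨ at false (outs c) a | e
        ...   | true | ()
        ...   | false | ()

        infer-absent : ∀ {a b} → a < size c → b < size c → infer c a b ≡ absent → arc H (ρ a) (ρ b) ≡ false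
        infer-absent {a} {b} la lb e with entry c a b in eq
        ... | absent = absent-ok r la lb eq
        ... | unknown with isPresent (entry c b a) in e₁
        ...   | true = asym H (present-ok r lb la (present-sound _ e₁))
        ...   | false with a ≡ᵇ b in e₂
        ...     | true with refl ← ≡ᵇ-true a b e₂ = irrefl H (ρ a)
        ...     | false with at false (ins c) b in e₃
        ...       | true = ≢true λ p → let b′ , lb′ , q , s = in-ok r lb e₃ _ p in clashing q (injective r la lb′ s)
          where
          clashing : ∀ {b′} → entry c b′ b ≡ present → a ≡ b′ → ⊥
          clashing q refl with () ← trans (sym q) eq
        ...       | false with at false (outs c) a in e₄
        ...         | true = ≢true λ p → let b′ , lb′ , q , s = out-ok r la e₄ _ p in clashing q (injective r lb lb′ s)
          where
          clashing : ∀ {b′} → entry c a b′ ≡ present → b ≡ b′ → ⊥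
          clashing q refl with () ← trans (sym q) eq
        infer-absent {a} {b} la lb () | unknown | false | false | false | false

        indegree-≤ : ∀ {x} → x < size c → indegree c x ≤ indeg H (ρ x)
        indegree-≤ {x} lx = count-≤ (λ u → arc H u (ρ x)) ρ _ (size c) (injective r) (λ la e → present-ok r la lx (present-sound _ e))

        outdegree-≤ : ∀ {x} → x < size c → outdegree c x ≤ outdeg H (ρ x)
        outdegree-≤ {x} lx = count-≤ (λ u → arc H (ρ x) u) ρ _ (size c) (injective r) (λ la e → present-ok r lx la (present-sound _ e))

        lowest-ok : ∀ {x} → x < size c → lowest c x ≤ deg H (ρ x)
        lowest-ok {x} lx with kind c x in eq
        ... | just (i , o) = let p , q = kind-ok r lx eq in ≤-reflexive (sym (cong₂ _+_ p q))
        ... | nothing = let p , q , s , _ = tame _ (alive-ok r lx) in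
              ⊔-lub s (+-mono-≤ (⊔-lub p (indegree-≤ lx)) (⊔-lub q (outdegree-≤ lx)))

        view-sees : Sees (size c) ρ (injective r) H (view c)
        view-sees = record
          { live-< = λ {a} p → <ᵇ-true a _ p
          ; live-ok = λ {a} p → alive-ok r (<ᵇ-true a _ p)
          ; present-ok = λ {a} {b} p q → infer-present (<ᵇ-true a _ p) (<ᵇ-true b _ q)
          ; absent-ok = λ {a} {b} p q → infer-absent (<ᵇ-true a _ p) (<ᵇ-true b _ q)
          ; in-ok = λ {a} p e u q → let b , lb , _ , eq = in-ok r (<ᵇ-true a _ p) e u q in b , <ᵇ-complete lb , eq
          ; out-ok = λ {a} p e u q → let b , lb , _ , eq = out-ok r (<ᵇ-true a _ p) e u q in b , <ᵇ-complete lb , eq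
          ; low-ok = λ {a} p → lowest-ok (<ᵇ-true a _ p)
          }
          where
          <ᵇ-complete : ∀ {a b} → a < b → (a <ᵇ b) ≡ true
          <ᵇ-complete {a} {b} lt with a <ᵇ b | <⇒<ᵇ lt
          ... | true | _ = refl

        reduce-sound : ∀ ops → run (size c) (view c) ops 0 0 ≡ true → Goal
        reduce-sound ops ok =
          let b , le , B = run-sound (size c) ρ (injective r) ih ops 0 0 ok view-sees free (≤-reflexive (+-identityʳ _))
          in bounded-weaken H (≤-trans (m≤m+n b 0) le) B

        badKinds-sound : ∀ {p q} → p < size c → q < size c → badArc c p q ≡ true → Goal
        badKinds-sound {p} {q} lp lq ok with e , ok′ ← ∧-true {isPresent (entry c p q)} ok
                                    with kind c p in kp | kind c q in kq
        ... | just (i , o) | just (i′ , o′) with refl , refl ← kind-ok r lp kp with refl , refl ← kind-ok r lq kq with ∨-true ok′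
        ...   | inj₁ s = let s₁ , s₂ = ∧-true s ; s₃ , s₄ = ∧-true s₂ in
                  bad-out _ _ (present-ok r lp lq (present-sound _ e)) s₄ (≡ᵇ-true _ 2 s₁) (≡ᵇ-true _ 2 s₃)
        ...   | inj₂ s = let s₁ , s₂ = ∧-true s ; s₃ , s₄ = ∧-true s₂ in
                  bad-in _ _ (present-ok r lp lq (present-sound _ e)) (≡ᵇ-true _ 2 s₁) (≡ᵇ-true _ 2 s₃) s₄

        overfull-sound : ∀ {x} → x < size c → overfull c x ≡ true → ⊥
        overfull-sound {x} lx ok with kind c x in eq
        ... | just (i , o) with refl , refl ← kind-ok r lx eq with ∨-true ok
        ...   | inj₁ p = <⇒≱ (<ᵇ-true _ (indegree c x) p) (indegree-≤ lx)
        ...   | inj₂ p = <⇒≱ (<ᵇ-true _ (outdegree c x) p) (outdegree-≤ lx)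

        clashes-sound : ∀ x → clashes c x ≡ true → Goal
        clashes-sound x ok with lx , ok′ ← ∧-true {x <ᵇ size c} ok with ∨-true {overfull c x} ok′
        ... | inj₁ p = ⊥-elim (overfull-sound (<ᵇ-true x _ lx) p)
        ... | inj₂ p with any-sound (size c) _ p
        ...   | a , la , q with ∨-true {badArc c x a} q
        ...     | inj₁ s = badKinds-sound (<ᵇ-true x _ lx) la s
        ...     | inj₂ s = badKinds-sound la (<ᵇ-true x _ lx) s

        -- Restricting updates to unknown entries protects the recorded arcs on which closed
        -- neighbourhoods depend.
        setEntry-ok : ∀ {a b s} → entry c a b ≡ unknown →
                      (s ≡ present → arc H (ρ a) (ρ b) ≡ true) → (s ≡ absent → arc H (ρ a) (ρ b) ≡ false) →
                      Realizes H (setEntry c a b s) ρ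
        setEntry-ok {a} {b} {s} unk′ yes-ok no-ok = record
          { injective = injective r ; alive-ok = alive-ok r
          ; present-ok = λ {a′} {b′} la lb e → present′ (a′ ≟ a) (b′ ≟ b) la lb e
          ; absent-ok = λ {a′} {b′} la lb e → absent′ (a′ ≟ a) (b′ ≟ b) la lb e
          ; kind-ok = kind-ok r
          ; in-ok = λ la e u p → let b′ , lb , q , eq = in-ok r la e u p in b′ , lb , keep q , eq
          ; out-ok = λ la e u p → let b′ , lb , q , eq = out-ok r la e u p in b′ , lb , keep q , eq
          }
          where
          present′ : ∀ {a′ b′} → Dec (a′ ≡ a) → Dec (b′ ≡ b) → a′ < size c → b′ < size c →
                     entry (setEntry c a b s) a′ b′ ≡ present → arc H (ρ a′) (ρ b′) ≡ true
          present′ (yes refl) (yes refl) _ _ e = yes-ok (trans (sym (entry-set c a b s)) e)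
          present′ (no p) _ la lb e = present-ok r la lb (trans (sym (entry-set-≢ c a b s (inj₁ p))) e)
          present′ (yes _) (no p) la lb e = present-ok r la lb (trans (sym (entry-set-≢ c a b s (inj₂ p))) e)
          absent′ : ∀ {a′ b′} → Dec (a′ ≡ a) → Dec (b′ ≡ b) → a′ < size c → b′ < size c →
                     entry (setEntry c a b s) a′ b′ ≡ absent → arc H (ρ a′) (ρ b′) ≡ false
          absent′ (yes refl) (yes refl) _ _ e = no-ok (trans (sym (entry-set c a b s)) e)
          absent′ (no p) _ la lb e = absent-ok r la lb (trans (sym (entry-set-≢ c a b s (inj₁ p))) e)
          absent′ (yes _) (no p) la lb e = absent-ok r la lb (trans (sym (entry-set-≢ c a b s (inj₂ p))) e)
          keep : ∀ {a′ b′} → entry c a′ b′ ≡ present → entry (setEntry c a b s) a′ b′ ≡ present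
          keep {a′} {b′} q with a′ ≟ a | b′ ≟ b
          ... | yes refl | yes refl with () ← trans (sym q) unk′
          ... | no p | _ = trans (entry-set-≢ c a b s (inj₁ p)) q
          ... | yes _ | no p = trans (entry-set-≢ c a b s (inj₂ p)) q

        setKind-ok : ∀ {x} → x < size c → Realizes H (setKind c x (indeg H (ρ x) , outdeg H (ρ x))) ρ
        setKind-ok {x} lx = record
          { injective = injective r ; alive-ok = alive-ok r ; present-ok = present-ok r ; absent-ok = absent-ok r
          ; kind-ok = λ {a} la e → kind′ (a ≟ x) la e ; in-ok = in-ok r ; out-ok = out-ok r }
          where
          κ : ℕ × ℕ
          κ = indeg H (ρ x) , outdeg H (ρ x)
          kind′ : ∀ {a i o} → Dec (a ≡ x) → a < size c → kind (setKind c x κ) a ≡ just (i , o) → indeg H (ρ a) ≡ i × outdeg H (ρ a) ≡ o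
          kind′ (yes refl) _ e with refl ← trans (sym (at-put nothing x (just κ) (kinds c))) e = refl , refl
          kind′ (no p) la e = kind-ok r la (trans (sym (at-put-≢ nothing x (just κ) (kinds c) p)) e)

        setIn-ok : ∀ {x} → x < size c → fullIn c x ≡ true → Realizes H (setIn c x) ρ
        setIn-ok {x} lx full = record
          { injective = injective r ; alive-ok = alive-ok r ; present-ok = present-ok r ; absent-ok = absent-ok r
          ; kind-ok = kind-ok r ; in-ok = λ {a} la e → in′ (a ≟ x) la e ; out-ok = out-ok r }
          where
          everything : ∀ u → arc H u (ρ x) ≡ true → ∃ λ b → b < size c × entry c b x ≡ present × u ≡ ρ b
          everything u p with kind c x in eq
          ... | just (i , o) with refl , refl ← kind-ok r lx eq =
                let b , lb , q , s = exhausted (λ u → arc H u (ρ x)) ρ _ (size c) (injective r)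
                                       (λ la e → present-ok r la lx (present-sound _ e)) (≤ᵇ-true _ (indegree c x) full) u p
                in b , lb , present-sound _ q , s
          in′ : ∀ {a} → Dec (a ≡ x) → a < size c → at false (put false x true (ins c)) a ≡ true → ∀ u → arc H u (ρ a) ≡ true →
                ∃ λ b → b < size c × entry c b a ≡ present × u ≡ ρ b
          in′ (yes refl) _ _ = everything
          in′ (no p) la e = in-ok r la (trans (sym (at-put-≢ false x true (ins c) p)) e)

        setOut-ok : ∀ {x} → x < size c → fullOut c x ≡ true → Realizes H (setOut c x) ρ
        setOut-ok {x} lx full = record
          { injective = injective r ; alive-ok = alive-ok r ; present-ok = present-ok r ; absent-ok = absent-ok r
          ; kind-ok = kind-ok r ; in-ok = in-ok r ; out-ok = λ {a} la e → out′ (a ≟ x) la e }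
          where
          everything : ∀ u → arc H (ρ x) u ≡ true → ∃ λ b → b < size c × entry c x b ≡ present × u ≡ ρ b
          everything u p with kind c x in eq
          ... | just (i , o) with refl , refl ← kind-ok r lx eq =
                let b , lb , q , s = exhausted (λ u → arc H (ρ x) u) ρ _ (size c) (injective r)
                                       (λ la e → present-ok r lx la (present-sound _ e)) (≤ᵇ-true _ (outdegree c x) full) u p
                in b , lb , present-sound _ q , s
          out′ : ∀ {a} → Dec (a ≡ x) → a < size c → at false (put false x true (outs c)) a ≡ true → ∀ u → arc H (ρ a) u ≡ true →
                ∃ λ b → b < size c × entry c a b ≡ present × u ≡ ρ b
          out′ (yes refl) _ _ = everything
          out′ (no p) la e = out-ok r la (trans (sym (at-put-≢ false x true (outs c) p)) e)

        module _ (u : Fin n) (au : alive H u ≡ true) (new : ∀ {a} → a < size c → u ≢ ρ a) (fresh : isFresh c ≡ true) where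

          private
            f₁ = ∧-true {isNothing (kind c (size c))} fresh
            f₂ = ∧-true {not (at false (ins c) (size c))} (proj₂ f₁)
            f₃ = ∧-true {not (at false (outs c) (size c))} (proj₂ f₂)

          extend : ℕ → Fin n
          extend a = if a ≡ᵇ size c then u else ρ a

          extend-new : extend (size c) ≡ u
          extend-new rewrite ≡ᵇ-refl (size c) = refl

          extend-old : ∀ {a} → a < size c → extend a ≡ ρ a
          extend-old lt rewrite ≢⇒≡ᵇ (<⇒≢ lt) = refl

          private
            isUnknown-sound : ∀ s → isUnknown s ≡ true → s ≡ unknown
            isUnknown-sound unknown _ = refl

          fresh-left : ∀ {b} → b < suc (size c) → entry c (size c) b ≡ unknown
          fresh-left {b} lb = isUnknown-sound _ (proj₂ (∧-true {isUnknown (entry c b (size c))} (all-sound (suc (size c)) _ (proj₂ f₃) lb)))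

          fresh-right : ∀ {a} → a < suc (size c) → entry c a (size c) ≡ unknown
          fresh-right {a} la = isUnknown-sound _ (proj₁ (∧-true {isUnknown (entry c a (size c))} (all-sound (suc (size c)) _ (proj₂ f₃) la)))

          private
            old? : ∀ {a} → a < suc (size c) → a < size c ⊎ a ≡ size c
            old? lt = m≤n⇒m<n∨m≡n (≤-pred lt)

            injective′ : ∀ {a b} → a < suc (size c) → b < suc (size c) → extend a ≡ extend b → a ≡ b
            injective′ la lb e with old? la | old? lb
            ... | inj₁ p | inj₁ q = injective r p q (trans (sym (extend-old p)) (trans e (extend-old q)))
            ... | inj₁ p | inj₂ refl = ⊥-elim (new p (trans (sym extend-new) (trans (sym e) (extend-old p))))
            ... | inj₂ refl | inj₁ q = ⊥-elim (new q (trans (sym extend-new) (trans e (extend-old q))))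
            ... | inj₂ refl | inj₂ refl = refl

            alive′ : ∀ {a} → a < suc (size c) → alive H (extend a) ≡ true
            alive′ la with old? la
            ... | inj₁ p rewrite extend-old p = alive-ok r p
            ... | inj₂ refl rewrite extend-new = au

            entry′ : ∀ {a b s} → a < suc (size c) → b < suc (size c) → entry c a b ≡ s → s ≢ unknown → a < size c × b < size c
            entry′ la lb e s≢ with old? la | old? lb
            ... | inj₁ p | inj₁ q = p , q
            ... | inj₂ refl | _ = ⊥-elim (s≢ (trans (sym e) (fresh-left lb)))
            ... | inj₁ _ | inj₂ refl = ⊥-elim (s≢ (trans (sym e) (fresh-right la)))

            kind′ : ∀ {a i o} → a < suc (size c) → kind c a ≡ just (i , o) → a < size c
            kind′ la e with old? la
            ... | inj₁ p = p
            ... | inj₂ refl with kind c (size c) | proj₁ f₁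
            kind′ la () | inj₂ refl | nothing | _

          grow-ok : Realizes H (grow c) extend
          grow-ok = record
            { injective = injective′
            ; alive-ok = alive′
            ; present-ok = λ la lb e → let p , q = entry′ la lb e (λ ()) in
                subst₂ (λ v w → arc H v w ≡ true) (sym (extend-old p)) (sym (extend-old q)) (present-ok r p q e)
            ; absent-ok = λ la lb e → let p , q = entry′ la lb e (λ ()) in
                subst₂ (λ v w → arc H v w ≡ false) (sym (extend-old p)) (sym (extend-old q)) (absent-ok r p q e)
            ; kind-ok = λ la e → let p = kind′ la e in
                subst (λ v → indeg H v ≡ _ × outdeg H v ≡ _) (sym (extend-old p)) (kind-ok r p e)
            ; in-ok = in′
            ; out-ok = out′
            }
            where
            in′ : ∀ {a} → a < suc (size c) → at false (ins c) a ≡ true → ∀ v → arc H v (extend a) ≡ true →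
                ∃ λ b → b < suc (size c) × entry c b a ≡ present × v ≡ extend b
            in′ la e v p with old? la
            ... | inj₂ refl = ⊥-elim (true≢false e (not-true (proj₁ f₂)))
            ... | inj₁ l rewrite extend-old l = let b , lb , q , s = in-ok r l e v p in b , m≤n⇒m≤1+n lb , q , trans s (sym (extend-old lb))
            out′ : ∀ {a} → a < suc (size c) → at false (outs c) a ≡ true → ∀ v → arc H (extend a) v ≡ true →
                ∃ λ b → b < suc (size c) × entry c a b ≡ present × v ≡ extend b
            out′ la e v p with old? la
            ... | inj₂ refl = ⊥-elim (true≢false e (not-true (proj₁ f₃)))
            ... | inj₁ l rewrite extend-old l = let b , lb , q , s = out-ok r l e v p in b , m≤n⇒m≤1+n lb , q , trans s (sym (extend-old lb))

        -- Separates a new neighbour from the old labels: if it had one, the decided entry would be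
        -- present and the vertex counted already.
        decided : ∀ {a b} → a < size c → b < size c → not (isUnknown (infer c a b)) ≡ true →
                  arc H (ρ a) (ρ b) ≡ true → isPresent (entry c a b) ≡ true
        decided {a} {b} la lb known p with infer c a b in e
        ... | absent = ⊥-elim (true≢false p (infer-absent la lb e))
        ... | present = cong isPresent (recorded e)
          where
          recorded : infer c a b ≡ present → entry c a b ≡ present
          recorded e with entry c a b
          ... | present = refl
          ... | unknown with isPresent (entry c b a) ∨ (a ≡ᵇ b) ∨ at false (ins c) b ∨ at false (outs c) a | e
          ...   | true | ()
          ...   | false | ()

      module _ {c : Config} {ρ : ℕ → Fin n} (r : Realizes H c ρ) where

        newIn-ok : ∀ {x} → x < size c → roomIn c x ≡ true → all (size c) (λ a → not (isUnknown (infer c a x))) ≡ true →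
                   isFresh c ≡ true → ∃ λ ρ′ → Realizes H (setEntry (grow c) (size c) x present) ρ′
        newIn-ok {x} lx room known fresh = go
          where
          find : ∃ λ u → arc H u (ρ x) ≡ true × (∀ {a} → a < size c → isPresent (entry c a x) ≡ true → u ≢ ρ a)
          find with kind c x in eq
          ... | just (i , o) with refl , refl ← kind-ok r lx eq =
                another (λ u → arc H u (ρ x)) ρ _ (size c) (injective r) (λ la e → present-ok r la lx (present-sound _ e))
                  (<ᵇ-true (indegree c x) _ room)
          go : ∃ λ ρ′ → Realizes H (setEntry (grow c) (size c) x present) ρ′
          go with u , p , new′ ← find = extend r u (tail-alive H p) new fresh , setEntry-ok (grow-ok r u (tail-alive H p) new fresh)
                   (fresh-left r u (tail-alive H p) new fresh (m≤n⇒m≤1+n lx))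
                   (λ _ → subst₂ (λ v w → arc H v w ≡ true) (sym (extend-new r u (tail-alive H p) new fresh)) (sym (extend-old r u (tail-alive H p) new fresh lx)) p)
                   (λ ())
            where
            new : ∀ {a} → a < size c → u ≢ ρ a
            new la e = new′ la (decided r la lx (all-sound (size c) _ known la) (subst (λ v → arc H v (ρ x) ≡ true) e p)) e

        newOut-ok : ∀ {x} → x < size c → roomOut c x ≡ true → all (size c) (λ a → not (isUnknown (infer c x a))) ≡ true →
                   isFresh c ≡ true → ∃ λ ρ′ → Realizes H (setEntry (grow c) x (size c) present) ρ′
        newOut-ok {x} lx room known fresh = go
          where
          find : ∃ λ u → arc H (ρ x) u ≡ true × (∀ {a} → a < size c → isPresent (entry c x a) ≡ true → u ≢ ρ a)
          find with kind c x in eq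
          ... | just (i , o) with refl , refl ← kind-ok r lx eq =
                another (λ u → arc H (ρ x) u) ρ _ (size c) (injective r) (λ la e → present-ok r lx la (present-sound _ e))
                  (<ᵇ-true (outdegree c x) _ room)
          go : ∃ λ ρ′ → Realizes H (setEntry (grow c) x (size c) present) ρ′
          go with u , p , new′ ← find = extend r u (head-alive H p) new fresh , setEntry-ok (grow-ok r u (head-alive H p) new fresh)
                   (fresh-right r u (head-alive H p) new fresh (m≤n⇒m≤1+n lx))
                   (λ _ → subst₂ (λ v w → arc H v w ≡ true) (sym (extend-old r u (head-alive H p) new fresh lx)) (sym (extend-new r u (head-alive H p) new fresh)) p)
                   (λ ())
            where
            new : ∀ {a} → a < size c → u ≢ ρ a
            new la e = new′ la (decided r lx la (all-sound (size c) _ known la) (subst (λ v → arc H (ρ x) v ≡ true) e p)) e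

      private
        fits-ok : ∀ v → alive H v ≡ true → fits (indeg H v) (outdeg H v) ≡ true
        fits-ok v av with p , q , s , _ ← tame v av = cong₂ _∧_ (≤ᵇ-complete p) (cong₂ _∧_ (≤ᵇ-complete q) (≤ᵇ-complete s))
          where
          ≤ᵇ-complete : ∀ {a b} → a ≤ b → (a ≤ᵇ b) ≡ true
          ≤ᵇ-complete {a} {b} le with a ≤ᵇ b | ≤⇒≤ᵇ le
          ... | true | _ = refl

        unknown-sound : ∀ s → isUnknown s ≡ true → s ≡ unknown
        unknown-sound unknown _ = refl

      check-sound : ∀ t {c ρ} → Realizes H c ρ → check c t ≡ true → Goal
      kinds-sound : ∀ κs ts {c ρ x} → Realizes H c ρ → x < size c → checkKinds c x κs ts ≡ true →
                    (indeg H (ρ x) , outdeg H (ρ x)) ∈ κs → Goal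

      check-sound (reduce ops) r ok = reduce-sound r ops ok
      check-sound (clash x) r ok = clashes-sound r x ok
      check-sound (ask a b t t′) {c} {ρ} r ok
        with la , ok₁ ← ∧-true {a <ᵇ size c} ok
        with lb , ok₂ ← ∧-true {b <ᵇ size c} ok₁
        with unk , ok₃ ← ∧-true {isUnknown (entry c a b)} ok₂
        with no-ok , yes-ok ← ∧-true {check (setEntry c a b absent) t} ok₃
        with arc H (ρ a) (ρ b) in e
      ... | false = check-sound t (setEntry-ok r (unknown-sound _ unk) (λ ()) (λ _ → e)) no-ok
      ... | true = check-sound t′ (setEntry-ok r (unknown-sound _ unk) (λ _ → e) (λ ())) yes-ok
      check-sound (split x ts) {c} {ρ} r ok with lx , ok₁ ← ∧-true {x <ᵇ size c} ok =
        kinds-sound allKinds ts r (<ᵇ-true x _ lx) ok₁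
          (∈-allKinds _ _ (proj₂ (proj₂ (proj₂ (tame _ (alive-ok r (<ᵇ-true x _ lx)))))))
      check-sound (newIn x t) {c} r ok
        with lx , ok₁ ← ∧-true {x <ᵇ size c} ok
        with room , ok₂ ← ∧-true {roomIn c x} ok₁
        with known , ok₃ ← ∧-true {all (size c) (λ a → not (isUnknown (infer c a x)))} ok₂
        with fresh , ok₄ ← ∧-true {isFresh c} ok₃ =
        check-sound t (proj₂ (newIn-ok r (<ᵇ-true x _ lx) room known fresh)) ok₄
      check-sound (newOut x t) {c} r ok
        with lx , ok₁ ← ∧-true {x <ᵇ size c} ok
        with room , ok₂ ← ∧-true {roomOut c x} ok₁
        with known , ok₃ ← ∧-true {all (size c) (λ a → not (isUnknown (infer c x a)))} ok₂
        with fresh , ok₄ ← ∧-true {isFresh c} ok₃ =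
        check-sound t (proj₂ (newOut-ok r (<ᵇ-true x _ lx) room known fresh)) ok₄
      check-sound (closeIn x t) {c} r ok
        with lx , ok₁ ← ∧-true {x <ᵇ size c} ok
        with full , ok₂ ← ∧-true {fullIn c x} ok₁ = check-sound t (setIn-ok r (<ᵇ-true x _ lx) full) ok₂
      check-sound (closeOut x t) {c} r ok
        with lx , ok₁ ← ∧-true {x <ᵇ size c} ok
        with full , ok₂ ← ∧-true {fullOut c x} ok₁ = check-sound t (setOut-ok r (<ᵇ-true x _ lx) full) ok₂

      kinds-sound (κ ∷ κs) [] {c} {ρ} {x} r lx ok mem
        with skip , ok₁ ← ∧-true {not (fits (proj₁ κ) (proj₂ κ)) ∨ clashes (setKind c x κ) x} ok with mem
      ... | there mem′ = kinds-sound κs [] r lx ok₁ mem′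
      ... | here refl with ∨-true {not (fits (proj₁ κ) (proj₂ κ))} skip
      ...   | inj₁ p = ⊥-elim (true≢false (fits-ok _ (alive-ok r lx)) (not-true p))
      ...   | inj₂ p = clashes-sound (setKind-ok r lx) x p
      kinds-sound (κ ∷ κs) (t ∷ ts) {c} {ρ} {x} r lx ok mem =
        -- The recursive calls are handed over as functions, so that the case split on the skipping
        -- test takes place outside the mutual recursion.
        decide (λ r′ ok′ → check-sound t r′ ok′) (λ ok′ mem′ → kinds-sound κs ts r lx ok′ mem′)
               (λ ok′ mem′ → kinds-sound κs (t ∷ ts) r lx ok′ mem′) _ refl ok mem
        where
        κ₀ : ℕ × ℕ
        κ₀ = indeg H (ρ x) , outdeg H (ρ x)
        decide : (Realizes H (setKind c x κ₀) ρ → check (setKind c x κ₀) t ≡ true → Goal) →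
                 (checkKinds c x κs ts ≡ true → κ₀ ∈ κs → Goal) →
                 (checkKinds c x κs (t ∷ ts) ≡ true → κ₀ ∈ κs → Goal) →
                 ∀ b → not (fits (proj₁ κ) (proj₂ κ)) ∨ clashes (setKind c x κ) x ≡ b →
                 (if b then checkKinds c x κs (t ∷ ts) else (check (setKind c x κ) t ∧ checkKinds c x κs ts)) ≡ true →
                 κ₀ ∈ κ ∷ κs → Goal
        decide _ _ later true _ ok (there mem) = later ok mem
        decide _ _ _ true skip _ (here refl) with ∨-true {not (fits (proj₁ κ) (proj₂ κ))} skip
        ... | inj₁ p = ⊥-elim (true≢false (fits-ok _ (alive-ok r lx)) (not-true p))
        ... | inj₂ p = clashes-sound (setKind-ok r lx) x p
        decide now _ _ false _ ok (here refl) = now (setKind-ok r lx) (proj₁ (∧-true {check (setKind c x κ) t} ok))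
        decide _ next _ false _ ok (there mem) = next (proj₂ (∧-true {check (setKind c x κ) t} ok)) mem

-- The decision trees and the configurations at their roots

module Trees where
  open Certificates
  open Config

  empty : Config
  empty = config 0 [] [] [] []

  single : ℕ × ℕ → Config
  single κ = setKind (grow 0 0 [] empty) 0 κ

  -- The trees were found by a computer search.  A split lists the subtrees of
  -- the admissible kinds only, in the order of allKinds.

  tree11 : Tree
  tree11 =
    newIn 0 (newOut 0 (closeIn 0 (closeOut 0 (split 1 (closeOut 1 (reduce (cut 2 ∷ sink 0 ∷ sink 1 ∷ [])) ∷ ask
      2 1 (newIn 1 (closeIn 1 (reduce (cut 3 ∷ source 1 ∷ source 0 ∷ [])))) (closeIn 1 (reduce (cut 2 ∷ sink 0
      ∷ source 1 ∷ []))) ∷ closeOut 1 (reduce (cut 2 ∷ sink 0 ∷ sink 1 ∷ [])) ∷ reduce (cut 1 ∷ source 0 ∷ [])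
      ∷ reduce (cut 1 ∷ source 0 ∷ []) ∷ closeOut 1 (reduce (cut 0 ∷ sink 1 ∷ [])) ∷ reduce (cut 1 ∷ source 0 ∷
      []) ∷ reduce (cut 1 ∷ source 0 ∷ []) ∷ reduce (cut 1 ∷ source 0 ∷ []) ∷ closeOut 1 (reduce (cut 0 ∷ sink
      1 ∷ [])) ∷ reduce (cut 1 ∷ source 0 ∷ []) ∷ reduce (cut 1 ∷ source 0 ∷ []) ∷ reduce (cut 1 ∷ source 0 ∷
      []) ∷ reduce (cut 1 ∷ source 0 ∷ []) ∷ closeOut 1 (reduce (cut 0 ∷ sink 1 ∷ [])) ∷ [])))))

  tree12 : Tree
  tree12 =
    newIn 0 (newOut 0 (newOut 0 (closeIn 0 (closeOut 0 (split 1 (closeOut 1 (ask 2 1 (ask 3 1 (newIn 1 (closeIn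
      1 (reduce (cut 4 ∷ source 1 ∷ source 0 ∷ [])))) (closeIn 1 (reduce (cut 3 ∷ mergeIn 0 1 ∷ source 1 ∷
      [])))) (closeIn 1 (reduce (cut 2 ∷ mergeIn 0 1 ∷ source 1 ∷ [])))) ∷ reduce (cut 1 ∷ source 0 ∷ []) ∷
      closeOut 1 (reduce (cut 0 ∷ sink 1 ∷ [])) ∷ reduce (cut 1 ∷ source 0 ∷ []) ∷ reduce (cut 1 ∷ source 0 ∷
      []) ∷ closeOut 1 (reduce (cut 0 ∷ sink 1 ∷ [])) ∷ reduce (cut 1 ∷ source 0 ∷ []) ∷ reduce (cut 1 ∷ source
      0 ∷ []) ∷ reduce (cut 1 ∷ source 0 ∷ []) ∷ closeOut 1 (reduce (cut 0 ∷ sink 1 ∷ [])) ∷ reduce (cut 1 ∷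
      source 0 ∷ []) ∷ reduce (cut 1 ∷ source 0 ∷ []) ∷ reduce (cut 1 ∷ source 0 ∷ []) ∷ reduce (cut 1 ∷ source
      0 ∷ []) ∷ closeOut 1 (reduce (cut 0 ∷ sink 1 ∷ [])) ∷ []))))))

  -- From out-degree 3 on no case distinction is needed: the in-neighbour has degree at least 2 and
  -- loses 4, after which label 0 is a source of degree at least 3 and loses 5 or more. For smaller
  -- out-degrees the in-neighbour has to be examined.
  tree13 : Tree
  tree13 =
    newIn 0 (newOut 0 (newOut 0 (newOut 0 (closeIn 0 (closeOut 0 (reduce (cut 1 ∷ source 0 ∷ [])))))))

  tree14 : Tree
  tree14 =
    newIn 0 (newOut 0 (newOut 0 (newOut 0 (newOut 0 (closeIn 0 (closeOut 0 (reduce (cut 1 ∷ source 0 ∷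
      []))))))))

  tree15 : Tree
  tree15 =
    newIn 0 (newOut 0 (newOut 0 (newOut 0 (newOut 0 (newOut 0 (closeIn 0 (closeOut 0 (reduce (cut 1 ∷ source 0
      ∷ [])))))))))

  -- Label 4 is the second in-neighbour. Deleting it loses at least 2 + 4, and label 0 then merges
  -- into label 1 for the missing 3; the two arcs assumed absent rule out a triangle.
  treeCover : Tree
  treeCover =
    newIn 0 (closeIn 0 (closeOut 0 (reduce (cut 4 ∷ mergeIn 0 1 ∷ []))))

  tree33 : Tree
  tree33 =
    closeIn 0 (closeOut 0 (split 2 (ask 1 2 (ask 2 1 (reduce (cut 1 ∷ cut 2 ∷ source 0 ∷ [])) (closeOut 2 (ask
      3 2 (newIn 2 (closeIn 2 (ask 1 5 (reduce (cut 4 ∷ mergeIn 2 5 ∷ [])) (ask 3 5 (reduce (cut 1 ∷ cut 4 ∷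
      mergeIn 0 2 ∷ mergeIn 2 5 ∷ [])) (split 3 (closeOut 3 (split 5 (closeIn 5 (ask 4 3 (ask 5 4 (reduce (cut
      1 ∷ cut 3 ∷ source 5 ∷ cut 4 ∷ sink 0 ∷ source 2 ∷ [])) (closeOut 5 (reduce (cut 1 ∷ mergeOut 3 5 ∷
      [])))) (closeIn 3 (split 4 (closeOut 4 (reduce (cut 2 ∷ cut 3 ∷ mergeIn 0 1 ∷ sink 4 ∷ [])) ∷ ask 5 4
      (reduce (cut 1 ∷ mergeOut 3 5 ∷ [])) (closeIn 4 (reduce (cut 0 ∷ cut 5 ∷ mergeIn 3 4 ∷ source 4 ∷ []))) ∷
      closeOut 4 (reduce (cut 2 ∷ cut 3 ∷ mergeIn 0 1 ∷ sink 4 ∷ [])) ∷ reduce (cut 1 ∷ cut 4 ∷ mergeIn 0 2 ∷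
      []) ∷ reduce (cut 1 ∷ cut 4 ∷ mergeIn 0 2 ∷ []) ∷ reduce (cut 1 ∷ cut 4 ∷ mergeIn 0 2 ∷ []) ∷ [])))) ∷
      closeIn 5 (reduce (cut 1 ∷ cut 3 ∷ source 5 ∷ [])) ∷ reduce (cut 1 ∷ cut 5 ∷ sink 3 ∷ []) ∷ closeIn 5
      (reduce (cut 1 ∷ cut 3 ∷ source 5 ∷ [])) ∷ reduce (cut 1 ∷ cut 5 ∷ sink 3 ∷ []) ∷ reduce (cut 1 ∷ cut 5 ∷
      sink 3 ∷ []) ∷ [])) ∷ split 5 (closeIn 5 (reduce (cut 1 ∷ cut 3 ∷ source 5 ∷ [])) ∷ closeIn 5 (reduce
      (cut 1 ∷ cut 3 ∷ source 5 ∷ [])) ∷ ask 4 3 (newIn 3 (closeIn 3 (split 6 (ask 6 1 (ask 1 6 (reduce (cut 0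
      ∷ cut 1 ∷ sink 2 ∷ cut 6 ∷ source 3 ∷ [])) (closeOut 1 (reduce (cut 0 ∷ cut 5 ∷ mergeIn 2 4 ∷ cut 6 ∷
      sink 1 ∷ source 3 ∷ [])))) (closeOut 6 (reduce (cut 1 ∷ cut 3 ∷ sink 6 ∷ []))) ∷ reduce (cut 0 ∷ cut 6 ∷
      source 3 ∷ []) ∷ reduce (cut 0 ∷ cut 6 ∷ source 3 ∷ []) ∷ reduce (cut 0 ∷ cut 6 ∷ source 3 ∷ []) ∷ reduce
      (cut 0 ∷ cut 6 ∷ source 3 ∷ []) ∷ reduce (cut 0 ∷ cut 6 ∷ source 3 ∷ []) ∷ [])))) (closeIn 3 (split 4
      (closeOut 4 (reduce (cut 2 ∷ cut 3 ∷ mergeIn 0 1 ∷ sink 4 ∷ [])) ∷ reduce (cut 1 ∷ cut 4 ∷ mergeIn 0 2 ∷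
      cut 5 ∷ source 2 ∷ source 3 ∷ []) ∷ closeOut 4 (reduce (cut 2 ∷ cut 3 ∷ sink 4 ∷ [])) ∷ reduce (cut 0 ∷
      cut 4 ∷ source 3 ∷ []) ∷ reduce (cut 0 ∷ cut 4 ∷ source 3 ∷ []) ∷ reduce (cut 0 ∷ cut 4 ∷ source 3 ∷ [])
      ∷ []))) ∷ closeIn 5 (reduce (cut 1 ∷ cut 3 ∷ source 5 ∷ [])) ∷ split 4 (ask 5 4 (ask 4 5 (reduce (cut 4 ∷
      cut 5 ∷ source 2 ∷ [])) (closeIn 5 (reduce (cut 1 ∷ cut 3 ∷ cut 4 ∷ sink 0 ∷ sink 2 ∷ source 5 ∷ []))))
      (closeIn 4 (reduce (cut 0 ∷ cut 5 ∷ source 4 ∷ []))) ∷ reduce (cut 4 ∷ cut 5 ∷ source 2 ∷ []) ∷ reduce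
      (cut 4 ∷ cut 5 ∷ source 2 ∷ []) ∷ reduce (cut 1 ∷ cut 4 ∷ mergeIn 0 2 ∷ []) ∷ reduce (cut 1 ∷ cut 4 ∷
      mergeIn 0 2 ∷ []) ∷ reduce (cut 1 ∷ cut 4 ∷ mergeIn 0 2 ∷ []) ∷ []) ∷ split 4 (ask 5 4 (ask 4 5 (reduce
      (cut 4 ∷ cut 5 ∷ source 2 ∷ [])) (closeOut 4 (newOut 5 (closeOut 5 (reduce (cut 2 ∷ cut 6 ∷ sink 5 ∷
      [])))))) (closeIn 4 (reduce (cut 0 ∷ cut 5 ∷ source 4 ∷ []))) ∷ reduce (cut 4 ∷ cut 5 ∷ source 2 ∷ []) ∷
      reduce (cut 4 ∷ cut 5 ∷ source 2 ∷ []) ∷ reduce (cut 1 ∷ cut 4 ∷ mergeIn 0 2 ∷ []) ∷ reduce (cut 1 ∷ cut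
      4 ∷ mergeIn 0 2 ∷ []) ∷ reduce (cut 1 ∷ cut 4 ∷ mergeIn 0 2 ∷ []) ∷ []) ∷ []) ∷ closeOut 3 (reduce (cut 1
      ∷ cut 5 ∷ sink 3 ∷ [])) ∷ split 4 (ask 4 3 (ask 3 4 (reduce (cut 3 ∷ cut 4 ∷ sink 0 ∷ [])) (closeIn 4
      (newIn 3 (closeIn 3 (reduce (cut 0 ∷ cut 6 ∷ source 3 ∷ [])))))) (closeOut 4 (reduce (cut 2 ∷ cut 3 ∷
      sink 4 ∷ []))) ∷ reduce (cut 3 ∷ cut 4 ∷ sink 0 ∷ []) ∷ reduce (cut 3 ∷ cut 4 ∷ sink 0 ∷ []) ∷ reduce
      (cut 1 ∷ cut 4 ∷ mergeIn 0 2 ∷ []) ∷ reduce (cut 1 ∷ cut 4 ∷ mergeIn 0 2 ∷ []) ∷ reduce (cut 1 ∷ cut 4 ∷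
      mergeIn 0 2 ∷ []) ∷ []) ∷ split 4 (ask 4 3 (ask 3 4 (reduce (cut 3 ∷ cut 4 ∷ sink 0 ∷ [])) (closeIn 4
      (closeOut 3 (ask 4 5 (reduce (cut 1 ∷ cut 4 ∷ mergeIn 0 2 ∷ cut 5 ∷ source 2 ∷ sink 3 ∷ [])) (closeOut 4
      (reduce (cut 0 ∷ mergeIn 4 3 ∷ []))))))) (closeOut 4 (reduce (cut 2 ∷ cut 3 ∷ sink 4 ∷ []))) ∷ reduce
      (cut 3 ∷ cut 4 ∷ sink 0 ∷ []) ∷ reduce (cut 3 ∷ cut 4 ∷ sink 0 ∷ []) ∷ reduce (cut 1 ∷ cut 4 ∷ mergeIn 0
      2 ∷ []) ∷ reduce (cut 1 ∷ cut 4 ∷ mergeIn 0 2 ∷ []) ∷ reduce (cut 1 ∷ cut 4 ∷ mergeIn 0 2 ∷ []) ∷ []) ∷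
      closeOut 3 (reduce (cut 1 ∷ cut 5 ∷ sink 3 ∷ [])) ∷ [])))))) (closeIn 2 (reduce (cut 3 ∷ cut 4 ∷ sink 0 ∷
      source 2 ∷ [])))))) (closeIn 2 (reduce (cut 1 ∷ cut 4 ∷ mergeIn 0 2 ∷ source 2 ∷ []))) ∷ reduce (cut 1 ∷
      cut 2 ∷ source 0 ∷ []) ∷ reduce (cut 1 ∷ cut 2 ∷ source 0 ∷ []) ∷ reduce (cut 1 ∷ cut 2 ∷ source 0 ∷ [])
      ∷ reduce (cut 1 ∷ cut 2 ∷ source 0 ∷ []) ∷ reduce (cut 1 ∷ cut 2 ∷ source 0 ∷ []) ∷ [])))

  tree24 : Tree
  tree24 =
    closeIn 0 (closeOut 0 (split 2 (ask 2 1 (ask 1 2 (reduce (cut 1 ∷ cut 2 ∷ source 0 ∷ [])) (closeIn 2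
      (reduce (cut 1 ∷ cut 4 ∷ mergeIn 0 2 ∷ source 2 ∷ [])))) (closeIn 1 (reduce (cut 2 ∷ cut 3 ∷ mergeIn 0 1
      ∷ source 1 ∷ []))) ∷ reduce (cut 1 ∷ cut 2 ∷ source 0 ∷ []) ∷ reduce (cut 1 ∷ cut 2 ∷ source 0 ∷ []) ∷
      reduce (cut 1 ∷ cut 2 ∷ source 0 ∷ []) ∷ reduce (cut 1 ∷ cut 2 ∷ source 0 ∷ []) ∷ reduce (cut 1 ∷ cut 2 ∷
      source 0 ∷ []) ∷ [])))

  tree42 : Tree
  tree42 =
    closeIn 0 (closeOut 0 (split 2 (ask 1 2 (ask 2 1 (reduce (cut 1 ∷ cut 2 ∷ source 0 ∷ [])) (closeOut 2 (ask
      1 4 (newOut 1 (closeOut 1 (reduce (cut 0 ∷ cut 5 ∷ sink 1 ∷ [])))) (closeOut 1 (reduce (cut 0 ∷ cut 4 ∷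
      sink 1 ∷ sink 2 ∷ [])))))) (closeIn 2 (reduce (cut 1 ∷ cut 4 ∷ mergeIn 0 2 ∷ source 2 ∷ []))) ∷ reduce
      (cut 1 ∷ cut 2 ∷ source 0 ∷ []) ∷ reduce (cut 1 ∷ cut 2 ∷ source 0 ∷ []) ∷ reduce (cut 1 ∷ cut 2 ∷ source
      0 ∷ []) ∷ reduce (cut 1 ∷ cut 2 ∷ source 0 ∷ []) ∷ reduce (cut 1 ∷ cut 2 ∷ source 0 ∷ []) ∷ [])))

  -- An in-neighbour of degree 5 is one unit short: beside a non-adjacent in-neighbour of degree 4,
  -- deleting both loses only 7 + 6 + 4 = 17. In return, kinds of degree 6 no longer occur next to
  -- vertices of kind (2 , 2).
  tree23 : Tree
  tree23 =
    closeIn 0 (closeOut 0 (split 2 (ask 2 1 (ask 2 3 (newOut 2 (closeOut 2 (ask 1 2 (ask 3 2 (newIn 2 (closeIn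
      2 (ask 5 6 (reduce (cut 4 ∷ mergeIn 2 6 ∷ [])) (split 5 (ask 1 5 (ask 4 5 (ask 3 5 (newIn 5 (closeIn 5
      (ask 5 1 (ask 7 1 (ask 1 7 (reduce (cut 1 ∷ cut 2 ∷ source 0 ∷ cut 7 ∷ source 5 ∷ [])) (ask 5 4 (ask 5 3
      (newOut 5 (closeOut 5 (ask 8 7 (reduce (cut 6 ∷ mergeOut 5 8 ∷ [])) (split 7 (closeIn 7 (reduce (cut 1 ∷
      cut 2 ∷ source 0 ∷ cut 8 ∷ mergeIn 5 7 ∷ source 7 ∷ [])) ∷ reduce (cut 1 ∷ cut 2 ∷ source 0 ∷ cut 7 ∷
      source 5 ∷ []) ∷ reduce (cut 1 ∷ cut 2 ∷ source 0 ∷ cut 7 ∷ source 5 ∷ []) ∷ []))))) (closeOut 5 (split 3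
      (closeIn 3 (reduce (cut 0 ∷ cut 5 ∷ sink 2 ∷ source 3 ∷ [])) ∷ closeIn 3 (reduce (cut 0 ∷ cut 5 ∷ sink 2
      ∷ source 3 ∷ [])) ∷ ask 3 7 (reduce (cut 6 ∷ mergeOut 5 3 ∷ [])) (closeOut 3 (reduce (cut 1 ∷ cut 2 ∷
      source 0 ∷ cut 7 ∷ sink 3 ∷ source 5 ∷ []))) ∷ [])))) (closeOut 5 (reduce (cut 4 ∷ cut 6 ∷ source 2 ∷
      sink 5 ∷ []))))) (closeIn 1 (reduce (cut 2 ∷ cut 3 ∷ mergeIn 0 1 ∷ cut 7 ∷ source 1 ∷ source 5 ∷ []))))
      (closeIn 1 (closeOut 5 (reduce (cut 2 ∷ cut 3 ∷ mergeIn 0 1 ∷ cut 7 ∷ source 5 ∷ source 1 ∷ [])))))))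
      (closeIn 5 (ask 4 1 (reduce (cut 2 ∷ cut 3 ∷ mergeIn 0 1 ∷ source 5 ∷ [])) (closeIn 1 (reduce (cut 3 ∷
      cut 4 ∷ sink 0 ∷ source 1 ∷ [])))))) (closeIn 5 (reduce (cut 4 ∷ cut 6 ∷ source 2 ∷ source 5 ∷ []))))
      (closeIn 5 (reduce (cut 1 ∷ cut 2 ∷ source 0 ∷ source 5 ∷ []))) ∷ ask 1 5 (ask 4 5 (ask 3 5 (newIn 5
      (closeIn 5 (split 7 (ask 5 1 (reduce (cut 1 ∷ cut 2 ∷ source 0 ∷ cut 7 ∷ source 5 ∷ [])) (closeIn 1
      (reduce (cut 2 ∷ cut 3 ∷ mergeIn 0 1 ∷ cut 7 ∷ source 5 ∷ source 1 ∷ []))) ∷ reduce (cut 2 ∷ cut 7 ∷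
      source 5 ∷ []) ∷ reduce (cut 2 ∷ cut 7 ∷ source 5 ∷ []) ∷ reduce (cut 2 ∷ cut 7 ∷ source 5 ∷ []) ∷ reduce
      (cut 2 ∷ cut 7 ∷ source 5 ∷ []) ∷ reduce (cut 2 ∷ cut 7 ∷ source 5 ∷ []) ∷ [])))) (closeIn 5 (split 3
      (closeOut 3 (ask 5 1 (reduce (cut 1 ∷ cut 5 ∷ sink 3 ∷ [])) (closeIn 1 (reduce (cut 3 ∷ mergeIn 1 5 ∷
      [])))) ∷ reduce (cut 2 ∷ cut 3 ∷ source 5 ∷ []) ∷ closeOut 3 (reduce (cut 1 ∷ cut 5 ∷ sink 3 ∷ [])) ∷
      [])))) (closeIn 5 (reduce (cut 4 ∷ cut 6 ∷ source 2 ∷ source 5 ∷ [])))) (closeIn 5 (reduce (cut 1 ∷ cut 2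
      ∷ source 5 ∷ []))) ∷ split 3 (ask 5 3 (ask 4 3 (ask 6 3 (newIn 3 (closeIn 3 (ask 3 5 (ask 7 5 (ask 5 7
      (reduce (cut 0 ∷ cut 5 ∷ sink 2 ∷ cut 7 ∷ source 3 ∷ [])) (closeOut 5 (reduce (cut 0 ∷ cut 6 ∷ mergeIn 2
      4 ∷ cut 7 ∷ source 3 ∷ sink 5 ∷ [])))) (ask 3 4 (ask 3 6 (newOut 3 (closeOut 3 (ask 8 7 (reduce (cut 1 ∷
      mergeOut 3 8 ∷ [])) (ask 4 1 (ask 5 1 (ask 5 4 (ask 1 4 (ask 1 5 (ask 8 1 (ask 4 5 (ask 1 8 (split 8 (ask
      4 8 (ask 8 4 (ask 8 5 (ask 5 8 (reduce (cut 1 ∷ cut 4 ∷ mergeIn 0 2 ∷ cut 5 ∷ mergeIn 2 6 ∷ cut 8 ∷ sink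
      3 ∷ [])) (closeIn 8 (reduce (cut 0 ∷ cut 5 ∷ sink 2 ∷ cut 7 ∷ source 3 ∷ source 8 ∷ [])))) (closeOut 8
      (reduce (cut 0 ∷ cut 5 ∷ sink 2 ∷ cut 7 ∷ source 3 ∷ sink 8 ∷ [])))) (closeOut 8 (reduce (cut 1 ∷ cut 4 ∷
      mergeIn 0 2 ∷ cut 7 ∷ mergeIn 3 2 ∷ sink 8 ∷ [])))) (closeIn 8 (reduce (cut 3 ∷ cut 4 ∷ sink 0 ∷ source 8
      ∷ []))) ∷ reduce (cut 1 ∷ cut 8 ∷ sink 3 ∷ []) ∷ reduce (cut 1 ∷ cut 8 ∷ sink 3 ∷ []) ∷ [])) (split 8
      (closeIn 8 (reduce (cut 1 ∷ cut 7 ∷ mergeIn 3 0 ∷ mergeIn 8 0 ∷ [])) ∷ closeIn 8 (reduce (cut 1 ∷ cut 7 ∷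
      mergeIn 3 0 ∷ mergeIn 8 0 ∷ [])) ∷ ask 1 7 (ask 8 5 (ask 5 8 (reduce (cut 0 ∷ cut 5 ∷ sink 2 ∷ cut 8 ∷
      mergeIn 3 7 ∷ [])) (closeOut 5 (reduce (cut 0 ∷ cut 6 ∷ mergeIn 2 4 ∷ cut 8 ∷ mergeIn 3 7 ∷ sink 5 ∷
      [])))) (closeOut 8 (reduce (cut 0 ∷ cut 5 ∷ sink 2 ∷ cut 7 ∷ sink 8 ∷ [])))) (closeOut 1 (split 7
      (closeIn 7 (reduce (cut 1 ∷ cut 8 ∷ sink 3 ∷ source 7 ∷ [])) ∷ closeIn 7 (reduce (cut 1 ∷ cut 8 ∷ source
      7 ∷ [])) ∷ closeOut 7 (reduce (cut 3 ∷ cut 5 ∷ sink 7 ∷ [])) ∷ []))) ∷ []))) (closeIn 5 (split 4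
      (closeOut 4 (reduce (cut 0 ∷ cut 5 ∷ sink 2 ∷ sink 4 ∷ [])) ∷ ask 1 8 (split 8 (ask 4 8 (ask 8 4 (reduce
      (cut 1 ∷ cut 4 ∷ mergeIn 0 2 ∷ cut 8 ∷ sink 3 ∷ [])) (closeIn 4 (reduce (cut 1 ∷ cut 2 ∷ source 0 ∷ cut 8
      ∷ source 4 ∷ [])))) (closeIn 8 (reduce (cut 3 ∷ cut 4 ∷ sink 0 ∷ source 8 ∷ []))) ∷ reduce (cut 1 ∷ cut 8
      ∷ sink 3 ∷ []) ∷ reduce (cut 1 ∷ cut 8 ∷ sink 3 ∷ []) ∷ [])) (split 8 (closeIn 8 (reduce (cut 1 ∷ cut 7 ∷
      mergeIn 3 0 ∷ mergeIn 8 0 ∷ [])) ∷ closeIn 8 (reduce (cut 1 ∷ cut 7 ∷ mergeIn 3 0 ∷ mergeIn 8 0 ∷ [])) ∷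
      ask 1 7 (ask 5 8 (reduce (cut 0 ∷ cut 5 ∷ sink 2 ∷ cut 8 ∷ mergeIn 3 7 ∷ [])) (closeOut 5 (reduce (cut 0
      ∷ cut 6 ∷ mergeIn 2 4 ∷ cut 8 ∷ mergeIn 3 7 ∷ sink 5 ∷ [])))) (closeOut 1 (split 7 (closeIn 7 (reduce
      (cut 1 ∷ cut 8 ∷ sink 3 ∷ source 7 ∷ [])) ∷ closeIn 7 (reduce (cut 1 ∷ cut 8 ∷ source 7 ∷ [])) ∷ closeOut
      7 (reduce (cut 3 ∷ cut 5 ∷ sink 7 ∷ [])) ∷ []))) ∷ [])) ∷ closeOut 4 (reduce (cut 0 ∷ cut 5 ∷ sink 2 ∷
      sink 4 ∷ [])) ∷ [])))) (closeIn 1 (split 8 (closeOut 8 (reduce (cut 1 ∷ cut 7 ∷ mergeIn 3 0 ∷ sink 8 ∷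
      [])) ∷ ask 5 8 (ask 1 7 (ask 8 5 (reduce (cut 0 ∷ cut 5 ∷ sink 2 ∷ cut 8 ∷ mergeIn 1 3 ∷ [])) (closeIn 5
      (closeOut 8 (ask 6 8 (reduce (cut 1 ∷ cut 4 ∷ mergeIn 0 2 ∷ cut 5 ∷ mergeIn 2 6 ∷ cut 7 ∷ mergeIn 3 6 ∷
      sink 8 ∷ [])) (closeIn 8 (reduce (cut 3 ∷ cut 6 ∷ source 8 ∷ source 1 ∷ []))))))) (split 7 (closeIn 7
      (closeOut 7 (reduce (cut 3 ∷ mergeOut 7 5 ∷ []))) ∷ closeIn 7 (reduce (cut 1 ∷ cut 8 ∷ source 7 ∷ [])) ∷
      closeOut 7 (reduce (cut 3 ∷ cut 5 ∷ sink 7 ∷ [])) ∷ []))) (closeIn 8 (reduce (cut 3 ∷ mergeIn 1 8 ∷ [])))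
      ∷ closeOut 8 (reduce (cut 1 ∷ cut 7 ∷ mergeIn 3 0 ∷ sink 8 ∷ [])) ∷ [])))) (closeIn 5 (reduce (cut 1 ∷
      cut 2 ∷ source 0 ∷ cut 7 ∷ source 3 ∷ source 5 ∷ [])))) (split 4 (closeIn 4 (reduce (cut 1 ∷ cut 2 ∷
      source 0 ∷ source 4 ∷ [])) ∷ closeIn 4 (reduce (cut 1 ∷ cut 2 ∷ source 0 ∷ source 4 ∷ [])) ∷ ask 4 5
      (reduce (cut 3 ∷ cut 4 ∷ sink 0 ∷ cut 5 ∷ sink 2 ∷ [])) (closeOut 4 (reduce (cut 0 ∷ cut 5 ∷ sink 2 ∷
      sink 4 ∷ []))) ∷ []))) (closeOut 5 (reduce (cut 4 ∷ cut 6 ∷ source 2 ∷ sink 5 ∷ [])))) (closeIn 1 (reduce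
      (cut 3 ∷ cut 5 ∷ source 1 ∷ [])))) (closeIn 1 (reduce (cut 3 ∷ cut 4 ∷ sink 0 ∷ source 1 ∷ [])))))))
      (closeOut 3 (ask 6 7 (reduce (cut 1 ∷ mergeOut 3 6 ∷ [])) (ask 5 4 (ask 1 7 (reduce (cut 0 ∷ cut 6 ∷
      mergeIn 2 4 ∷ mergeIn 3 7 ∷ [])) (split 7 (closeIn 7 (reduce (cut 1 ∷ cut 6 ∷ sink 3 ∷ source 7 ∷ [])) ∷
      closeIn 7 (reduce (cut 1 ∷ cut 6 ∷ sink 3 ∷ source 7 ∷ [])) ∷ closeOut 7 (reduce (cut 3 ∷ cut 5 ∷ sink 7
      ∷ [])) ∷ []))) (closeOut 5 (reduce (cut 4 ∷ cut 6 ∷ source 2 ∷ sink 5 ∷ []))))))) (closeOut 3 (reduce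
      (cut 1 ∷ cut 4 ∷ mergeIn 0 2 ∷ sink 3 ∷ []))))) (closeOut 3 (reduce (cut 1 ∷ cut 4 ∷ mergeIn 0 2 ∷ cut 5
      ∷ mergeIn 2 6 ∷ sink 3 ∷ [])))))) (closeIn 3 (ask 5 4 (reduce (cut 0 ∷ cut 6 ∷ mergeIn 2 4 ∷ source 3 ∷
      [])) (closeOut 5 (reduce (cut 4 ∷ cut 6 ∷ source 2 ∷ sink 5 ∷ [])))))) (closeIn 3 (split 4 (closeOut 4
      (reduce (cut 2 ∷ cut 3 ∷ mergeIn 0 1 ∷ sink 4 ∷ [])) ∷ ask 3 6 (reduce (cut 1 ∷ cut 4 ∷ mergeIn 0 2 ∷
      mergeIn 3 2 ∷ [])) (closeOut 3 (ask 6 4 (reduce (cut 1 ∷ mergeOut 3 6 ∷ [])) (closeIn 4 (reduce (cut 0 ∷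
      cut 6 ∷ mergeIn 3 4 ∷ source 4 ∷ []))))) ∷ closeOut 4 (reduce (cut 2 ∷ cut 3 ∷ mergeIn 0 1 ∷ sink 4 ∷
      [])) ∷ [])))) (closeIn 3 (reduce (cut 0 ∷ cut 5 ∷ sink 2 ∷ source 3 ∷ []))) ∷ ask 5 3 (ask 5 4 (ask 4 3
      (ask 3 4 (split 4 (ask 4 5 (ask 3 5 (reduce (cut 3 ∷ cut 4 ∷ sink 0 ∷ cut 5 ∷ sink 2 ∷ [])) (ask 6 3
      (newIn 3 (closeIn 3 (split 7 (ask 7 5 (ask 5 7 (reduce (cut 0 ∷ cut 5 ∷ sink 2 ∷ cut 7 ∷ source 3 ∷ []))
      (closeOut 5 (reduce (cut 0 ∷ cut 6 ∷ mergeIn 2 4 ∷ cut 7 ∷ source 3 ∷ sink 5 ∷ [])))) (closeIn 5 (reduce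
      (cut 1 ∷ cut 2 ∷ source 0 ∷ cut 7 ∷ source 3 ∷ source 5 ∷ []))) ∷ reduce (cut 0 ∷ cut 7 ∷ source 3 ∷ [])
      ∷ reduce (cut 0 ∷ cut 7 ∷ source 3 ∷ []) ∷ reduce (cut 0 ∷ cut 7 ∷ source 3 ∷ []) ∷ reduce (cut 0 ∷ cut 7
      ∷ source 3 ∷ []) ∷ reduce (cut 0 ∷ cut 7 ∷ source 3 ∷ []) ∷ [])))) (closeIn 3 (reduce (cut 0 ∷ cut 6 ∷
      mergeIn 2 4 ∷ source 3 ∷ []))))) (closeOut 4 (reduce (cut 0 ∷ cut 5 ∷ sink 2 ∷ sink 4 ∷ []))) ∷ reduce
      (cut 3 ∷ cut 4 ∷ sink 0 ∷ []) ∷ reduce (cut 3 ∷ cut 4 ∷ sink 0 ∷ []) ∷ [])) (ask 6 3 (newIn 3 (closeIn 3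
      (split 4 (closeIn 4 (reduce (cut 0 ∷ cut 7 ∷ source 3 ∷ source 4 ∷ [])) ∷ closeIn 4 (reduce (cut 0 ∷ cut
      7 ∷ source 3 ∷ source 4 ∷ [])) ∷ split 7 (ask 7 5 (ask 5 7 (reduce (cut 0 ∷ cut 5 ∷ sink 2 ∷ cut 7 ∷
      source 3 ∷ [])) (closeOut 5 (reduce (cut 0 ∷ cut 6 ∷ mergeIn 2 4 ∷ cut 7 ∷ source 3 ∷ sink 5 ∷ []))))
      (closeOut 7 (reduce (cut 3 ∷ cut 4 ∷ sink 0 ∷ cut 5 ∷ sink 2 ∷ sink 7 ∷ []))) ∷ reduce (cut 0 ∷ cut 7 ∷
      source 3 ∷ []) ∷ reduce (cut 0 ∷ cut 7 ∷ source 3 ∷ []) ∷ reduce (cut 0 ∷ cut 7 ∷ source 3 ∷ []) ∷ reduce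
      (cut 0 ∷ cut 7 ∷ source 3 ∷ []) ∷ reduce (cut 0 ∷ cut 7 ∷ source 3 ∷ []) ∷ []) ∷ [])))) (closeIn 3
      (reduce (cut 0 ∷ cut 6 ∷ mergeIn 2 4 ∷ source 3 ∷ []))))) (closeIn 3 (split 4 (closeOut 4 (reduce (cut 2
      ∷ cut 3 ∷ mergeIn 0 1 ∷ sink 4 ∷ [])) ∷ ask 3 6 (reduce (cut 1 ∷ cut 4 ∷ mergeIn 0 2 ∷ mergeIn 3 2 ∷ []))
      (ask 3 5 (split 6 (closeIn 6 (reduce (cut 3 ∷ cut 5 ∷ source 6 ∷ [])) ∷ closeIn 6 (reduce (cut 3 ∷ cut 5
      ∷ source 6 ∷ [])) ∷ reduce (cut 1 ∷ cut 4 ∷ mergeIn 0 2 ∷ cut 6 ∷ source 2 ∷ source 3 ∷ []) ∷ []))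
      (closeOut 3 (ask 1 4 (reduce (cut 0 ∷ cut 6 ∷ mergeIn 2 4 ∷ mergeIn 3 4 ∷ [])) (closeIn 4 (reduce (cut 0
      ∷ cut 1 ∷ mergeIn 3 4 ∷ source 4 ∷ [])))))) ∷ closeOut 4 (reduce (cut 2 ∷ cut 3 ∷ sink 4 ∷ [])) ∷ []))))
      (closeOut 5 (reduce (cut 4 ∷ cut 6 ∷ source 2 ∷ sink 5 ∷ [])))) (closeIn 3 (reduce (cut 0 ∷ cut 5 ∷
      source 3 ∷ []))) ∷ ask 3 4 (ask 3 5 (ask 5 4 (ask 4 3 (split 4 (ask 4 5 (ask 5 3 (reduce (cut 3 ∷ cut 4 ∷
      sink 0 ∷ cut 5 ∷ sink 2 ∷ [])) (closeOut 5 (reduce (cut 3 ∷ cut 4 ∷ sink 0 ∷ cut 6 ∷ source 2 ∷ sink 5 ∷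
      [])))) (closeOut 4 (reduce (cut 0 ∷ cut 5 ∷ sink 2 ∷ sink 4 ∷ []))) ∷ reduce (cut 3 ∷ cut 4 ∷ sink 0 ∷
      []) ∷ reduce (cut 3 ∷ cut 4 ∷ sink 0 ∷ []) ∷ [])) (split 4 (closeOut 4 (reduce (cut 2 ∷ cut 3 ∷ mergeIn 0
      1 ∷ sink 4 ∷ [])) ∷ ask 5 3 (ask 4 5 (reduce (cut 3 ∷ cut 4 ∷ sink 0 ∷ cut 5 ∷ sink 2 ∷ [])) (closeOut 4
      (ask 3 6 (newOut 3 (closeOut 3 (split 7 (ask 1 4 (ask 7 4 (reduce (cut 0 ∷ cut 5 ∷ sink 2 ∷ mergeOut 4 3
      ∷ [])) (closeIn 4 (reduce (cut 1 ∷ cut 2 ∷ source 0 ∷ cut 7 ∷ sink 3 ∷ source 4 ∷ [])))) (closeIn 4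
      (reduce (cut 1 ∷ cut 2 ∷ source 0 ∷ source 4 ∷ []))) ∷ reduce (cut 1 ∷ cut 7 ∷ sink 3 ∷ []) ∷ reduce (cut
      1 ∷ cut 7 ∷ sink 3 ∷ []) ∷ reduce (cut 1 ∷ cut 7 ∷ sink 3 ∷ []) ∷ reduce (cut 1 ∷ cut 7 ∷ sink 3 ∷ []) ∷
      reduce (cut 1 ∷ cut 7 ∷ sink 3 ∷ []) ∷ [])))) (closeOut 3 (split 6 (closeIn 6 (reduce (cut 3 ∷ cut 5 ∷
      source 6 ∷ [])) ∷ reduce (cut 1 ∷ cut 6 ∷ sink 3 ∷ []) ∷ reduce (cut 1 ∷ cut 6 ∷ sink 3 ∷ []) ∷ []))))))
      (closeOut 5 (reduce (cut 3 ∷ cut 4 ∷ sink 0 ∷ cut 6 ∷ source 2 ∷ sink 5 ∷ []))) ∷ closeOut 4 (reduce (cut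
      2 ∷ cut 3 ∷ sink 4 ∷ [])) ∷ []))) (closeOut 5 (reduce (cut 4 ∷ cut 6 ∷ source 2 ∷ sink 5 ∷ []))))
      (closeOut 3 (reduce (cut 1 ∷ cut 5 ∷ sink 3 ∷ [])))) (closeOut 3 (reduce (cut 1 ∷ cut 4 ∷ mergeIn 0 2 ∷
      sink 3 ∷ []))) ∷ []) ∷ []))))) (closeIn 2 (reduce (cut 3 ∷ cut 4 ∷ sink 0 ∷ source 2 ∷ [])))) (closeIn 2
      (reduce (cut 1 ∷ cut 4 ∷ mergeIn 0 2 ∷ source 2 ∷ [])))))) (closeOut 2 (reduce (cut 3 ∷ cut 4 ∷ sink 0 ∷
      sink 2 ∷ [])))) (closeIn 1 (reduce (cut 2 ∷ cut 3 ∷ mergeIn 0 1 ∷ source 1 ∷ []))) ∷ ask 2 1 (ask 1 2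
      (reduce (cut 1 ∷ cut 2 ∷ source 0 ∷ [])) (closeIn 2 (reduce (cut 1 ∷ cut 4 ∷ mergeIn 0 2 ∷ source 2 ∷
      [])))) (closeIn 1 (reduce (cut 2 ∷ cut 3 ∷ mergeIn 0 1 ∷ source 1 ∷ []))) ∷ ask 2 1 (ask 1 2 (reduce (cut
      1 ∷ cut 2 ∷ source 0 ∷ [])) (split 3 (ask 3 2 (ask 3 4 (newOut 3 (closeOut 3 (ask 2 3 (ask 4 3 (newIn 3
      (closeIn 3 (ask 5 6 (reduce (cut 1 ∷ mergeOut 3 5 ∷ [])) (ask 2 6 (ask 2 5 (newOut 2 (closeOut 2 (split 7
      (ask 6 2 (ask 7 6 (ask 6 7 (reduce (cut 0 ∷ cut 6 ∷ source 3 ∷ cut 7 ∷ sink 2 ∷ [])) (closeIn 7 (reduce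
      (cut 1 ∷ cut 2 ∷ source 0 ∷ cut 6 ∷ source 3 ∷ source 7 ∷ [])))) (split 6 (closeIn 6 (reduce (cut 0 ∷ cut
      5 ∷ mergeIn 3 6 ∷ cut 7 ∷ sink 2 ∷ source 6 ∷ [])) ∷ closeIn 6 (reduce (cut 0 ∷ cut 5 ∷ mergeIn 3 6 ∷ cut
      7 ∷ sink 2 ∷ source 6 ∷ [])) ∷ reduce (cut 0 ∷ cut 6 ∷ source 3 ∷ cut 7 ∷ sink 2 ∷ []) ∷ []))) (closeIn 2
      (ask 7 6 (reduce (cut 1 ∷ cut 4 ∷ mergeIn 0 2 ∷ mergeIn 2 6 ∷ [])) (ask 7 1 (ask 7 4 (reduce (cut 0 ∷ cut
      6 ∷ mergeOut 2 7 ∷ source 3 ∷ [])) (closeOut 7 (reduce (cut 1 ∷ cut 4 ∷ mergeIn 0 2 ∷ cut 6 ∷ source 2 ∷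
      source 3 ∷ sink 7 ∷ [])))) (closeOut 7 (reduce (cut 1 ∷ cut 6 ∷ mergeIn 3 0 ∷ sink 7 ∷ [])))))) ∷ reduce
      (cut 0 ∷ cut 7 ∷ sink 2 ∷ []) ∷ reduce (cut 0 ∷ cut 7 ∷ sink 2 ∷ []) ∷ reduce (cut 0 ∷ cut 7 ∷ sink 2 ∷
      []) ∷ reduce (cut 0 ∷ cut 7 ∷ sink 2 ∷ []) ∷ reduce (cut 0 ∷ cut 7 ∷ sink 2 ∷ []) ∷ [])))) (closeOut 2
      (split 5 (closeIn 5 (ask 1 6 (reduce (cut 0 ∷ cut 5 ∷ sink 2 ∷ mergeIn 3 6 ∷ [])) (closeOut 1 (split 6
      (closeIn 6 (reduce (cut 1 ∷ cut 5 ∷ sink 3 ∷ source 6 ∷ [])) ∷ closeIn 6 (reduce (cut 1 ∷ cut 5 ∷ sink 3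
      ∷ source 6 ∷ [])) ∷ reduce (cut 0 ∷ cut 5 ∷ sink 2 ∷ cut 6 ∷ sink 1 ∷ source 3 ∷ []) ∷ [])))) ∷ reduce
      (cut 0 ∷ cut 5 ∷ sink 2 ∷ []) ∷ reduce (cut 0 ∷ cut 5 ∷ sink 2 ∷ []) ∷ [])))) (closeOut 2 (reduce (cut 0
      ∷ cut 6 ∷ sink 2 ∷ source 3 ∷ []))))))) (closeIn 3 (split 4 (closeOut 4 (reduce (cut 2 ∷ cut 3 ∷ mergeIn
      0 1 ∷ sink 4 ∷ [])) ∷ ask 5 4 (reduce (cut 1 ∷ mergeOut 3 5 ∷ [])) (closeIn 4 (reduce (cut 0 ∷ cut 5 ∷
      mergeIn 3 4 ∷ source 4 ∷ []))) ∷ closeOut 4 (reduce (cut 2 ∷ cut 3 ∷ sink 4 ∷ [])) ∷ [])))) (closeIn 3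
      (reduce (cut 1 ∷ cut 2 ∷ source 0 ∷ source 3 ∷ [])))))) (closeOut 3 (reduce (cut 1 ∷ cut 4 ∷ mergeIn 0 2
      ∷ sink 3 ∷ [])))) (closeOut 3 (reduce (cut 1 ∷ cut 2 ∷ source 0 ∷ sink 3 ∷ []))) ∷ ask 4 1 (newIn 1
      (closeIn 1 (split 5 (ask 5 3 (ask 3 5 (reduce (cut 3 ∷ cut 5 ∷ source 1 ∷ [])) (ask 2 5 (ask 1 4 (newOut
      1 (closeOut 1 (ask 6 5 (reduce (cut 3 ∷ mergeIn 1 5 ∷ [])) (closeIn 5 (reduce (cut 3 ∷ cut 6 ∷ mergeIn 1
      5 ∷ source 5 ∷ [])))))) (closeOut 1 (reduce (cut 3 ∷ cut 4 ∷ sink 0 ∷ mergeIn 1 5 ∷ [])))) (closeIn 5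
      (reduce (cut 2 ∷ cut 3 ∷ mergeIn 1 5 ∷ source 5 ∷ []))))) (closeIn 3 (reduce (cut 0 ∷ cut 5 ∷ mergeIn 1 3
      ∷ source 3 ∷ []))) ∷ reduce (cut 3 ∷ cut 5 ∷ source 1 ∷ []) ∷ reduce (cut 3 ∷ cut 5 ∷ source 1 ∷ []) ∷
      reduce (cut 3 ∷ cut 5 ∷ source 1 ∷ []) ∷ reduce (cut 3 ∷ cut 5 ∷ source 1 ∷ []) ∷ reduce (cut 3 ∷ cut 5 ∷
      source 1 ∷ []) ∷ [])))) (closeIn 1 (reduce (cut 3 ∷ cut 4 ∷ sink 0 ∷ source 1 ∷ []))) ∷ ask 4 1 (newIn 1
      (closeIn 1 (split 5 (ask 5 3 (ask 3 5 (reduce (cut 3 ∷ cut 5 ∷ source 1 ∷ [])) (closeOut 3 (ask 5 2 (ask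
      5 4 (newOut 5 (closeOut 5 (reduce (cut 1 ∷ cut 6 ∷ sink 5 ∷ sink 3 ∷ [])))) (closeOut 5 (reduce (cut 1 ∷
      cut 4 ∷ mergeOut 3 5 ∷ sink 5 ∷ [])))) (closeOut 5 (reduce (cut 1 ∷ cut 2 ∷ mergeOut 3 5 ∷ sink 5 ∷
      [])))))) (closeOut 5 (ask 3 2 (ask 3 4 (newOut 3 (closeOut 3 (reduce (cut 1 ∷ cut 6 ∷ sink 3 ∷ sink 5 ∷
      [])))) (closeOut 3 (reduce (cut 1 ∷ cut 4 ∷ sink 3 ∷ sink 5 ∷ [])))) (closeOut 3 (reduce (cut 1 ∷ cut 2 ∷
      sink 3 ∷ []))))) ∷ reduce (cut 3 ∷ cut 5 ∷ source 1 ∷ []) ∷ reduce (cut 3 ∷ cut 5 ∷ source 1 ∷ []) ∷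
      reduce (cut 3 ∷ cut 5 ∷ source 1 ∷ []) ∷ reduce (cut 3 ∷ cut 5 ∷ source 1 ∷ []) ∷ reduce (cut 3 ∷ cut 5 ∷
      source 1 ∷ []) ∷ [])))) (closeIn 1 (reduce (cut 3 ∷ cut 4 ∷ sink 0 ∷ source 1 ∷ []))) ∷ []))) (closeIn 1
      (reduce (cut 2 ∷ cut 3 ∷ mergeIn 0 1 ∷ source 1 ∷ []))) ∷ [])))

  tree32 : Tree
  tree32 =
    closeIn 0 (closeOut 0 (split 3 (ask 1 4 (ask 1 2 (newOut 1 (closeOut 1 (split 5 (ask 5 3 (ask 3 5 (ask 4 1
      (ask 4 3 (ask 3 4 (split 4 (split 2 (ask 5 4 (ask 4 5 (reduce (cut 3 ∷ cut 4 ∷ sink 0 ∷ cut 5 ∷ sink 1 ∷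
      [])) (closeIn 5 (closeOut 4 (ask 3 2 (reduce (cut 1 ∷ cut 4 ∷ mergeIn 0 2 ∷ source 5 ∷ [])) (closeIn 2
      (clash 3)))))) (closeIn 4 (reduce (cut 0 ∷ cut 5 ∷ sink 1 ∷ source 4 ∷ []))) ∷ []) ∷ reduce (cut 3 ∷ cut
      4 ∷ sink 0 ∷ []) ∷ [])) (split 4 (closeIn 4 (split 2 (ask 2 1 (reduce (cut 1 ∷ cut 2 ∷ source 0 ∷ []))
      (closeOut 2 (reduce (cut 0 ∷ cut 5 ∷ sink 1 ∷ sink 2 ∷ []))) ∷ [])) ∷ []))) (closeIn 3 (split 4 (closeOut
      4 (reduce (cut 2 ∷ cut 3 ∷ mergeIn 0 1 ∷ sink 4 ∷ [])) ∷ split 2 (ask 2 1 (reduce (cut 1 ∷ cut 2 ∷ source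
      0 ∷ [])) (closeOut 2 (reduce (cut 0 ∷ cut 5 ∷ sink 1 ∷ sink 2 ∷ []))) ∷ []) ∷ [])))) (split 4 (split 2
      (ask 2 1 (reduce (cut 1 ∷ cut 2 ∷ source 0 ∷ [])) (closeOut 2 (reduce (cut 0 ∷ cut 5 ∷ sink 1 ∷ sink 2 ∷
      []))) ∷ []) ∷ []))) (closeIn 5 (clash 3))) (closeIn 3 (reduce (cut 0 ∷ cut 5 ∷ sink 1 ∷ source 3 ∷ [])))
      ∷ reduce (cut 0 ∷ cut 5 ∷ sink 1 ∷ []) ∷ reduce (cut 0 ∷ cut 5 ∷ sink 1 ∷ []) ∷ reduce (cut 0 ∷ cut 5 ∷
      sink 1 ∷ []) ∷ reduce (cut 0 ∷ cut 5 ∷ sink 1 ∷ []) ∷ reduce (cut 0 ∷ cut 5 ∷ sink 1 ∷ []) ∷ []))))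
      (closeOut 1 (split 2 (closeIn 2 (reduce (cut 1 ∷ cut 4 ∷ mergeIn 0 2 ∷ source 2 ∷ [])) ∷ split 4 (ask 4 3
      (ask 3 4 (reduce (cut 3 ∷ cut 4 ∷ sink 0 ∷ [])) (closeIn 4 (ask 2 3 (newOut 2 (closeOut 2 (reduce (cut 0
      ∷ cut 5 ∷ sink 2 ∷ sink 1 ∷ [])))) (closeIn 3 (reduce (cut 0 ∷ cut 2 ∷ source 3 ∷ source 4 ∷ []))))))
      (closeIn 3 (newOut 2 (closeOut 2 (reduce (cut 0 ∷ cut 5 ∷ sink 2 ∷ sink 1 ∷ []))))) ∷ []) ∷ []))))
      (closeOut 1 (reduce (cut 3 ∷ cut 4 ∷ sink 0 ∷ sink 1 ∷ []))) ∷ [])))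

  -- By now all neighbours of a vertex of kind (2 , 2) have that kind too, so each `split` has a
  -- single subtree and the tree explores a region that is 4-regular.
  tree22 : Tree
  tree22 =
    closeIn 0 (closeOut 0 (split 1 (split 2 (split 3 (split 4 (ask 1 4 (ask 1 2 (newOut 1 (closeOut 1 (split 5
      (ask 2 1 (ask 4 1 (newIn 1 (closeIn 1 (split 6 (ask 5 6 (reduce (cut 3 ∷ mergeIn 1 6 ∷ [])) (ask 2 3 (ask
      2 5 (ask 2 6 (newOut 2 (closeOut 2 (split 7 (ask 3 2 (ask 6 2 (ask 5 2 (newIn 2 (closeIn 2 (split 8 (ask
      7 8 (reduce (cut 4 ∷ mergeIn 2 8 ∷ [])) (ask 5 3 (ask 5 4 (ask 5 7 (ask 5 8 (newOut 5 (closeOut 5 (split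
      9 (ask 3 5 (ask 4 5 (ask 7 5 (ask 8 5 (newIn 5 (closeIn 5 (split 10 (ask 9 10 (reduce (cut 6 ∷ mergeOut 5
      9 ∷ [])) (ask 3 7 (ask 4 7 (ask 6 7 (ask 9 7 (ask 10 7 (newIn 7 (closeIn 7 (split 11 (ask 7 10 (ask 11 10
      (ask 10 11 (reduce (cut 1 ∷ cut 2 ∷ source 0 ∷ cut 10 ∷ source 5 ∷ cut 11 ∷ source 7 ∷ [])) (closeOut 10
      (ask 7 3 (ask 4 6 (reduce (cut 2 ∷ cut 3 ∷ mergeIn 0 1 ∷ cut 5 ∷ mergeIn 1 6 ∷ cut 11 ∷ source 7 ∷ sink
      10 ∷ [])) (closeIn 6 (closeOut 4 (reduce (cut 0 ∷ cut 6 ∷ mergeIn 1 3 ∷ cut 7 ∷ sink 2 ∷ sink 4 ∷ [])))))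
      (closeIn 3 (reduce (cut 0 ∷ cut 7 ∷ sink 2 ∷ source 3 ∷ [])))))) (closeIn 10 (reduce (cut 1 ∷ cut 2 ∷
      source 0 ∷ cut 9 ∷ mergeIn 5 10 ∷ cut 11 ∷ source 7 ∷ source 10 ∷ [])))) (closeIn 10 (closeOut 7 (reduce
      (cut 0 ∷ cut 6 ∷ mergeIn 1 3 ∷ cut 7 ∷ sink 2 ∷ cut 9 ∷ sink 5 ∷ source 10 ∷ [])))) ∷ [])))) (closeOut 10
      (reduce (cut 0 ∷ cut 5 ∷ sink 1 ∷ cut 7 ∷ sink 2 ∷ sink 10 ∷ [])))) (closeIn 7 (closeOut 9 (ask 6 10
      (reduce (cut 1 ∷ cut 2 ∷ source 0 ∷ cut 9 ∷ mergeIn 5 10 ∷ source 7 ∷ [])) (closeOut 6 (reduce (cut 1 ∷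
      cut 10 ∷ source 5 ∷ sink 6 ∷ []))))))) (closeOut 6 (reduce (cut 0 ∷ cut 5 ∷ sink 1 ∷ cut 7 ∷ sink 2 ∷
      sink 6 ∷ [])))) (closeOut 4 (reduce (cut 0 ∷ cut 7 ∷ sink 2 ∷ sink 4 ∷ [])))) (closeOut 3 (reduce (cut 0
      ∷ cut 7 ∷ sink 2 ∷ mergeOut 3 1 ∷ [])))) ∷ [])))) (closeOut 8 (reduce (cut 0 ∷ cut 5 ∷ sink 1 ∷ cut 7 ∷
      sink 2 ∷ sink 8 ∷ [])))) (closeOut 7 (reduce (cut 0 ∷ cut 5 ∷ sink 1 ∷ cut 8 ∷ mergeIn 2 4 ∷ sink 7 ∷
      [])))) (closeIn 5 (reduce (cut 1 ∷ cut 4 ∷ mergeIn 0 2 ∷ source 5 ∷ [])))) (closeOut 3 (reduce (cut 0 ∷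
      cut 5 ∷ sink 1 ∷ sink 3 ∷ []))) ∷ [])))) (closeIn 8 (reduce (cut 0 ∷ cut 5 ∷ sink 1 ∷ cut 7 ∷ sink 2 ∷
      source 8 ∷ [])))) (closeOut 5 (reduce (cut 0 ∷ cut 6 ∷ mergeIn 1 3 ∷ cut 7 ∷ sink 2 ∷ sink 5 ∷ []))))
      (closeIn 4 (reduce (cut 0 ∷ cut 5 ∷ sink 1 ∷ source 4 ∷ [])))) (closeIn 3 (reduce (cut 0 ∷ cut 5 ∷ sink 1
      ∷ source 3 ∷ [])))) ∷ [])))) (closeIn 2 (closeOut 5 (ask 7 5 (reduce (cut 4 ∷ mergeIn 2 5 ∷ [])) (closeIn
      5 (reduce (cut 0 ∷ cut 6 ∷ mergeIn 1 3 ∷ cut 7 ∷ sink 2 ∷ sink 5 ∷ []))))))) (closeOut 6 (reduce (cut 1 ∷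
      cut 2 ∷ source 0 ∷ sink 6 ∷ [])))) (closeOut 3 (reduce (cut 1 ∷ cut 2 ∷ source 0 ∷ sink 3 ∷ []))) ∷
      [])))) (closeIn 6 (closeOut 2 (ask 5 3 (reduce (cut 0 ∷ cut 6 ∷ mergeIn 1 3 ∷ sink 2 ∷ [])) (closeIn 3
      (reduce (cut 0 ∷ cut 5 ∷ sink 1 ∷ source 3 ∷ []))))))) (closeOut 2 (reduce (cut 0 ∷ cut 5 ∷ sink 1 ∷ sink
      2 ∷ [])))) (closeIn 3 (reduce (cut 1 ∷ cut 2 ∷ source 0 ∷ source 3 ∷ [])))) ∷ [])))) (closeOut 4 (reduce
      (cut 1 ∷ cut 2 ∷ source 0 ∷ sink 4 ∷ [])))) (closeOut 2 (reduce (cut 0 ∷ cut 5 ∷ sink 1 ∷ sink 2 ∷ [])))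
      ∷ [])))) (closeIn 2 (closeOut 1 (ask 4 1 (reduce (cut 1 ∷ cut 4 ∷ mergeIn 0 2 ∷ source 2 ∷ [])) (closeOut
      4 (reduce (cut 0 ∷ cut 2 ∷ sink 1 ∷ sink 4 ∷ []))))))) (closeIn 4 (reduce (cut 1 ∷ cut 2 ∷ source 0 ∷
      source 4 ∷ []))) ∷ []) ∷ []) ∷ []) ∷ [])))

  -- With all degrees at least 5, the two in-neighbours lose 7 and, even if they are adjacent, 6;
  -- the source left over loses 5.
  treeFive : Tree
  treeFive =
    newIn 0 (newIn 0 (newOut 0 (newOut 0 (newOut 0 (closeIn 0 (closeOut 0 (reduce (cut 1 ∷ cut 2 ∷ source 0 ∷
      []))))))))

  treeSix : Tree
  treeSix =
    newIn 0 (newIn 0 (newOut 0 (newOut 0 (newOut 0 (newOut 0 (closeIn 0 (closeOut 0 (reduce (cut 1 ∷ cut 2 ∷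
      source 0 ∷ [])))))))))

  -- The loss 8 + 8 + 6 + 5 = 27 is exactly enough for three deletions. It relies on the first two
  -- in-neighbours being non-adjacent; otherwise the second would lose only 7.
  treeIn : Tree
  treeIn =
    newIn 0 (newOut 0 (newOut 0 (newOut 0 (closeIn 0 (closeOut 0 (reduce (cut 1 ∷ cut 2 ∷ cut 3 ∷ source 0 ∷
      [])))))))

  -- Labels 5 and 6 are the other out-neighbours of 0. If label 1 sends arcs to both, then, being
  -- non-adjacent to 2, it shares no triangle with 0 and can absorb it once 3 and 4 are deleted.
  -- Otherwise the in-neighbours of 5 and 6 decide: a newly labelled one is not adjacent to 0, which
  -- gives a non-adjacent pair of in-neighbours as in `treeIn`.
  treeAcross : Tree
  treeAcross =
    newIn 0 (newIn 0 (newOut 0 (newOut 0 (closeIn 0 (closeOut 0 (split 5 (split 6 (ask 1 5 (ask 3 5 (ask 4 5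
      (ask 2 5 (ask 6 5 (newIn 5 (newIn 5 (closeIn 5 (reduce (cut 0 ∷ cut 7 ∷ cut 8 ∷ source 5 ∷ []))))) (newIn
      5 (closeIn 5 (reduce (cut 0 ∷ cut 6 ∷ cut 7 ∷ source 5 ∷ []))))) (ask 6 5 (newIn 5 (closeIn 5 (reduce
      (cut 0 ∷ cut 2 ∷ cut 7 ∷ source 5 ∷ [])))) (closeIn 5 (ask 1 6 (ask 3 6 (ask 4 6 (ask 2 6 (newIn 6 (newIn
      6 (closeIn 6 (reduce (cut 0 ∷ cut 7 ∷ cut 8 ∷ source 6 ∷ []))))) (newIn 6 (closeIn 6 (reduce (cut 0 ∷ cut
      2 ∷ cut 7 ∷ source 6 ∷ []))))) (ask 2 6 (newIn 6 (closeIn 6 (reduce (cut 0 ∷ cut 4 ∷ cut 7 ∷ source 6 ∷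
      [])))) (closeIn 6 (reduce (cut 0 ∷ cut 4 ∷ cut 2 ∷ mergeIn 5 6 ∷ source 6 ∷ []))))) (ask 4 6 (ask 2 6
      (newIn 6 (closeIn 6 (reduce (cut 0 ∷ cut 3 ∷ cut 7 ∷ source 6 ∷ [])))) (closeIn 6 (reduce (cut 0 ∷ cut 3
      ∷ cut 2 ∷ mergeIn 5 6 ∷ source 6 ∷ [])))) (closeIn 6 (reduce (cut 1 ∷ cut 3 ∷ cut 4 ∷ source 0 ∷ source 6
      ∷ []))))) (ask 3 6 (ask 4 6 (ask 2 6 (newIn 6 (closeIn 6 (reduce (cut 0 ∷ cut 1 ∷ cut 7 ∷ source 6 ∷
      [])))) (closeIn 6 (reduce (cut 0 ∷ cut 1 ∷ cut 2 ∷ source 6 ∷ [])))) (closeIn 6 (reduce (cut 1 ∷ cut 3 ∷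
      cut 4 ∷ source 0 ∷ source 6 ∷ [])))) (closeIn 6 (reduce (cut 1 ∷ cut 3 ∷ cut 4 ∷ source 0 ∷ source 6 ∷
      [])))))))) (ask 2 5 (ask 6 5 (newIn 5 (closeIn 5 (reduce (cut 0 ∷ cut 4 ∷ cut 7 ∷ source 5 ∷ []))))
      (closeIn 5 (ask 1 6 (ask 3 6 (ask 4 6 (ask 2 6 (newIn 6 (newIn 6 (closeIn 6 (reduce (cut 0 ∷ cut 7 ∷ cut
      8 ∷ source 6 ∷ []))))) (newIn 6 (closeIn 6 (reduce (cut 0 ∷ cut 2 ∷ cut 7 ∷ source 6 ∷ []))))) (ask 2 6
      (newIn 6 (closeIn 6 (reduce (cut 0 ∷ cut 4 ∷ cut 7 ∷ source 6 ∷ [])))) (closeIn 6 (reduce (cut 0 ∷ cut 4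
      ∷ cut 2 ∷ source 6 ∷ source 5 ∷ []))))) (ask 4 6 (ask 2 6 (newIn 6 (closeIn 6 (reduce (cut 0 ∷ cut 3 ∷
      cut 7 ∷ source 6 ∷ [])))) (closeIn 6 (reduce (cut 1 ∷ cut 3 ∷ cut 4 ∷ source 0 ∷ cut 2 ∷ source 6 ∷
      source 5 ∷ [])))) (closeIn 6 (reduce (cut 0 ∷ cut 3 ∷ cut 4 ∷ mergeIn 5 6 ∷ source 6 ∷ []))))) (ask 3 6
      (ask 4 6 (ask 2 6 (newIn 6 (closeIn 6 (reduce (cut 0 ∷ cut 1 ∷ cut 7 ∷ source 6 ∷ [])))) (closeIn 6
      (reduce (cut 0 ∷ cut 1 ∷ cut 2 ∷ source 6 ∷ [])))) (closeIn 6 (reduce (cut 0 ∷ cut 1 ∷ cut 4 ∷ mergeIn 5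
      6 ∷ source 6 ∷ [])))) (closeIn 6 (reduce (cut 1 ∷ cut 3 ∷ cut 4 ∷ source 0 ∷ source 6 ∷ [])))))))
      (closeIn 5 (ask 1 6 (ask 3 6 (ask 4 6 (ask 2 6 (ask 5 6 (reduce (cut 2 ∷ cut 5 ∷ cut 6 ∷ sink 0 ∷ []))
      (newIn 6 (closeIn 6 (reduce (cut 0 ∷ cut 5 ∷ cut 7 ∷ source 6 ∷ []))))) (ask 5 6 (reduce (cut 2 ∷ cut 5 ∷
      cut 6 ∷ sink 0 ∷ [])) (closeIn 6 (reduce (cut 0 ∷ cut 4 ∷ cut 2 ∷ source 5 ∷ source 6 ∷ []))))) (ask 2 6
      (ask 5 6 (reduce (cut 2 ∷ cut 5 ∷ cut 6 ∷ sink 0 ∷ [])) (closeIn 6 (reduce (cut 0 ∷ cut 4 ∷ cut 2 ∷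
      source 5 ∷ source 6 ∷ [])))) (closeIn 6 (reduce (cut 0 ∷ cut 4 ∷ cut 2 ∷ source 5 ∷ source 6 ∷ [])))))
      (ask 4 6 (ask 2 6 (ask 5 6 (reduce (cut 2 ∷ cut 5 ∷ cut 6 ∷ sink 0 ∷ [])) (closeIn 6 (reduce (cut 1 ∷ cut
      3 ∷ cut 4 ∷ source 0 ∷ cut 2 ∷ source 5 ∷ source 6 ∷ [])))) (closeIn 6 (reduce (cut 2 ∷ cut 5 ∷ cut 6 ∷
      sink 0 ∷ [])))) (closeIn 6 (reduce (cut 1 ∷ cut 3 ∷ cut 4 ∷ source 0 ∷ source 6 ∷ []))))) (ask 3 6 (ask 4
      6 (ask 2 6 (ask 5 6 (reduce (cut 2 ∷ cut 5 ∷ cut 6 ∷ sink 0 ∷ [])) (closeIn 6 (reduce (cut 1 ∷ cut 3 ∷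
      cut 4 ∷ source 0 ∷ cut 2 ∷ source 5 ∷ source 6 ∷ [])))) (closeIn 6 (reduce (cut 0 ∷ cut 1 ∷ cut 2 ∷
      source 6 ∷ [])))) (closeIn 6 (reduce (cut 1 ∷ cut 3 ∷ cut 4 ∷ source 0 ∷ source 6 ∷ [])))) (closeIn 6
      (reduce (cut 1 ∷ cut 3 ∷ cut 4 ∷ source 0 ∷ source 6 ∷ [])))))))) (ask 4 5 (ask 2 5 (ask 6 5 (newIn 5
      (closeIn 5 (reduce (cut 0 ∷ cut 3 ∷ cut 7 ∷ source 5 ∷ [])))) (closeIn 5 (ask 1 6 (ask 3 6 (ask 4 6 (ask
      2 6 (newIn 6 (newIn 6 (closeIn 6 (reduce (cut 0 ∷ cut 7 ∷ cut 8 ∷ source 6 ∷ []))))) (newIn 6 (closeIn 6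
      (reduce (cut 0 ∷ cut 2 ∷ cut 7 ∷ source 6 ∷ []))))) (ask 2 6 (newIn 6 (closeIn 6 (reduce (cut 0 ∷ cut 4 ∷
      cut 7 ∷ source 6 ∷ [])))) (closeIn 6 (reduce (cut 1 ∷ cut 3 ∷ cut 4 ∷ source 0 ∷ cut 2 ∷ source 6 ∷
      source 5 ∷ []))))) (ask 4 6 (ask 2 6 (newIn 6 (closeIn 6 (reduce (cut 0 ∷ cut 3 ∷ cut 7 ∷ source 6 ∷
      [])))) (closeIn 6 (reduce (cut 0 ∷ cut 3 ∷ cut 2 ∷ source 6 ∷ source 5 ∷ [])))) (closeIn 6 (reduce (cut 0
      ∷ cut 3 ∷ cut 4 ∷ source 6 ∷ source 5 ∷ []))))) (ask 3 6 (ask 4 6 (ask 2 6 (newIn 6 (closeIn 6 (reduce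
      (cut 0 ∷ cut 1 ∷ cut 7 ∷ source 6 ∷ [])))) (closeIn 6 (reduce (cut 0 ∷ cut 1 ∷ cut 2 ∷ source 6 ∷ []))))
      (closeIn 6 (reduce (cut 1 ∷ cut 3 ∷ cut 4 ∷ source 0 ∷ source 6 ∷ [])))) (closeIn 6 (reduce (cut 0 ∷ cut
      1 ∷ cut 3 ∷ mergeIn 5 6 ∷ source 6 ∷ []))))))) (closeIn 5 (ask 1 6 (ask 3 6 (ask 4 6 (ask 2 6 (ask 5 6
      (reduce (cut 2 ∷ cut 5 ∷ cut 6 ∷ sink 0 ∷ [])) (newIn 6 (closeIn 6 (reduce (cut 0 ∷ cut 5 ∷ cut 7 ∷
      source 6 ∷ []))))) (ask 5 6 (reduce (cut 2 ∷ cut 5 ∷ cut 6 ∷ sink 0 ∷ [])) (closeIn 6 (reduce (cut 0 ∷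
      cut 3 ∷ cut 2 ∷ source 5 ∷ source 6 ∷ []))))) (ask 2 6 (ask 5 6 (reduce (cut 2 ∷ cut 5 ∷ cut 6 ∷ sink 0 ∷
      [])) (closeIn 6 (reduce (cut 1 ∷ cut 3 ∷ cut 4 ∷ source 0 ∷ cut 2 ∷ source 5 ∷ source 6 ∷ [])))) (closeIn
      6 (reduce (cut 2 ∷ cut 5 ∷ cut 6 ∷ sink 0 ∷ []))))) (ask 4 6 (ask 2 6 (ask 5 6 (reduce (cut 2 ∷ cut 5 ∷
      cut 6 ∷ sink 0 ∷ [])) (closeIn 6 (reduce (cut 0 ∷ cut 3 ∷ cut 2 ∷ source 5 ∷ source 6 ∷ [])))) (closeIn 6
      (reduce (cut 0 ∷ cut 3 ∷ cut 2 ∷ source 5 ∷ source 6 ∷ [])))) (closeIn 6 (reduce (cut 1 ∷ cut 3 ∷ cut 4 ∷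
      source 0 ∷ source 6 ∷ []))))) (ask 3 6 (ask 4 6 (ask 2 6 (ask 5 6 (reduce (cut 2 ∷ cut 5 ∷ cut 6 ∷ sink 0
      ∷ [])) (closeIn 6 (reduce (cut 1 ∷ cut 3 ∷ cut 4 ∷ source 0 ∷ cut 2 ∷ source 5 ∷ source 6 ∷ []))))
      (closeIn 6 (reduce (cut 0 ∷ cut 1 ∷ cut 2 ∷ source 6 ∷ [])))) (closeIn 6 (reduce (cut 1 ∷ cut 3 ∷ cut 4 ∷
      source 0 ∷ source 6 ∷ [])))) (closeIn 6 (reduce (cut 1 ∷ cut 3 ∷ cut 4 ∷ source 0 ∷ source 6 ∷ [])))))))
      (closeIn 5 (reduce (cut 1 ∷ cut 3 ∷ cut 4 ∷ source 0 ∷ source 5 ∷ []))))) (ask 3 5 (ask 4 5 (ask 2 5 (ask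
      6 5 (newIn 5 (closeIn 5 (reduce (cut 0 ∷ cut 1 ∷ cut 7 ∷ source 5 ∷ [])))) (closeIn 5 (ask 1 6 (ask 3 6
      (ask 4 6 (ask 2 6 (newIn 6 (newIn 6 (closeIn 6 (reduce (cut 0 ∷ cut 7 ∷ cut 8 ∷ source 6 ∷ []))))) (newIn
      6 (closeIn 6 (reduce (cut 0 ∷ cut 2 ∷ cut 7 ∷ source 6 ∷ []))))) (ask 2 6 (newIn 6 (closeIn 6 (reduce
      (cut 0 ∷ cut 4 ∷ cut 7 ∷ source 6 ∷ [])))) (closeIn 6 (reduce (cut 1 ∷ cut 3 ∷ cut 4 ∷ source 0 ∷ cut 2 ∷
      source 6 ∷ source 5 ∷ []))))) (ask 4 6 (ask 2 6 (newIn 6 (closeIn 6 (reduce (cut 0 ∷ cut 3 ∷ cut 7 ∷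
      source 6 ∷ [])))) (closeIn 6 (reduce (cut 1 ∷ cut 3 ∷ cut 4 ∷ source 0 ∷ cut 2 ∷ source 6 ∷ source 5 ∷
      [])))) (closeIn 6 (reduce (cut 1 ∷ cut 3 ∷ cut 4 ∷ source 0 ∷ source 6 ∷ []))))) (reduce (cut 3 ∷ cut 4 ∷
      mergeIn 0 1 ∷ []))))) (closeIn 5 (reduce (cut 0 ∷ cut 1 ∷ cut 2 ∷ source 5 ∷ [])))) (closeIn 5 (reduce
      (cut 1 ∷ cut 3 ∷ cut 4 ∷ source 0 ∷ source 5 ∷ [])))) (closeIn 5 (reduce (cut 1 ∷ cut 3 ∷ cut 4 ∷ source
      0 ∷ source 5 ∷ [])))) ∷ []) ∷ [])))))))

  grow′ : Config → Config
  grow′ = grow 0 0 []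

  coverConfig : Config
  coverConfig = setEntry (setEntry (setEntry (setEntry (setEntry (grow′ (grow′ (grow′ (single (2 , 2))))) 1 0 present) 0 2 present) 0 3 present) 2 1 absent) 3 1 absent

  -- Two directed triangles that meet in label 0; each runs through one in-neighbour (1 or 2) and
  -- one out-neighbour (3 or 4).
  matched : Config
  matched = setEntry (setEntry (setEntry (setEntry (setEntry (setEntry (grow′ (grow′ (grow′ (grow′ (single (2 , 2)))))) 1 0 present) 2 0 present) 0 3 present) 0 4 present) 3 1 present) 4 2 present

  inConfig : Config
  inConfig = setEntry (setEntry (setEntry (setEntry (grow′ (grow′ (single (3 , 3)))) 1 0 present) 2 0 present) 1 2 absent) 2 1 absent

  acrossConfig : Config
  acrossConfig = setEntry (setEntry (setEntry (setEntry (grow′ (grow′ (single (3 , 3)))) 1 0 present) 0 2 present) 1 2 absent) 2 1 absent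

  six : List (ℕ × ℕ)
  six = (3 , 3) ∷ (2 , 4) ∷ (4 , 2) ∷ []

-- The induction on the weight

module DirectedMinors where
  open Certificates
  open Trees
  open import Data.Nat using (_+_; _*_; _≤_; _<_; _≡ᵇ_; _<ᵇ_; _≟_; _≤?_)
  open import Data.Nat.Properties
  open Digraph

  module _ {k : ℕ} (H : Digraph n) (f : Fin k → Fin n) (edge : ∀ {i j} → i ≢ j → Edge H (f i) (f j)) where

    private
      branch : Fin n → Maybe (Fin k)
      branch u with Fin.any? (λ i → f i Fin.≟ u)
      ... | yes (i , _) = just i
      ... | no _ = nothing

      f-injective : ∀ {i j} → f i ≡ f j → i ≡ j
      f-injective {i} {j} eq with i Fin.≟ j
      ... | yes p = p
      ... | no p with subst (Edge H (f i)) (sym eq) (edge p)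
      ...   | inj₁ e = ⊥-elim (true≢false e (irrefl H (f i)))
      ...   | inj₂ e = ⊥-elim (true≢false e (irrefl H (f i)))

      branch-f : ∀ i → branch (f i) ≡ just i
      branch-f i with Fin.any? (λ j → f j Fin.≟ f i)
      ... | yes (j , eq) = cong just (f-injective eq)
      ... | no none = ⊥-elim (none (i , refl))

      branch⁻ : ∀ {i u} → branch u ≡ just i → f i ≡ u
      branch⁻ {i} {u} e with Fin.any? (λ j → f j Fin.≟ u)
      branch⁻ refl | yes (_ , eq) = eq

    clique⇒minor : CompleteMinor k H
    clique⇒minor = record
      { branch = branch
      ; touching = λ {i} {j} i≢j → f i , f j , branch-f i , branch-f j , edge i≢j
      ; connected = λ {i} p q → subst₂ (Star (λ u v → Edge H u v × branch u ≡ just i × branch v ≡ just i)) (branch⁻ p) (branch⁻ q) ε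
      }

  -- The situation inside the induction, packaged so that it transfers to the reversed digraph;
  -- every case is then needed in one orientation only.
  record Minimal (H : Digraph n) : Set where
    field
      ih : ∀ (H′ : Digraph n) → weight H′ < weight H → ¬ CompleteMinor 5 H′ → Bounded H′ (weight H′)
      free : ¬ CompleteMinor 5 H

  open Minimal

  Goal : Digraph n → Set
  Goal H = Bounded H (weight H)

  Tame : ℕ → ℕ → Digraph n → Set
  Tame lo dmin H = ∀ v → alive H v ≡ true → lo ≤ indeg H v × lo ≤ outdeg H v × dmin ≤ deg H v × deg H v ≤ 6

  minimal-rev : {H : Digraph n} → Minimal H → Minimal (rev H)
  minimal-rev {H = H} μ = record
    { ih = λ H′ lt → ih μ H′ (subst (weight H′ <_) (weight-rev H) lt)
    ; free = free μ ∘ minor-rev {H = H} }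

  goal-rev : (H : Digraph n) → Goal (rev H) → Goal H
  goal-rev H g = subst (Bounded H) (weight-rev H) (bounded-rev H g)

  tame-rev : ∀ {lo dmin} {H : Digraph n} → Tame lo dmin H → Tame lo dmin (rev H)
  tame-rev {dmin = dmin} {H} τ v a with p , q , r , s ← τ v a =
    q , p , subst (dmin ≤_) (sym (deg-rev H v)) r , subst (_≤ 6) (sym (deg-rev H v)) s

  goal-delete : {H : Digraph n} → Minimal H → ∀ {v} → alive H v ≡ true → 7 ≤ deg H v → Goal H
  goal-delete {H = H} μ {v} av large = bounded-weaken H le (bounded-delete H v (ih μ (delete H v) lt (free μ ∘ minor-delete {H = H})))
    where
    eq : weight H ≡ weight (delete H v) + (2 + deg H v)
    eq = weight-delete H v av
    le : weight (delete H v) + 9 ≤ weight H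
    le = ≤-trans (+-monoʳ-≤ (weight (delete H v)) (s≤s (s≤s large))) (≤-reflexive (sym eq))
    lt : weight (delete H v) < weight H
    lt = <-≤-trans (m<m+n (weight (delete H v)) (s≤s z≤n)) le

  sum≡0 : {f : Fin n → ℕ} → sum f ≡ 0 → ∀ i → f i ≡ 0
  sum≡0 {f = f} eq i = n≤0⇒n≡0 (≤-trans (≤-sum f i) (≤-reflexive eq))

  goal-source : {H : Digraph n} → Minimal H → ∀ {v} → alive H v ≡ true → indeg H v ≡ 0 → Goal H
  goal-source {H = H} μ {v} av none =
    bounded-weaken H (<⇒≤ lt) (bounded-source H v arcless (ih μ (delete H v) lt (free μ ∘ minor-delete {H = H})))
    where
    lt : weight (delete H v) < weight H
    lt = <-≤-trans (m<m+n (weight (delete H v)) (s≤s z≤n)) (≤-reflexive (sym (weight-delete H v av)))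
    arcless : ∀ u → arc H u v ≡ false
    arcless u with arc H u v | sum≡0 none u
    ... | false | _ = refl

  -- Soundness of the certificates, for a minimal digraph and a list of excluded kinds.
  module Stage (lo dmin : ℕ) (bad : List (ℕ × ℕ)) {n : ℕ} (H : Digraph n) (μ : Minimal H) (τ : Tame lo dmin H)
      (bad-out : ∀ u v → arc H u v ≡ true → elem (indeg H u) (outdeg H u) bad ≡ true →
                 indeg H v ≡ 2 → outdeg H v ≡ 2 → Goal H)
      (bad-in : ∀ u v → arc H u v ≡ true → indeg H u ≡ 2 → outdeg H u ≡ 2 →
                elem (outdeg H v) (indeg H v) bad ≡ true → Goal H) where

    Real : Config → (ℕ → Fin n) → Set
    Real = Realizes lo dmin bad H

    sound : ∀ t {c ρ} → Real c ρ → check lo dmin bad c t ≡ true → Goal H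
    sound = check-sound lo dmin bad H 5 (ih μ) (free μ) τ bad-out bad-in

    entry⁺ : ∀ {c ρ a b s} → Real c ρ → entry c a b ≡ unknown → (s ≡ present → arc H (ρ a) (ρ b) ≡ true) →
             (s ≡ absent → arc H (ρ a) (ρ b) ≡ false) → Real (setEntry c a b s) ρ
    entry⁺ r e p q = setEntry-ok lo dmin bad H 5 (ih μ) (free μ) τ bad-out bad-in r e p q

    arc⁺ : ∀ {c ρ} a b → Real c ρ → entry c a b ≡ unknown → arc H (ρ a) (ρ b) ≡ true → Real (setEntry c a b present) ρ
    arc⁺ a b r e p = entry⁺ r e (λ _ → p) (λ ())

    nonarc⁺ : ∀ {c ρ} a b → Real c ρ → entry c a b ≡ unknown → arc H (ρ a) (ρ b) ≡ false → Real (setEntry c a b absent) ρ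
    nonarc⁺ a b r e p = entry⁺ r e (λ ()) (λ _ → p)

    kind⁺ : ∀ {c ρ} x {i o} → Real c ρ → x < Config.size c → indeg H (ρ x) ≡ i → outdeg H (ρ x) ≡ o → Real (setKind c x (i , o)) ρ
    kind⁺ x r lt refl refl = setKind-ok lo dmin bad H 5 (ih μ) (free μ) τ bad-out bad-in r lt

    push : (ℕ → Fin n) → ℕ → Fin n → ℕ → Fin n
    push ρ k u a = if a ≡ᵇ k then u else ρ a

    grow⁺ : ∀ {c ρ} → Real c ρ → ∀ u → alive H u ≡ true → (∀ {a} → a < Config.size c → u ≢ ρ a) →
            isFresh lo dmin bad c ≡ true → Real (grow lo dmin bad c) (push ρ (Config.size c) u)
    grow⁺ r u au new fresh = grow-ok lo dmin bad H 5 (ih μ) (free μ) τ bad-out bad-in r u au new fresh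

    -- Labels beyond the size of the configuration also name `v` until they are assigned.
    labels : Fin n → ℕ → Fin n
    labels v = push (λ _ → v) 0 v

    single⁺ : ∀ v {i o} → alive H v ≡ true → indeg H v ≡ i → outdeg H v ≡ o → Real (setKind (grow lo dmin bad empty) 0 (i , o)) (labels v)
    single⁺ v av p q = kind⁺ 0 one (s≤s z≤n) p q
      where
      none : Real empty (λ _ → v)
      none = record
        { injective = λ () ; alive-ok = λ () ; present-ok = λ () ; absent-ok = λ ()
        ; kind-ok = λ () ; in-ok = λ () ; out-ok = λ () }
      one : Real (grow lo dmin bad empty) (labels v)
      one = grow⁺ none v av (λ ()) refl

  module Plain (lo dmin : ℕ) {n : ℕ} (H : Digraph n) (μ : Minimal H) (τ : Tame lo dmin H) =
    Stage lo dmin [] H μ τ (λ _ _ _ ()) (λ _ _ _ _ _ ())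

  arc-≢ : (H : Digraph n) → ∀ {u v} → arc H u v ≡ true → u ≢ v
  arc-≢ H p refl = true≢false p (irrefl H _)

  module _ (H : Digraph n) (v : Fin n) where

    count-true : ∀ k → count k (λ _ → true) ≡ k
    count-true zero = refl
    count-true (suc k) = cong suc (count-true k)

    moreIn : ∀ k (ρ : ℕ → Fin n) → (∀ {a b} → a < k → b < k → ρ a ≡ ρ b → a ≡ b) →
             (∀ {a} → a < k → arc H (ρ a) v ≡ true) → k < indeg H v →
             ∃ λ u → arc H u v ≡ true × (∀ {a} → a < k → u ≢ ρ a)
    moreIn k ρ inj arcs lt = let u , p , new = another (λ u → arc H u v) ρ (λ _ → true) k inj (λ l _ → arcs l)
                                                 (subst (_< indeg H v) (sym (count-true k)) lt)
                             in u , p , λ l → new l refl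

  module _ {A : Set} {u : A} where

    apart₁ : (ρ : ℕ → A) → u ≢ ρ 0 → ∀ {a} → a < 1 → u ≢ ρ a
    apart₁ ρ p {zero} _ = p
    apart₁ ρ p {suc _} (s≤s ())

    apart₂ : (ρ : ℕ → A) → u ≢ ρ 0 → u ≢ ρ 1 → ∀ {a} → a < 2 → u ≢ ρ a
    apart₂ ρ p q {zero} _ = p
    apart₂ ρ p q {suc _} (s≤s l) = apart₁ (ρ ∘ suc) q l

    apart₃ : (ρ : ℕ → A) → u ≢ ρ 0 → u ≢ ρ 1 → u ≢ ρ 2 → ∀ {a} → a < 3 → u ≢ ρ a
    apart₃ ρ p q r {zero} _ = p
    apart₃ ρ p q r {suc _} (s≤s l) = apart₂ (ρ ∘ suc) q r l

    apart₄ : (ρ : ℕ → A) → u ≢ ρ 0 → u ≢ ρ 1 → u ≢ ρ 2 → u ≢ ρ 3 → ∀ {a} → a < 4 → u ≢ ρ a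
    apart₄ ρ p q r s {zero} _ = p
    apart₄ ρ p q r s {suc _} (s≤s l) = apart₃ (ρ ∘ suc) q r s l

  inNeighbour : (H : Digraph n) (v : Fin n) → 1 ≤ indeg H v → ∃ λ u → arc H u v ≡ true
  inNeighbour H v le = let u , p , _ = moreIn H v 0 (λ _ → v) (λ ()) (λ ()) le in u , p

  secondIn : (H : Digraph n) {u v : Fin n} → arc H u v ≡ true → 2 ≤ indeg H v → ∃ λ u′ → arc H u′ v ≡ true × u′ ≢ u
  secondIn H {u} {v} p le = let u′ , q , new = moreIn H v 1 (λ _ → u) (λ { (s≤s z≤n) (s≤s z≤n) _ → refl }) (λ _ → p) le
                            in u′ , q , new (s≤s z≤n)

  thirdIn : (H : Digraph n) {u u′ v : Fin n} → arc H u v ≡ true → arc H u′ v ≡ true → u′ ≢ u → 3 ≤ indeg H v →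
            ∃ λ u″ → arc H u″ v ≡ true × u″ ≢ u × u″ ≢ u′
  thirdIn {n} H {u} {u′} {v} p p′ u′≢u le =
    let u″ , q , new = moreIn H v 2 ρ inj arcs le in u″ , q , new {0} (s≤s z≤n) , new {1} (s≤s (s≤s z≤n))
    where
    ρ : ℕ → Fin n
    ρ zero = u
    ρ (suc _) = u′
    inj : ∀ {a b} → a < 2 → b < 2 → ρ a ≡ ρ b → a ≡ b
    inj {zero} {zero} _ _ _ = refl
    inj {zero} {suc _} _ _ e = ⊥-elim (u′≢u (sym e))
    inj {suc _} {zero} _ _ e = ⊥-elim (u′≢u e)
    inj {suc zero} {suc zero} _ _ _ = refl
    inj {suc (suc _)} (s≤s (s≤s ())) _ _
    inj {suc zero} {suc (suc _)} _ (s≤s (s≤s ())) _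
    arcs : ∀ {a} → a < 2 → arc H (ρ a) v ≡ true
    arcs {zero} _ = p
    arcs {suc _} _ = p′

  module _ {n : ℕ} (H : Digraph n) (μ : Minimal H) where

    goal-in1 : Tame 1 2 H → ∀ v → alive H v ≡ true → indeg H v ≡ 1 → Goal H
    goal-in1 τ v av one = go (outdeg H v) refl
      where
      open Plain 1 2 H μ τ
      bound : deg H v ≤ 6
      bound = proj₂ (proj₂ (proj₂ (τ v av)))
      go : ∀ o → outdeg H v ≡ o → Goal H
      go 0 e with () ← ≤-trans (proj₁ (proj₂ (τ v av))) (≤-reflexive e)
      go 1 e = sound tree11 (single⁺ v av one e) refl
      go 2 e = sound tree12 (single⁺ v av one e) refl
      go 3 e = sound tree13 (single⁺ v av one e) refl
      go 4 e = sound tree14 (single⁺ v av one e) refl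
      go 5 e = sound tree15 (single⁺ v av one e) refl
      go (suc (suc (suc (suc (suc (suc o)))))) e
        with s≤s (s≤s (s≤s (s≤s (s≤s (s≤s ()))))) ← subst₂ (λ a b → a + b ≤ 6) one e bound

    module _ (τ : Tame 2 4 H) where

      goal-uncovered : ∀ {v u w w′} → indeg H v ≡ 2 → outdeg H v ≡ 2 → arc H u v ≡ true → arc H v w ≡ true → arc H v w′ ≡ true →
                       w′ ≢ w → arc H w u ≡ false → arc H w′ u ≡ false → Goal H
      goal-uncovered {v} {u} {w} {w′} i o uv vw vw′ w′≢w wu w′u = sound treeCover r refl
        where
        open Plain 2 4 H μ τ
        w≢u : ∀ {w} → arc H v w ≡ true → w ≢ u
        w≢u p refl = true≢false p (asym H uv)
        r₁ : Real (single (2 , 2)) (labels v)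
        r₁ = single⁺ v (head-alive H uv) i o
        r₂ = grow⁺ r₁ u (tail-alive H uv) (apart₁ (labels v) (arc-≢ H uv)) refl
        r₃ = grow⁺ r₂ w (head-alive H vw) (apart₂ (push (labels v) 1 u) (arc-≢ H vw ∘ sym) (w≢u vw)) refl
        r₄ = grow⁺ r₃ w′ (head-alive H vw′) (apart₃ (push (push (labels v) 1 u) 2 w) (arc-≢ H vw′ ∘ sym) (w≢u vw′) w′≢w) refl
        r : Real coverConfig _
        r = nonarc⁺ 3 1 (nonarc⁺ 2 1 (arc⁺ 0 3 (arc⁺ 0 2 (arc⁺ 1 0 r₄ refl uv) refl vw) refl vw′) refl wu) refl w′u

  record Matched (H : Digraph n) (u v : Fin n) : Set where
    constructor matching
    field
      {u′ w w′} : Fin n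
      uv  : arc H u v ≡ true
      u′v : arc H u′ v ≡ true
      vw  : arc H v w ≡ true
      vw′ : arc H v w′ ≡ true
      wu  : arc H w u ≡ true
      wu′ : arc H w′ u′ ≡ true
      u′≢u : u′ ≢ u
      w′≢w : w′ ≢ w

  -- By goal-uncovered the arcs from N⁺(v) to N⁻(v) cover both sets, so they
  -- contain a perfect matching.
  match : (H : Digraph n) → Minimal H → Tame 2 4 H → ∀ {u v} → arc H u v ≡ true →
          indeg H v ≡ 2 → outdeg H v ≡ 2 → Goal H ⊎ Matched H u v
  match H μ τ {u} {v} uv i o = go
    where
    u′₊ = secondIn H uv (≤-reflexive (sym i))
    w₊ = inNeighbour (rev H) v (≤-trans (s≤s z≤n) (≤-reflexive (sym o)))
    w = proj₁ w₊
    vw = proj₂ w₊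
    w′₊ = secondIn (rev H) {w} {v} vw (≤-reflexive (sym o))
    u′ = proj₁ u′₊
    u′v = proj₁ (proj₂ u′₊)
    u′≢u = proj₂ (proj₂ u′₊)
    w′ = proj₁ w′₊
    vw′ = proj₁ (proj₂ w′₊)
    w′≢w = proj₂ (proj₂ w′₊)
    uncovered : ∀ {u} → arc H u v ≡ true → arc H w u ≡ false → arc H w′ u ≡ false → Goal H
    uncovered p a b = goal-uncovered H μ τ i o p vw vw′ w′≢w a b
    uncovered′ : ∀ {w} → arc H v w ≡ true → arc H w u ≡ false → arc H w u′ ≡ false → Goal H
    uncovered′ p a b = goal-rev H (goal-uncovered (rev H) (minimal-rev μ) (tame-rev {H = H} τ) o i p uv u′v u′≢u a b)
    go : Goal H ⊎ Matched H u v
    go with arc H w u in a | arc H w u′ in b | arc H w′ u in c | arc H w′ u′ in d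
    ... | true | _ | _ | true = inj₂ (matching uv u′v vw vw′ a d u′≢u w′≢w)
    ... | _ | true | true | _ = inj₂ (matching uv u′v vw′ vw c b u′≢u (w′≢w ∘ sym))
    ... | false | false | _ | _ = inj₁ (uncovered′ vw a b)
    ... | false | true | false | _ = inj₁ (uncovered uv a c)
    ... | true | false | _ | false = inj₁ (uncovered u′v b d)
    ... | true | true | false | false = inj₁ (uncovered′ vw′ c d)

  -- Quantified over all digraphs in order to apply to the reversed one too, where it speaks of
  -- out-neighbours with the degrees swapped.
  Excluded : List (ℕ × ℕ) → Set
  Excluded bad = ∀ {n} (H : Digraph n) → Minimal H → Tame 2 4 H → ∀ u v → arc H u v ≡ true →
    elem (indeg H u) (outdeg H u) bad ≡ true → indeg H v ≡ 2 → outdeg H v ≡ 2 → Goal H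

  module _ (bad : List (ℕ × ℕ)) (excluded : Excluded bad) {n : ℕ} (H : Digraph n) (μ : Minimal H) (τ : Tame 2 4 H) where

    open Stage 2 4 bad H μ τ (excluded H μ τ)
      (λ u v p i o e → goal-rev H (excluded (rev H) (minimal-rev μ) (tame-rev {H = H} τ) v u p e o i))

    private
      -- The equation records that label 1 went to the in-neighbour `u`, whose kind is fixed
      -- afterwards.
      matched⁺ : ∀ {u v} → indeg H v ≡ 2 → outdeg H v ≡ 2 → Matched H u v → ∃ λ ρ → Real matched ρ × ρ 1 ≡ u
      matched⁺ {u} {v} i o (matching {u′} {w} {w′} uv u′v vw vw′ wu w′u′ u′≢u w′≢w) =
        _ , arc⁺ 4 2 (arc⁺ 3 1 (arc⁺ 0 4 (arc⁺ 0 3 (arc⁺ 2 0 (arc⁺ 1 0 r₅ refl uv) refl u′v) refl vw) refl vw′) refl wu) refl w′u′ , refl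
        where
        out≢in : ∀ {w u} → arc H v w ≡ true → arc H u v ≡ true → w ≢ u
        out≢in p q refl = true≢false p (asym H q)
        r₁ : Real (single (2 , 2)) (labels v)
        r₁ = single⁺ v (head-alive H uv) i o
        r₂ = grow⁺ r₁ u (tail-alive H uv) (apart₁ (labels v) (arc-≢ H uv)) refl
        r₃ = grow⁺ r₂ u′ (tail-alive H u′v) (apart₂ (push (labels v) 1 u) (arc-≢ H u′v) u′≢u) refl
        r₄ = grow⁺ r₃ w (head-alive H vw) (apart₃ (push (push (labels v) 1 u) 2 u′) (arc-≢ H vw ∘ sym) (out≢in vw uv) (out≢in vw u′v)) refl
        r₅ = grow⁺ r₄ w′ (head-alive H vw′) (apart₄ (push (push (push (labels v) 1 u) 2 u′) 3 w) (arc-≢ H vw′ ∘ sym) (out≢in vw′ uv) (out≢in vw′ u′v) w′≢w) refl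

    goal-kind : ∀ i o t → check 2 4 bad (setKind matched 1 (i , o)) t ≡ true → ∀ {u v} → arc H u v ≡ true →
                indeg H u ≡ i → outdeg H u ≡ o → indeg H v ≡ 2 → outdeg H v ≡ 2 → Goal H
    goal-kind i o t ok {u} uv p q p′ q′ with match H μ τ uv p′ q′
    ... | inj₁ g = g
    ... | inj₂ M with ρ , r , refl ← matched⁺ p′ q′ M = sound t (kind⁺ 1 r (s≤s (s≤s z≤n)) p q) ok

    goal-four : ∀ t → check 2 4 bad matched t ≡ true → ∀ v → indeg H v ≡ 2 → outdeg H v ≡ 2 → Goal H
    goal-four t ok v p q with u , uv ← inNeighbour H v (≤-trans (s≤s z≤n) (≤-reflexive (sym p))) with match H μ τ uv p q
    ... | inj₁ g = g
    ... | inj₂ M with ρ , r , _ ← matched⁺ p q M = sound t r ok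

  elem-∷ : ∀ i o κ κs → elem i o (κ ∷ κs) ≡ true → (i ≡ proj₁ κ × o ≡ proj₂ κ) ⊎ elem i o κs ≡ true
  elem-∷ i o (a , b) κs e with ∨-true {(i ≡ᵇ a) ∧ (o ≡ᵇ b)} e
  ... | inj₁ p = let q , r = ∧-true p in inj₁ (≡ᵇ-true i a q , ≡ᵇ-true o b r)
  ... | inj₂ p = inj₂ p

  excluded-none : Excluded []
  excluded-none _ _ _ _ _ _ ()

  excluded-six : Excluded six
  excluded-six H μ τ u v p e i o with elem-∷ _ _ (3 , 3) ((2 , 4) ∷ (4 , 2) ∷ []) e
  ... | inj₁ (a , b) = goal-kind [] excluded-none H μ τ 3 3 tree33 refl p a b i o
  ... | inj₂ e₁ with elem-∷ _ _ (2 , 4) ((4 , 2) ∷ []) e₁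
  ...   | inj₁ (a , b) = goal-kind [] excluded-none H μ τ 2 4 tree24 refl p a b i o
  ...   | inj₂ e₂ with elem-∷ _ _ (4 , 2) [] e₂
  ...     | inj₁ (a , b) = goal-kind [] excluded-none H μ τ 4 2 tree42 refl p a b i o

  -- From here on the exclusions build on each other: the tree for (2 , 3) uses that degree 6 is
  -- excluded, and the tree for (3 , 2) uses both.
  excluded-23 : Excluded ((2 , 3) ∷ six)
  excluded-23 H μ τ u v p e i o with elem-∷ _ _ (2 , 3) six e
  ... | inj₁ (a , b) = goal-kind six excluded-six H μ τ 2 3 tree23 refl p a b i o
  ... | inj₂ e₁ = excluded-six H μ τ u v p e₁ i o

  excluded-32 : Excluded ((3 , 2) ∷ (2 , 3) ∷ six)
  excluded-32 H μ τ u v p e i o with elem-∷ _ _ (3 , 2) ((2 , 3) ∷ six) e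
  ... | inj₁ (a , b) = goal-kind ((2 , 3) ∷ six) excluded-23 H μ τ 3 2 tree32 refl p a b i o
  ... | inj₂ e₁ = excluded-23 H μ τ u v p e₁ i o

  module _ {n : ℕ} (H : Digraph n) (μ : Minimal H) where

    goal-23 : Tame 2 5 H → ∀ v → alive H v ≡ true → indeg H v ≡ 2 → outdeg H v ≡ 3 → Goal H
    goal-23 τ v av p q = sound treeFive (single⁺ v av p q) refl
      where open Plain 2 5 H μ τ

    goal-24 : Tame 2 5 H → ∀ v → alive H v ≡ true → indeg H v ≡ 2 → outdeg H v ≡ 4 → Goal H
    goal-24 τ v av p q = sound treeSix (single⁺ v av p q) refl
      where open Plain 2 5 H μ τ

  module _ {n : ℕ} (H : Digraph n) (μ : Minimal H) (τ : Tame 3 6 H) where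

    open Plain 3 6 H μ τ

    regular : ∀ v → alive H v ≡ true → indeg H v ≡ 3 × outdeg H v ≡ 3
    regular v av with p , q , _ , s ← τ v av =
      ≤-antisym (+-cancelʳ-≤ 3 _ 3 (≤-trans (+-monoʳ-≤ (indeg H v) q) s)) p ,
      ≤-antisym (+-cancelˡ-≤ 3 _ 3 (≤-trans (+-monoˡ-≤ (outdeg H v) p) s)) q

    nonedge : ∀ {u v} → ¬ Edge H u v → arc H u v ≡ false × arc H v u ≡ false
    nonedge ne = ≢true (ne ∘ inj₁) , ≢true (ne ∘ inj₂)

    goal-in : ∀ {a b v} → arc H a v ≡ true → arc H b v ≡ true → b ≢ a → ¬ Edge H a b → Goal H
    goal-in {a} {b} {v} av bv b≢a ne = sound treeIn r refl
      where
      ρ≡ = regular v (head-alive H av)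
      r₁ : Real (single (3 , 3)) (labels v)
      r₁ = single⁺ v (head-alive H av) (proj₁ ρ≡) (proj₂ ρ≡)
      r₂ = grow⁺ r₁ a (tail-alive H av) (apart₁ (labels v) (arc-≢ H av)) refl
      r₃ = grow⁺ r₂ b (tail-alive H bv) (apart₂ (push (labels v) 1 a) (arc-≢ H bv) b≢a) refl
      r : Real inConfig _
      r = nonarc⁺ 2 1 (nonarc⁺ 1 2 (arc⁺ 2 0 (arc⁺ 1 0 r₃ refl av) refl bv) refl (proj₁ (nonedge ne))) refl (proj₂ (nonedge ne))

    goal-across : ∀ {a v x} → arc H a v ≡ true → arc H v x ≡ true → ¬ Edge H a x → Goal H
    goal-across {a} {v} {x} av vx ne = sound treeAcross r refl
      where
      x≢a : x ≢ a
      x≢a refl = true≢false vx (asym H av)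
      ρ≡ = regular v (head-alive H av)
      r₁ : Real (single (3 , 3)) (labels v)
      r₁ = single⁺ v (head-alive H av) (proj₁ ρ≡) (proj₂ ρ≡)
      r₂ = grow⁺ r₁ a (tail-alive H av) (apart₁ (labels v) (arc-≢ H av)) refl
      r₃ = grow⁺ r₂ x (head-alive H vx) (apart₂ (push (labels v) 1 a) (arc-≢ H vx ∘ sym) x≢a) refl
      r : Real acrossConfig _
      r = nonarc⁺ 2 1 (nonarc⁺ 1 2 (arc⁺ 0 2 (arc⁺ 1 0 r₃ refl av) refl vx) refl (proj₁ (nonedge ne))) refl (proj₂ (nonedge ne))

    edge? : ∀ u v → Dec (Edge H u v)
    edge? u v = (arc H u v Bool.≟ true) ⊎-dec (arc H v u Bool.≟ true)

    -- The vertex, its three in-neighbours and one out-neighbour form the K₅: pairs containing `v`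
    -- are adjacent by choice, and a non-adjacent pair among the others is disposed of by `goal-in`
    -- or `goal-across`.
    goal-regular : ∀ v → alive H v ≡ true → Goal H
    goal-regular v alv with a , av ← inNeighbour H v (≤-trans (s≤s z≤n) (≤-reflexive (sym (proj₁ (regular v alv)))))
                       with b , bv , b≢a ← secondIn H av (≤-trans (s≤s (s≤s z≤n)) (≤-reflexive (sym (proj₁ (regular v alv)))))
                       with c , cv , c≢a , c≢b ← thirdIn H av bv b≢a (≤-reflexive (sym (proj₁ (regular v alv))))
                       with x , vx ← inNeighbour (rev H) v (≤-trans (s≤s z≤n) (≤-reflexive (sym (proj₂ (regular v alv)))))
                       with edge? a b | edge? a c | edge? b c | edge? a x | edge? b x | edge? c x
    ... | no ne | _ | _ | _ | _ | _ = goal-in av bv b≢a ne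
    ... | _ | no ne | _ | _ | _ | _ = goal-in av cv c≢a ne
    ... | _ | _ | no ne | _ | _ | _ = goal-in bv cv c≢b ne
    ... | _ | _ | _ | no ne | _ | _ = goal-across av vx ne
    ... | _ | _ | _ | _ | no ne | _ = goal-across bv vx ne
    ... | _ | _ | _ | _ | _ | no ne = goal-across cv vx ne
    ... | yes ab | yes ac | yes bc | yes ax | yes bx | yes cx = ⊥-elim (free μ (clique⇒minor H f edge))
      where
      f : Fin 5 → Fin n
      f zero = v
      f (suc zero) = a
      f (suc (suc zero)) = b
      f (suc (suc (suc zero))) = c
      f (suc (suc (suc (suc zero)))) = x
      upward : ∀ i j → i Fin.< j → Edge H (f i) (f j)
      upward zero (suc zero) _ = inj₂ av
      upward zero (suc (suc zero)) _ = inj₂ bv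
      upward zero (suc (suc (suc zero))) _ = inj₂ cv
      upward zero (suc (suc (suc (suc zero)))) _ = inj₁ vx
      upward (suc zero) (suc (suc zero)) _ = ab
      upward (suc zero) (suc (suc (suc zero))) _ = ac
      upward (suc zero) (suc (suc (suc (suc zero)))) _ = ax
      upward (suc (suc zero)) (suc (suc (suc zero))) _ = bc
      upward (suc (suc zero)) (suc (suc (suc (suc zero)))) _ = bx
      upward (suc (suc (suc zero))) (suc (suc (suc (suc zero)))) _ = cx
      upward (suc zero) (suc zero) (s≤s ())
      upward (suc (suc zero)) (suc zero) (s≤s ())
      upward (suc (suc zero)) (suc (suc zero)) (s≤s (s≤s ()))
      upward (suc (suc (suc zero))) (suc zero) (s≤s ())
      upward (suc (suc (suc zero))) (suc (suc zero)) (s≤s (s≤s ()))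
      upward (suc (suc (suc zero))) (suc (suc (suc zero))) (s≤s (s≤s (s≤s ())))
      upward (suc (suc (suc (suc zero)))) (suc zero) (s≤s ())
      upward (suc (suc (suc (suc zero)))) (suc (suc zero)) (s≤s (s≤s ()))
      upward (suc (suc (suc (suc zero)))) (suc (suc (suc zero))) (s≤s (s≤s (s≤s ())))
      upward (suc (suc (suc (suc zero)))) (suc (suc (suc (suc zero)))) (s≤s (s≤s (s≤s (s≤s ()))))
      edge : ∀ {i j} → i ≢ j → Edge H (f i) (f j)
      edge {i} {j} i≢j with Fin.<-cmp i j
      ... | tri< lt _ _ = upward i j lt
      ... | tri≈ _ eq _ = ⊥-elim (i≢j eq)
      ... | tri> _ _ gt = swap (upward j i gt)

  module _ {n : ℕ} (H : Digraph n) (μ : Minimal H) where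

    private
      excluding : (P : Fin n → Set) → (∀ v → Dec (P v)) → (∀ v → alive H v ≡ true → P v → Goal H) →
                  ((∀ v → alive H v ≡ true → ¬ P v) → Goal H) → Goal H
      excluding P P? now later with Fin.any? (λ v → (alive H v Bool.≟ true) ×-dec P? v)
      ... | yes (v , a , p) = now v a p
      ... | no none = later (λ v a p → none (v , a , p))

      H′ = rev H
      μ′ = minimal-rev μ

      back : Goal H′ → Goal H
      back = goal-rev H

      stage₆ : Tame 3 6 H → Goal H
      stage₆ τ with Fin.any? (λ v → alive H v Bool.≟ true)
      ... | yes (v , a) = goal-regular H μ τ v a
      -- No vertex is alive, so there are no arcs and the empty set serves.
      ... | no none = (λ _ → false) , (λ _ → 0) , (λ p → ⊥-elim (none (_ , tail-alive H p))) ,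
            ≤-trans (≤-reflexive (cong (9 *_) (sum-zero {n}))) z≤n

      kind? : ∀ i o v → Dec (indeg H v ≡ i × outdeg H v ≡ o)
      kind? i o v = (indeg H v ≟ i) ×-dec (outdeg H v ≟ o)

      -- Reversal exchanges (2 , 3) with (3 , 2) and (2 , 4) with (4 , 2), so two trees remove four
      -- kinds and only (3 , 3) is left.
      stage₅ : Tame 2 5 H → Goal H
      stage₅ τ =
        excluding _ (kind? 2 3) (λ v a (p , q) → goal-23 H μ τ v a p q) λ no23 →
        excluding _ (kind? 3 2) (λ v a (p , q) → back (goal-23 H′ μ′ (tame-rev {H = H} τ) v a q p)) λ no32 →
        excluding _ (kind? 2 4) (λ v a (p , q) → goal-24 H μ τ v a p q) λ no24 →
        excluding _ (kind? 4 2) (λ v a (p , q) → back (goal-24 H′ μ′ (tame-rev {H = H} τ) v a q p)) λ no42 →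
        stage₆ λ v a → let p , q , s , t = τ v a in
          narrow _ _ p q s t (λ x y → no23 v a (x , y)) (λ x y → no32 v a (x , y)) (λ x y → no24 v a (x , y)) (λ x y → no42 v a (x , y))
        where
        narrow : ∀ i o → 2 ≤ i → 2 ≤ o → 5 ≤ i + o → i + o ≤ 6 → (i ≡ 2 → ¬ o ≡ 3) → (i ≡ 3 → ¬ o ≡ 2) →
                 (i ≡ 2 → ¬ o ≡ 4) → (i ≡ 4 → ¬ o ≡ 2) → 3 ≤ i × 3 ≤ o × 6 ≤ i + o × i + o ≤ 6
        narrow 0 _ ()
        narrow 1 _ (s≤s ())
        narrow _ 0 _ ()
        narrow _ 1 _ (s≤s ())
        narrow 2 2 _ _ (s≤s (s≤s (s≤s (s≤s ()))))
        narrow 2 3 _ _ _ _ a = ⊥-elim (a refl refl)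
        narrow 2 4 _ _ _ _ _ _ a = ⊥-elim (a refl refl)
        narrow 2 (suc (suc (suc (suc (suc o))))) _ _ _ (s≤s (s≤s (s≤s (s≤s (s≤s (s≤s ()))))))
        narrow 3 2 _ _ _ _ _ a = ⊥-elim (a refl refl)
        narrow 3 3 p q _ t _ _ _ _ = ≤-refl , ≤-refl , ≤-refl , t
        narrow 3 (suc (suc (suc (suc o)))) _ _ _ (s≤s (s≤s (s≤s (s≤s (s≤s (s≤s ()))))))
        narrow 4 2 _ _ _ _ _ _ _ a = ⊥-elim (a refl refl)
        narrow 4 (suc (suc (suc o))) _ _ _ (s≤s (s≤s (s≤s (s≤s (s≤s (s≤s ()))))))
        narrow (suc (suc (suc (suc (suc i))))) (suc (suc o)) _ _ _ (s≤s (s≤s (s≤s (s≤s (s≤s t)))))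
          with s≤s () ← ≤-trans (m≤n+m (suc (suc o)) i) t

      stage₄ : Tame 2 4 H → Goal H
      stage₄ τ = excluding _ (kind? 2 2) (λ v _ (p , q) → goal-four ((3 , 2) ∷ (2 , 3) ∷ six) excluded-32 H μ τ tree22 refl v p q) λ no22 →
        stage₅ λ v a → let p , q , s , t = τ v a in
          p , q , ≤∧≢⇒< s (λ e → no22 v a (exact p q (sym e))) , t
        where
        exact : ∀ {i o} → 2 ≤ i → 2 ≤ o → i + o ≡ 4 → i ≡ 2 × o ≡ 2
        exact {i} {o} p q e = ≤-antisym (+-cancelʳ-≤ 2 i 2 (≤-trans (+-monoʳ-≤ i q) (≤-reflexive e))) p ,
                              ≤-antisym (+-cancelˡ-≤ 2 o 2 (≤-trans (+-monoˡ-≤ o p) (≤-reflexive e))) q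

      stage₁ : Tame 1 2 H → Goal H
      stage₁ τ =
        excluding _ (λ v → indeg H v ≟ 1) (λ v a p → goal-in1 H μ τ v a p) λ in≢1 →
        excluding _ (λ v → outdeg H v ≟ 1) (λ v a p → back (goal-in1 H′ μ′ (tame-rev {H = H} τ) v a p)) λ out≢1 →
        stage₄ λ v a → let p , q , _ , t = τ v a
                           p′ = ≤∧≢⇒< p (in≢1 v a ∘ sym) ; q′ = ≤∧≢⇒< q (out≢1 v a ∘ sym)
                       in p′ , q′ , +-mono-≤ p′ q′ , t

    goal-minimal : Goal H
    goal-minimal =
      excluding _ (λ v → 7 ≤? deg H v) (λ v a p → goal-delete μ a p) λ small →
      excluding _ (λ v → indeg H v ≟ 0) (λ v a p → goal-source μ a p) λ in≢0 →
      excluding _ (λ v → outdeg H v ≟ 0) (λ v a p → back (goal-source μ′ a p)) λ out≢0 →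
      stage₁ λ v a → let p = n≢0⇒n>0 (in≢0 v a) ; q = n≢0⇒n>0 (out≢0 v a)
                     in p , q , +-mono-≤ p q , ≤-pred (≰⇒> (small v a))

  bounded : (H : Digraph n) → ¬ CompleteMinor 5 H → Bounded H (weight H)
  bounded {n} H free = go H free (<-wellFounded (weight H))
    where
    go : (H : Digraph n) → ¬ CompleteMinor 5 H → Acc _<_ (weight H) → Bounded H (weight H)
    go H free (acc rec) = goal-minimal H record { ih = λ H′ lt free′ → go H′ free′ (rec lt) ; free = free }

open DirectedMinors using (bounded)

-- Double sums and counting

module Embeddings where
  open import Data.List using (tabulate)
  open import Data.Nat using (_+_; _*_; _≤_; _<_; _<ᵇ_)
  open import Data.Nat.Properties

  sum₂ : ∀ {m n} → (Fin m → Fin n → ℕ) → ℕ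
  sum₂ f = sum (λ u → sum (f u))

  total : ∀ {m n} → (Fin m → Fin n → Bool) → ℕ
  total p = sum₂ (λ u v → ⟦ p u v ⟧)

  sum₂-cong : ∀ {m n} {f g : Fin m → Fin n → ℕ} → (∀ u v → f u v ≡ g u v) → sum₂ f ≡ sum₂ g
  sum₂-cong {m} {n} p = sum-cong-≗ {m} (λ u → sum-cong-≗ {n} (p u))

  sum₂-mono : ∀ {m n} {f g : Fin m → Fin n → ℕ} → (∀ u v → f u v ≤ g u v) → sum₂ f ≤ sum₂ g
  sum₂-mono p = sum-mono (λ u → sum-mono (p u))

  sum₂-+ : ∀ {m n} (f g : Fin m → Fin n → ℕ) → sum₂ (λ u v → f u v + g u v) ≡ sum₂ f + sum₂ g
  sum₂-+ {m} {n} f g = trans (sum-cong-≗ {m} (λ u → ∑-distrib-+ {n} (f u) (g u))) (∑-distrib-+ {m} _ _)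

  sum₂-zero : ∀ {m n} {f : Fin m → Fin n → ℕ} → (∀ u v → f u v ≡ 0) → sum₂ f ≡ 0
  sum₂-zero {m} {n} p = trans (sum-cong-≗ {m} (λ u → trans (sum-cong-≗ {n} (p u)) (sum-zero {n}))) (sum-zero {m})

  ≤-sum₂ : ∀ {m n} (f : Fin m → Fin n → ℕ) u v → f u v ≤ sum₂ f
  ≤-sum₂ f u v = ≤-trans (≤-sum (f u) v) (≤-sum (λ u → sum (f u)) u)

  sum-one : sum {n} (λ _ → 1) ≡ n
  sum-one {zero} = refl
  sum-one {suc n} = cong suc (sum-one {n})

  sum-== : (x : Fin n) → sum (λ i → ⟦ x == i ⟧) ≡ 1
  sum-== {n} x = trans (sum-cong-≗ {n} go) (sum-only x (λ _ → 1))
    where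
    go : ∀ i → ⟦ x == i ⟧ ≡ only x (λ _ → 1) i
    go i with x Fin.≟ i | i Fin.≟ x
    ... | yes _ | yes _ = refl
    ... | no _ | no _ = refl
    ... | yes refl | no p = ⊥-elim (p refl)
    ... | no p | yes refl = ⊥-elim (p refl)

  -- Allows the balance of a class of darts to be proved as an inequality at every vertex, the
  -- totals being equal by exchanging the sums.
  sum-mono-≡ : {f g : Fin n → ℕ} → (∀ i → f i ≤ g i) → sum f ≡ sum g → ∀ i → f i ≡ g i
  sum-mono-≡ {suc n} {f} {g} le eq zero = ≤-antisym (le zero) (+-cancelʳ-≤ (sum (f ∘ suc)) _ _ (≤-trans (+-monoʳ-≤ (g zero) (sum-mono (le ∘ suc))) (≤-reflexive (sym eq))))
  sum-mono-≡ {suc n} {f} {g} le eq (suc i) = sum-mono-≡ {f = f ∘ suc} (le ∘ suc)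
    (≤-antisym (sum-mono (le ∘ suc)) (+-cancelˡ-≤ (f zero) _ _ (≤-trans (+-monoˡ-≤ (sum (g ∘ suc)) (le zero)) (≤-reflexive (sym eq))))) i

  atMostOne : (p : Fin n → Bool) → (∀ {i j} → p i ≡ true → p j ≡ true → i ≡ j) → sum (λ i → ⟦ p i ⟧) ≤ 1
  atMostOne {n} p unique with Fin.any? (λ i → p i Bool.≟ true)
  ... | no none = ≤-trans (≤-reflexive (trans (sum-cong-≗ {n} (λ i → cong ⟦_⟧ (≢true (λ e → none (i , e))))) (sum-zero {n}))) z≤n
  ... | yes (j , pj) = ≤-trans (sum-mono le) (≤-reflexive (sum-only j (λ _ → 1)))
    where
    le : ∀ i → ⟦ p i ⟧ ≤ only j (λ _ → 1) i
    le i with p i in e | i Fin.≟ j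
    ... | false | _ = z≤n
    ... | true | yes _ = ≤-refl
    ... | true | no i≢j = ⊥-elim (i≢j (unique e pj))

  -- The pairs (i , h i) are counted in both orders; injectivity leaves at most one pair over each
  -- j.
  sum-injection : ∀ {a b} (p : Fin a → Bool) (q : Fin b → Bool) (h : Fin a → Fin b) →
    (∀ {i} → p i ≡ true → q (h i) ≡ true) → (∀ {i j} → p i ≡ true → p j ≡ true → h i ≡ h j → i ≡ j) →
    sum (λ i → ⟦ p i ⟧) ≤ sum (λ j → ⟦ q j ⟧)
  sum-injection {a} {b} p q h p⇒q injective = begin
    sum (λ i → ⟦ p i ⟧) ≡⟨ sum-cong-≗ {a} spread ⟩
    sum₂ (λ i j → ⟦ p i ∧ (h i == j) ⟧) ≡⟨ ∑-comm (λ i j → ⟦ p i ∧ (h i == j) ⟧) ⟩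
    sum₂ (λ j i → ⟦ p i ∧ (h i == j) ⟧) ≤⟨ sum-mono fibre ⟩
    sum (λ j → ⟦ q j ⟧) ∎
    where
    open ≤-Reasoning
    spread : ∀ i → ⟦ p i ⟧ ≡ sum (λ j → ⟦ p i ∧ (h i == j) ⟧)
    spread i with p i
    ... | true = sym (sum-== (h i))
    ... | false = sym (sum-zero {b})
    ==-true : ∀ {m} {x y : Fin m} → (x == y) ≡ true → x ≡ y
    ==-true {x = x} {y} e with x Fin.≟ y
    ... | yes r = r
    fibre : ∀ j → sum (λ i → ⟦ p i ∧ (h i == j) ⟧) ≤ ⟦ q j ⟧
    fibre j with q j in qj
    ... | true = atMostOne _ λ s t → let s₁ , s₂ = ∧-true s ; t₁ , t₂ = ∧-true t in injective s₁ t₁ (trans (==-true s₂) (sym (==-true t₂)))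
    ... | false = ≤-reflexive (trans (sum-cong-≗ {a} (λ i → cong ⟦_⟧ (≢true (λ s → let s₁ , s₂ = ∧-true s in
                    true≢false (p⇒q s₁) (trans (cong q (==-true s₂)) qj))))) (sum-zero {a}))

  pair : ∀ {m n} → Fin m → Fin n → Fin m → Fin n → Bool
  pair i j u v = (u == i) ∧ (v == j)

  total-pair : ∀ {m n} (i : Fin m) (j : Fin n) → total (pair i j) ≡ 1
  total-pair {m} {n} i j = trans (sum-cong-≗ {m} row) (sum-only i (λ _ → 1))
    where
    row : ∀ u → sum (λ v → ⟦ pair i j u v ⟧) ≡ only i (λ _ → 1) u
    row u with u Fin.≟ i
    ... | yes _ = sum-only j (λ _ → 1)
    ... | no _ = sum-zero {n}

  pair-true : ∀ {m n} {i u : Fin m} {j v : Fin n} → pair i j u v ≡ true → u ≡ i × v ≡ j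
  pair-true {i = i} {u} {j} {v} e with u Fin.≟ i | v Fin.≟ j
  ... | yes p | yes q = p , q

  without : ∀ {m n} → Fin m → Fin n → (Fin m → Fin n → Bool) → Fin m → Fin n → Bool
  without i j p u v = p u v ∧ not (pair i j u v)

  total-without : ∀ {m n} {p : Fin m → Fin n → Bool} {i j} → p i j ≡ true → total p ≡ suc (total (without i j p))
  total-without {p = p} {i} {j} pij = trans (sum₂-cong pointwise)
    (trans (sum₂-+ (λ u v → ⟦ pair i j u v ⟧) (λ u v → ⟦ without i j p u v ⟧)) (cong (_+ total (without i j p)) (total-pair i j)))
    where
    pointwise : ∀ u v → ⟦ p u v ⟧ ≡ ⟦ pair i j u v ⟧ + ⟦ without i j p u v ⟧
    pointwise u v with pair i j u v in e
    ... | true with refl , refl ← pair-true {i = i} {u} {j} {v} e rewrite pij = refl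
    ... | false with p u v
    ...   | true = refl
    ...   | false = refl

  without-true : ∀ {m n} {p : Fin m → Fin n → Bool} {i j u v} → p u v ≡ true → ¬ (u ≡ i × v ≡ j) → without i j p u v ≡ true
  without-true {i = i} {j} {u} {v} puv ne rewrite puv with pair i j u v in e
  ... | false = refl
  ... | true = ⊥-elim (ne (pair-true {i = i} {u} {j} {v} e))

  three≤total : ∀ {m n} (p : Fin m → Fin n → Bool) {i j i′ j′ i″ j″} → p i j ≡ true → p i′ j′ ≡ true → p i″ j″ ≡ true →
    ¬ (i′ ≡ i × j′ ≡ j) → ¬ (i″ ≡ i × j″ ≡ j) → ¬ (i″ ≡ i′ × j″ ≡ j′) → 3 ≤ total p
  three≤total p {i} {j} {i′} {j′} {i″} {j″} a b c ne ne′ ne″ = begin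
    3 ≤⟨ s≤s (s≤s (≤-trans (≤-reflexive (sym (cong ⟦_⟧ c₂))) (≤-sum₂ (λ u v → ⟦ without i′ j′ p₁ u v ⟧) i″ j″))) ⟩
    suc (suc (total (without i′ j′ p₁))) ≡⟨ cong suc (total-without {p = p₁} b₁) ⟨
    suc (total p₁) ≡⟨ total-without {p = p} a ⟨
    total p ∎
    where
    open ≤-Reasoning
    p₁ = without i j p
    b₁ : p₁ i′ j′ ≡ true
    b₁ = without-true {p = p} b ne
    c₂ : without i′ j′ p₁ i″ j″ ≡ true
    c₂ = without-true {p = p₁} (without-true {p = p} c ne′) ne″

  -- By induction on the number of pairs, removing one pair together with its image at a time.
  total-injection : ∀ {a b m n} (p : Fin a → Fin b → Bool) (q : Fin m → Fin n → Bool)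
    (x : Fin a → Fin b → Fin m) (y : Fin a → Fin b → Fin n) →
    (∀ {i j} → p i j ≡ true → q (x i j) (y i j) ≡ true) →
    (∀ {i j i′ j′} → p i j ≡ true → p i′ j′ ≡ true → x i j ≡ x i′ j′ → y i j ≡ y i′ j′ → i ≡ i′ × j ≡ j′) →
    total p ≤ total q
  total-injection {a} {b} {m} {n} p q x y p⇒q injective = go (total p) p q refl p⇒q injective
    where
    go : ∀ t (p : Fin a → Fin b → Bool) (q : Fin m → Fin n → Bool) → total p ≡ t →
         (∀ {i j} → p i j ≡ true → q (x i j) (y i j) ≡ true) →
         (∀ {i j i′ j′} → p i j ≡ true → p i′ j′ ≡ true → x i j ≡ x i′ j′ → y i j ≡ y i′ j′ → i ≡ i′ × j ≡ j′) →
         t ≤ total q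
    go zero p q _ _ _ = z≤n
    go (suc t) p q eq p⇒q inj with Fin.any? (λ i → Fin.any? (λ j → p i j Bool.≟ true))
    ... | no none with () ← trans (sym eq) (sum₂-zero (λ i j → cong ⟦_⟧ (≢true (λ e → none (i , j , e)))))
    ... | yes (i , j , e) = ≤-trans (s≤s (go t (without i j p) (without (x i j) (y i j) q)
            (suc-injective (trans (sym (total-without {p = p} e)) eq))
            (λ s → let s₁ , s₂ = ∧-true s in without-true {p = q} (p⇒q s₁)
               (λ (r₁ , r₂) → let z₁ , z₂ = inj s₁ e r₁ r₂ in true≢false (pair-refl z₁ z₂) (not-true s₂)))
            (λ s t → inj (proj₁ (∧-true s)) (proj₁ (∧-true t)))))
          (≤-reflexive (sym (total-without {p = q} (p⇒q e))))
      where
      not-true : ∀ {a} → not a ≡ true → a ≡ false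
      not-true {false} _ = refl
      pair-refl : ∀ {m n} {i u : Fin m} {j v : Fin n} → u ≡ i → v ≡ j → pair i j u v ≡ true
      pair-refl {u = u} {v = v} refl refl rewrite ==-refl u | ==-refl v = refl

  module _ {A : Set} {P : Pred A 0ℓ} (P? : Decidable P) where

    length-filter-tabulate : (f : Fin n → A) → length (filter P? (tabulate f)) ≡ sum (λ i → ⟦ does (P? (f i)) ⟧)
    length-filter-tabulate {zero} f = refl
    length-filter-tabulate {suc n} f with P? (f zero)
    ... | yes _ = cong suc (length-filter-tabulate (f ∘ suc))
    ... | no _ = length-filter-tabulate (f ∘ suc)

  length-filter-pairs : ∀ {P : Pred (Fin n × Fin n) 0ℓ} (P? : Decidable P) →
    length (filter P? (cartesianProduct (allFin n) (allFin n))) ≡ total (λ u v → does (P? (u , v)))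
  length-filter-pairs {n} P? = go id
    where
    go : ∀ {m} (f : Fin m → Fin n) → length (filter P? (cartesianProduct (tabulate f) (allFin n))) ≡ sum (λ u → sum (λ v → ⟦ does (P? (f u , v)) ⟧))
    go {zero} f = refl
    go {suc m} f = trans (cong length (filter-++ P? (map (f zero ,_) (allFin n)) _))
      (trans (length-++ (filter P? (map (f zero ,_) (allFin n))))
        (cong₂ _+_ (trans (cong (λ xs → length (filter P? xs)) (map-tabulate id (f zero ,_))) (length-filter-tabulate P? (f zero ,_))) (go (f ∘ suc))))

  total-comm : (p : Fin n → Fin n → Bool) → total (λ u v → p v u) ≡ total p
  total-comm p = ∑-comm (λ u v → ⟦ p v u ⟧)

  total-double : (p : Fin n → Fin n → Bool) → (∀ u v → p u v ≡ p v u) → (∀ u → p u u ≡ false) →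
    total p ≡ total (λ u v → does (u Fin.<? v) ∧ p u v) + total (λ u v → does (u Fin.<? v) ∧ p u v)
  total-double p p-sym p-irr = trans (sum₂-cong pointwise)
    (trans (sum₂-+ (λ u v → ⟦ does (u Fin.<? v) ∧ p u v ⟧) (λ u v → ⟦ does (v Fin.<? u) ∧ p v u ⟧))
      (cong (total (λ u v → does (u Fin.<? v) ∧ p u v) +_) (total-comm (λ u v → does (u Fin.<? v) ∧ p u v))))
    where
    pointwise : ∀ u v → ⟦ p u v ⟧ ≡ ⟦ does (u Fin.<? v) ∧ p u v ⟧ + ⟦ does (v Fin.<? u) ∧ p v u ⟧
    pointwise u v with Fin.toℕ u <ᵇ Fin.toℕ v in e | Fin.toℕ v <ᵇ Fin.toℕ u in e′
    ... | true | false = sym (+-identityʳ _)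
    ... | false | true = cong ⟦_⟧ (p-sym u v)
    ... | true | true = ⊥-elim (<-asym (<ᵇ⇒< (Fin.toℕ u) (Fin.toℕ v) (subst T (sym e) tt)) (<ᵇ⇒< (Fin.toℕ v) (Fin.toℕ u) (subst T (sym e′) tt)))
    ... | false | false with Fin.<-cmp u v
    ...   | tri< l _ _ = ⊥-elim (subst T e (<⇒<ᵇ l))
    ...   | tri> _ _ g = ⊥-elim (subst T e′ (<⇒<ᵇ g))
    ...   | tri≈ _ refl _ rewrite p-irr u = refl

  -- Circulations

  -- Meant for the darts of a class of faces whose reversals lie in other classes.
  record Circulation (a : Fin n → Fin n → Bool) : Set where
    field
      balanced : ∀ u → sum (λ v → ⟦ a u v ⟧) ≡ sum (λ v → ⟦ a v u ⟧)
      asymmetric : ∀ {u v} → a u v ≡ true → a v u ≡ false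

  open Circulation

  module _ {a : Fin n → Fin n → Bool} (circ : Circulation a) where

    private
      -- The balance is summed over the vertices in χ; arcs with both ends there occur on both sides
      -- and cancel.
      cut-balanced : (χ : Fin n → Bool) → total (λ u v → (χ u ∧ not (χ v)) ∧ a u v) ≡ total (λ u v → (χ u ∧ not (χ v)) ∧ a v u)
      cut-balanced χ = +-cancelˡ-≡ (total (λ u v → (χ u ∧ χ v) ∧ a u v)) _ _ (begin
        inside a + outside a ≡⟨ sym (split a) ⟩
        total (λ u v → χ u ∧ a u v) ≡⟨ sum-cong-≗ {n} rows ⟩
        total (λ u v → χ u ∧ a v u) ≡⟨ split (λ u v → a v u) ⟩
        inside (λ u v → a v u) + outside (λ u v → a v u) ≡⟨ cong (_+ outside (λ u v → a v u)) inside-comm ⟩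
        inside a + outside (λ u v → a v u) ∎)
        where
        open ≡-Reasoning
        inside outside : (Fin n → Fin n → Bool) → ℕ
        inside b = total (λ u v → (χ u ∧ χ v) ∧ b u v)
        outside b = total (λ u v → (χ u ∧ not (χ v)) ∧ b u v)
        bit : ∀ x y z → ⟦ x ∧ z ⟧ ≡ ⟦ (x ∧ y) ∧ z ⟧ + ⟦ (x ∧ not y) ∧ z ⟧
        bit false _ _ = refl
        bit true true z = sym (+-identityʳ _)
        bit true false z = refl
        split : ∀ b → total (λ u v → χ u ∧ b u v) ≡ inside b + outside b
        split b = trans (sum₂-cong (λ u v → bit (χ u) (χ v) (b u v))) (sum₂-+ (λ u v → ⟦ (χ u ∧ χ v) ∧ b u v ⟧) (λ u v → ⟦ (χ u ∧ not (χ v)) ∧ b u v ⟧))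
        rows : ∀ u → sum (λ v → ⟦ χ u ∧ a u v ⟧) ≡ sum (λ v → ⟦ χ u ∧ a v u ⟧)
        rows u with χ u
        ... | true = balanced circ u
        ... | false = refl
        inside-comm : inside (λ u v → a v u) ≡ inside a
        inside-comm = trans (sum₂-cong (λ u v → cong (λ x → ⟦ x ∧ a v u ⟧) (∧-comm (χ u) (χ v)))) (total-comm (λ u v → (χ u ∧ χ v) ∧ a u v))

    -- An arc entering a set of vertices is matched by an arc leaving it.
    leaves : (χ : Fin n → Bool) → ∀ {u v} → a u v ≡ true → χ u ≡ false → χ v ≡ true →
             ∃₂ λ u′ v′ → a u′ v′ ≡ true × χ u′ ≡ true × χ v′ ≡ false
    leaves χ {u} {v} auv χu χv with Fin.any? (λ u′ → Fin.any? (λ v′ → ((χ u′ ∧ not (χ v′)) ∧ a u′ v′) Bool.≟ true))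
    ... | yes (u′ , v′ , e) = let p , q = ∧-true {χ u′ ∧ not (χ v′)} e ; r , s = ∧-true {χ u′} p in u′ , v′ , q , r , not-true s
      where
      not-true : ∀ {a} → not a ≡ true → a ≡ false
      not-true {false} _ = refl
    ... | no none = ⊥-elim (1+n≰n (≤-trans (≤-trans (≤-reflexive (sym (cong ⟦_⟧ entering))) (≤-sum₂ (λ u v → ⟦ (χ u ∧ not (χ v)) ∧ a v u ⟧) v u))
                      (≤-reflexive (trans (sym (cut-balanced χ)) (sum₂-zero (λ u v → cong ⟦_⟧ (≢true (λ e → none (u , v , e)))))))))
      where
      entering : (χ v ∧ not (χ u)) ∧ a u v ≡ true
      entering rewrite χv | χu = auv

  -- Discarding pairs of opposite arcs removes equally many arcs into and out of each vertex.
  circulation : (c : Fin n → Fin n → Bool) → (∀ u → sum (λ v → ⟦ c u v ⟧) ≡ sum (λ v → ⟦ c v u ⟧)) →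
                Circulation (λ u v → c u v ∧ not (c v u))
  circulation {n} c bal = record
    { balanced = λ u → +-cancelʳ-≡ (sum (λ v → ⟦ c u v ∧ c v u ⟧)) _ _ (begin
        sum (λ v → ⟦ c u v ∧ not (c v u) ⟧) + sum (λ v → ⟦ c u v ∧ c v u ⟧) ≡⟨ split (λ v → c u v) (λ v → c v u) ⟨
        sum (λ v → ⟦ c u v ⟧) ≡⟨ bal u ⟩
        sum (λ v → ⟦ c v u ⟧) ≡⟨ split (λ v → c v u) (λ v → c u v) ⟩
        sum (λ v → ⟦ c v u ∧ not (c u v) ⟧) + sum (λ v → ⟦ c v u ∧ c u v ⟧)
          ≡⟨ cong (sum (λ v → ⟦ c v u ∧ not (c u v) ⟧) +_) (sum-cong-≗ {n} (λ v → cong ⟦_⟧ (∧-comm (c v u) (c u v)))) ⟩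
        sum (λ v → ⟦ c v u ∧ not (c u v) ⟧) + sum (λ v → ⟦ c u v ∧ c v u ⟧) ∎)
    ; asymmetric = λ {u} {v} → asymmetric′ (c u v) (c v u)
    }
    where
    open ≡-Reasoning
    bit : ∀ x y → ⟦ x ⟧ ≡ ⟦ x ∧ not y ⟧ + ⟦ x ∧ y ⟧
    bit false _ = refl
    bit true true = refl
    bit true false = refl
    split : (p q : Fin n → Bool) → sum (λ v → ⟦ p v ⟧) ≡ sum (λ v → ⟦ p v ∧ not (q v) ⟧) + sum (λ v → ⟦ p v ∧ q v ⟧)
    split p q = trans (sum-cong-≗ {n} (λ v → bit (p v) (q v))) (∑-distrib-+ {n} _ _)
    asymmetric′ : ∀ x y → x ∧ not y ≡ true → y ∧ not x ≡ false
    asymmetric′ true false _ = refl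

  -- If the quotient of a circulation by r has no opposite arcs, then an arc
  -- that survives in the quotient is the first of three consecutive ones.
  threeArcs : {R : Set} (_≟_ : (x y : R) → Dec (x ≡ y)) (r : Fin n → R) {a : Fin n → Fin n → Bool} → Circulation a →
    (∀ {u v u′ v′} → a u v ≡ true → a u′ v′ ≡ true → r u ≢ r v → r u′ ≡ r v → r v′ ≡ r u → ⊥) →
    ∀ {u v} → a u v ≡ true → r u ≢ r v →
    ∃₂ λ u′ v′ → ∃₂ λ u″ v″ → a u′ v′ ≡ true × a u″ v″ ≡ true × r u′ ≡ r v × r u″ ≡ r v′ × r u′ ≢ r v′ × r u″ ≢ r v″ × r u ≢ r v′
  threeArcs {n} _≟_ r {a} circ simple {u} {v} e cross =
    let u′ , v′ , e′ , p′ , q′ = next e cross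
        u″ , v″ , e″ , p″ , q″ = next e′ (λ eq → q′ (trans (sym eq) p′))
    in u′ , v′ , u″ , v″ , e′ , e″ , p′ , p″ , (λ eq → q′ (trans (sym eq) p′)) , (λ eq → q″ (trans (sym eq) p″)) ,
       (λ eq → simple e e′ cross p′ (sym eq))
    where
    -- The given arc enters the class of its head, so some arc leaves that class.
    next : ∀ {u v} → a u v ≡ true → r u ≢ r v → ∃₂ λ u′ v′ → a u′ v′ ≡ true × r u′ ≡ r v × r v′ ≢ r v
    next {u} {v} e cross with leaves circ (λ w → does (r w ≟ r v)) e (is-false cross) (is-true refl)
      where
      is-true : ∀ {x y} → x ≡ y → does (x ≟ y) ≡ true
      is-true {x} {y} p with x ≟ y
      ... | yes _ = refl
      ... | no q = ⊥-elim (q p)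
      is-false : ∀ {x y} → x ≢ y → does (x ≟ y) ≡ false
      is-false {x} {y} p with x ≟ y
      ... | no _ = refl
      ... | yes q = ⊥-elim (p q)
    ... | u′ , v′ , e′ , p , q with r u′ ≟ r v | r v′ ≟ r v
    ...   | yes p′ | no q′ = u′ , v′ , e′ , p′ , q′

  -- Partitions and spanning forests

  record Partition (A : Set) (k : ℕ) : Set where
    field
      class : A → Fin k
      inhabited : ∀ i → ∃ λ x → class x ≡ i

  open Partition

  identify : ∀ {k} (i j : Fin (suc k)) → i ≢ j → Fin (suc k) → Fin k
  identify i j i≢j x with x Fin.≟ j
  ... | yes _ = punchOut {i = j} {i} (i≢j ∘ sym)
  ... | no x≢j = punchOut {i = j} {x} (x≢j ∘ sym)

  module _ {k : ℕ} (i j : Fin (suc k)) (i≢j : i ≢ j) where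

    identify-≡ : identify i j i≢j i ≡ identify i j i≢j j
    identify-≡ with i Fin.≟ j | j Fin.≟ j
    ... | yes p | _ = ⊥-elim (i≢j p)
    ... | no _ | no q = ⊥-elim (q refl)
    ... | no _ | yes _ = Fin.punchOut-cong j refl

    identify-injective : ∀ {x y} → identify i j i≢j x ≡ identify i j i≢j y → x ≡ y ⊎ (x ≡ i × y ≡ j) ⊎ (x ≡ j × y ≡ i)
    identify-injective {x} {y} e with x Fin.≟ j | y Fin.≟ j
    ... | yes p | yes q = inj₁ (trans p (sym q))
    ... | yes p | no q = inj₂ (inj₂ (p , sym (Fin.punchOut-injective (i≢j ∘ sym) (q ∘ sym) e)))
    ... | no p | yes q = inj₂ (inj₁ (Fin.punchOut-injective (p ∘ sym) (i≢j ∘ sym) e , q))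
    ... | no p | no q = inj₁ (Fin.punchOut-injective (p ∘ sym) (q ∘ sym) e)

    identify-surjective : ∀ y → ∃ λ x → identify i j i≢j x ≡ y
    identify-surjective y = punchIn j y , lemma
      where
      lemma : identify i j i≢j (punchIn j y) ≡ y
      lemma with punchIn j y Fin.≟ j
      ... | yes p = ⊥-elim (Fin.punchInᵢ≢i j y p)
      ... | no _ = trans (Fin.punchOut-cong j refl) (Fin.punchOut-punchIn j {y})

  module _ {A : Set} where

    record Glued {k : ℕ} (r : Partition A k) (x y : A) : Set where
      field
        {size} : ℕ
        size-≡ : k ≡ suc size
        glued  : Partition A size
        respects : ∀ {u v} → class r u ≡ class r v → class glued u ≡ class glued v
        joined : class glued x ≡ class glued y
        faithful : ∀ {u v} → class glued u ≡ class glued v →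
                   class r u ≡ class r v ⊎ (class r u ≡ class r x × class r v ≡ class r y) ⊎ (class r u ≡ class r y × class r v ≡ class r x)

    glue : ∀ {k} (r : Partition A k) {x y} → class r x ≢ class r y → Glued r x y
    glue {zero} r {x} _ with () ← class r x
    glue {suc k} r {x} {y} x≢y = record
      { size-≡ = refl
      ; glued = record
          { class = f ∘ class r
          ; inhabited = λ i → let j , p = identify-surjective (class r x) (class r y) x≢y i
                                  z , q = inhabited r j
                              in z , trans (cong f q) p }
      ; respects = cong f
      ; joined = identify-≡ (class r x) (class r y) x≢y
      ; faithful = identify-injective (class r x) (class r y) x≢y
      }
      where
      f : Fin (suc k) → Fin k
      f = identify (class r x) (class r y) x≢y

    -- The size is bounded on one side only, because a listed pair may lie in a common class
    -- already.
    record Coarsening {k : ℕ} (r : Partition A k) (es : List (A × A)) : Set where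
      field
        {size} : ℕ
        partition : Partition A size
        respects : ∀ {u v} → class r u ≡ class r v → class partition u ≡ class partition v
        joined : ∀ {u v} → (u , v) ∈ es → class partition u ≡ class partition v
        size-≤ : k ≤ size + length es

    coarsen : ∀ {k} (r : Partition A k) es → Coarsening r es
    coarsen r [] = record { partition = r ; respects = id ; joined = λ () ; size-≤ = m≤m+n _ 0 }
    coarsen {k} r ((x , y) ∷ es) with class r x Fin.≟ class r y
    ... | yes p = record
      { partition = partition ; respects = respects
      ; joined = λ { (here refl) → respects p ; (there m) → joined m }
      ; size-≤ = ≤-trans size-≤ (+-monoʳ-≤ size (n≤1+n _)) }
      where open Coarsening (coarsen r es)
    ... | no p with glue r p
    ...   | record { size-≡ = refl ; glued = r′ ; respects = resp ; joined = join } = record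
      { partition = partition ; respects = respects ∘ resp
      ; joined = λ { (here refl) → respects join ; (there m) → joined m }
      ; size-≤ = ≤-trans (s≤s size-≤) (≤-reflexive (sym (+-suc size (length es)))) }
      where open Coarsening (coarsen r′ es)

  -- Adding the edges es one by one to a graph with components r, those that
  -- close a cycle are collected in chords.
  record Forest {n k : ℕ} (r : Partition (Fin n) k) (es : List (Fin n × Fin n)) : Set₁ where
    field
      {size} : ℕ
      partition : Partition (Fin n) size
      chords : List (Fin n × Fin n)
      chords-⊆ : ∀ {e} → e ∈ chords → e ∈ es
      count : length chords + k ≡ length es + size
      respects : ∀ {u v} → class r u ≡ class r v → class partition u ≡ class partition v
      joined : ∀ {u v} → (u , v) ∈ es → class partition u ≡ class partition v
      inner : ∀ {u v} → (u , v) ∈ es → class r u ≡ class r v → (u , v) ∈ chords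
      -- This says that the classes are generated by those of `r` and the edges `es`: nothing else
      -- is joined.
      invariant : {B : Set} (φ : Fin n → B) → (∀ {u v} → class r u ≡ class r v → φ u ≡ φ v) →
                  (∀ {u v} → (u , v) ∈ es → φ u ≡ φ v) → ∀ {u v} → class partition u ≡ class partition v → φ u ≡ φ v
      -- A circulation avoiding the chords avoids the tree edges too.
      flowless : ∀ {a} → Circulation a → (∀ {u v} → (u , v) ∈ chords → a u v ≡ false × a v u ≡ false) →
                 (∀ {u v} → a u v ≡ true → class partition u ≡ class partition v) →
                 (∀ {u v} → a u v ≡ true → class r u ≢ class r v → (u , v) ∈ es ⊎ (v , u) ∈ es) →
                 ∀ {u v} → a u v ≡ true → class r u ≡ class r v

  forest : ∀ {n k} (r : Partition (Fin n) k) es → Forest r es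
  forest r [] = record
    { partition = r ; chords = [] ; chords-⊆ = λ () ; count = refl ; respects = id ; joined = λ () ; inner = λ ()
    ; invariant = λ φ p _ → p ; flowless = λ _ _ p _ → p }
  forest {n} r ((x , y) ∷ es) with class r x Fin.≟ class r y
  ... | yes x≡y = record
    { partition = partition ; chords = (x , y) ∷ chords
    ; chords-⊆ = λ { (here refl) → here refl ; (there m) → there (chords-⊆ m) }
    ; count = cong suc count ; respects = respects
    ; joined = λ { (here refl) → respects x≡y ; (there m) → joined m }
    ; inner = λ { (here refl) _ → here refl ; (there m) p → there (inner m p) }
    ; invariant = λ φ p q → invariant φ p (q ∘ there)
    ; flowless = λ circ none inside known → flowless circ (none ∘ there) inside (λ e ne → later ne (known e ne))
    }
    where
    open Forest (forest r es)
    later : ∀ {u v} → class r u ≢ class r v → (u , v) ∈ (x , y) ∷ es ⊎ (v , u) ∈ (x , y) ∷ es → (u , v) ∈ es ⊎ (v , u) ∈ es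
    later ne (inj₁ (here refl)) = ⊥-elim (ne x≡y)
    later ne (inj₁ (there m)) = inj₁ m
    later ne (inj₂ (here refl)) = ⊥-elim (ne (sym x≡y))
    later ne (inj₂ (there m)) = inj₂ m
  ... | no x≢y with glue r x≢y
  ...   | record { size-≡ = refl ; glued = r′ ; respects = resp ; joined = join ; faithful = faith } = record
    { partition = partition ; chords = chords ; chords-⊆ = there ∘ chords-⊆
    ; count = trans (+-suc (length chords) _) (cong suc count)
    ; respects = respects ∘ resp
    ; joined = λ { (here refl) → respects join ; (there m) → joined m }
    ; inner = λ { (here refl) p → ⊥-elim (x≢y p) ; (there m) p → inner m (resp p) }
    ; invariant = λ φ p q → invariant φ (coarse φ p (q (here refl))) (q ∘ there)
    ; flowless = flowless′
    }
    where
    open Forest (forest r′ es)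
    coarse : {B : Set} (φ : Fin n → B) → (∀ {u v} → class r u ≡ class r v → φ u ≡ φ v) → φ x ≡ φ y → ∀ {u v} → class r′ u ≡ class r′ v → φ u ≡ φ v
    coarse φ p q e with faith e
    ... | inj₁ s = p s
    ... | inj₂ (inj₁ (s , t)) = trans (p s) (trans q (sym (p t)))
    ... | inj₂ (inj₂ (s , t)) = trans (p s) (trans (sym q) (sym (p t)))

    module _ {a : Fin n → Fin n → Bool} (circ : Circulation a) (none : ∀ {u v} → (u , v) ∈ chords → a u v ≡ false × a v u ≡ false)
             (inside : ∀ {u v} → a u v ≡ true → class partition u ≡ class partition v)
             (known : ∀ {u v} → a u v ≡ true → class r u ≢ class r v → (u , v) ∈ (x , y) ∷ es ⊎ (v , u) ∈ (x , y) ∷ es) where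

      in-r′ : ∀ {u v} → a u v ≡ true → class r′ u ≡ class r′ v
      in-r′ = flowless circ none inside λ e ne → later ne (known e (ne ∘ resp))
        where
        later : ∀ {u v} → class r′ u ≢ class r′ v → (u , v) ∈ (x , y) ∷ es ⊎ (v , u) ∈ (x , y) ∷ es → (u , v) ∈ es ⊎ (v , u) ∈ es
        later ne (inj₁ (here refl)) = ⊥-elim (ne join)
        later ne (inj₁ (there m)) = inj₁ m
        later ne (inj₂ (here refl)) = ⊥-elim (ne (sym join))
        later ne (inj₂ (there m)) = inj₂ m

      only-xy : ∀ {u v} → a u v ≡ true → class r u ≢ class r v → (u ≡ x × v ≡ y) ⊎ (u ≡ y × v ≡ x)
      only-xy e ne with known e ne
      ... | inj₁ (here refl) = inj₁ (refl , refl)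
      ... | inj₂ (here refl) = inj₂ (refl , refl)
      ... | inj₁ (there m) = ⊥-elim (true≢false e (proj₁ (none (inner m (in-r′ e)))))
      ... | inj₂ (there m) = ⊥-elim (true≢false e (proj₂ (none (inner m (sym (in-r′ e))))))

      -- By recursion all arcs stay inside classes of `r′`, so only the tree edge between `x` and
      -- `y` can leave a class of `r`. What enters a class must leave it again, here along the same
      -- edge in the opposite direction, which asymmetry forbids.
      flowless′ : ∀ {u v} → a u v ≡ true → class r u ≡ class r v
      flowless′ {u} {v} e with class r u Fin.≟ class r v
      ... | yes p = p
      ... | no ne with leaves circ (λ w → class r w == class r v) e (==-≢ ne) (==-refl (class r v))
      ...   | u′ , v′ , e′ , p , q with class r u′ Fin.≟ class r v | class r v′ Fin.≟ class r v
      ...     | yes p′ | no q′ with only-xy e ne | only-xy e′ (λ s → q′ (trans (sym s) p′))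
      ...       | inj₁ (refl , refl) | inj₁ (refl , refl) = ⊥-elim (ne p′)
      ...       | inj₂ (refl , refl) | inj₂ (refl , refl) = ⊥-elim (ne p′)
      ...       | inj₁ (refl , refl) | inj₂ (refl , refl) = ⊥-elim (true≢false e′ (Circulation.asymmetric circ e))
      ...       | inj₂ (refl , refl) | inj₁ (refl , refl) = ⊥-elim (true≢false e′ (Circulation.asymmetric circ e))

  finest : ∀ n → Partition (Fin n) n
  finest n = record { class = id ; inhabited = λ i → i , refl }

  module _ {A : Set} {R : Rel A 0ℓ} {k : ℕ} (cc : ClassCount R k) where

    open ClassCount cc

    class-of : A → Fin k
    class-of x = proj₁ (covers x)

    class-of-≡ : ∀ {x y} → EqClosure R x y → class-of x ≡ class-of y
    class-of-≡ {x} {y} p = distinct _ _ (Eq.transitive R (Eq.symmetric R (proj₂ (covers x))) (Eq.transitive R p (proj₂ (covers y))))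

    class-of-≡⁻ : ∀ {x y} → class-of x ≡ class-of y → EqClosure R x y
    class-of-≡⁻ {x} {y} e = Eq.transitive R (proj₂ (covers x)) (subst (λ i → EqClosure R (rep i) y) (sym e) (Eq.symmetric R (proj₂ (covers y))))

    classes : Partition A k
    classes = record { class = class-of ; inhabited = λ i → rep i , distinct _ _ (Eq.symmetric R (proj₂ (covers (rep i)))) }

  ==-true : {i j : Fin n} → (i == j) ≡ true → i ≡ j
  ==-true {i = i} {j} e with i Fin.≟ j
  ... | yes p = p

  does-true : {P : Set} (P? : Dec P) → does P? ≡ true → P
  does-true (yes p) _ = p

  true-does : {P : Set} (P? : Dec P) → P → does P? ≡ true
  true-does (yes _) _ = refl
  true-does (no p) q = ⊥-elim (p q)

  -- Classes of faces and the components they occupy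

  module Faces {n : ℕ} (G : Graph n) (rotation : RotationSystem G) {k : ℕ} (q : Partition (Dart G) k)
               (face : ∀ d → class q (RotationSystem.faceStep rotation d) ≡ class q d) where

    open Graph G
    open RotationSystem rotation

    private
      colour : Fin k → ∀ {u v} → Dec (Adj u v) → Bool
      colour κ {u} {v} (yes a) = class q (dart u v a) == κ
      colour κ (no _) = false

    -- A class of darts as a relation on vertices, so that darts are counted by sums over pairs of
    -- vertices.
    on : Fin k → Fin n → Fin n → Bool
    on κ u v = colour κ (adj? u v)

    on-dart : ∀ κ {u v} (a : Adj u v) → on κ u v ≡ (class q (dart u v a) == κ)
    on-dart κ {u} {v} a with adj? u v
    ... | yes _ = refl
    ... | no ¬a = contradiction a ¬a

    on-adj : ∀ κ {u v} → on κ u v ≡ true → Adj u v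
    on-adj κ {u} {v} e with adj? u v
    ... | yes a = a

    on-unique : ∀ κ κ′ {u v} → on κ u v ≡ true → on κ′ u v ≡ true → κ ≡ κ′
    on-unique κ κ′ {u} {v} e e′ with adj? u v
    ... | yes a = trans (sym (==-true {i = class q (dart u v a)} {κ} e)) (==-true {i = class q (dart u v a)} {κ′} e′)

    on-next : ∀ κ {u v} → Adj u v → on κ v u ≡ on κ u (next u v)
    on-next κ {u} {v} a = trans (on-dart κ (adj-sym a))
      (trans (cong (_== κ) (sym (face (dart v u (adj-sym a))))) (sym (on-dart κ (next-adj a))))

    private
      -- The rotation, started at `next u w`, comes back to `w`; the last stop before is the
      -- predecessor, which is `w` itself if no step is made.
      previous : ∀ {u w} → Adj u w → ∃ λ v → Adj u v × next u v ≡ w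
      previous {u} {w} a with go (transitive (next-adj a) a) (next-adj a)
        where
        go : ∀ {x} → Star (λ x y → next u x ≡ y) x w → Adj u x → x ≡ w ⊎ ∃ λ v → Adj u v × next u v ≡ w
        go ε _ = inj₁ refl
        go {x} (refl ◅ s) b with go s (next-adj b)
        ... | inj₁ e = inj₂ (x , b , e)
        ... | inj₂ r = inj₂ r
      ... | inj₁ e = w , a , e
      ... | inj₂ r = r

      before : ∀ u w → Dec (Adj u w) → Fin n
      before u w (yes a) = proj₁ (previous a)
      before u w (no _) = w

      out≤in : ∀ κ u → sum (λ w → ⟦ on κ u w ⟧) ≤ sum (λ w → ⟦ on κ w u ⟧)
      out≤in κ u = sum-injection (on κ u) (λ w → on κ w u) (λ w → before u w (adj? u w)) forward injective
        where
        forward : ∀ {w} → on κ u w ≡ true → on κ (before u w (adj? u w)) u ≡ true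
        forward {w} e with adj? u w in eq
        ... | yes a = let v , b , r = previous a in
              trans (on-next κ b) (trans (cong (on κ u) r) (trans (on-dart κ a) e))
        injective : ∀ {w w′} → on κ u w ≡ true → on κ u w′ ≡ true → before u w (adj? u w) ≡ before u w′ (adj? u w′) → w ≡ w′
        injective {w} {w′} e e′ r with adj? u w | adj? u w′
        ... | yes a | yes a′ = trans (sym (proj₂ (proj₂ (previous a)))) (trans (cong (next u) r) (proj₂ (proj₂ (previous a′))))

    on-balanced : ∀ κ u → sum (λ w → ⟦ on κ u w ⟧) ≡ sum (λ w → ⟦ on κ w u ⟧)
    on-balanced κ = sum-mono-≡ (out≤in κ) (sym (∑-comm (λ u w → ⟦ on κ w u ⟧)))

    oneSided : Fin k → Fin n → Fin n → Bool
    oneSided κ u v = on κ u v ∧ not (on κ v u)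

    oneSided-circulation : ∀ κ → Circulation (oneSided κ)
    oneSided-circulation κ = circulation (on κ) (on-balanced κ)

    oneSided? : ∀ κ → Dec (∃₂ λ u v → oneSided κ u v ≡ true)
    oneSided? κ = Fin.any? (λ u → Fin.any? (λ v → oneSided κ u v Bool.≟ true))

    -- The classes that contain the reversals of their darts.
    twoSided : Fin k → Bool
    twoSided κ = does (¬? (oneSided? κ))

    twoSided-rev : ∀ κ → twoSided κ ≡ true → ∀ {u v} → on κ u v ≡ true → on κ v u ≡ true
    twoSided-rev κ t {u} {v} e with on κ v u in e′
    ... | true = refl
    ... | false = ⊥-elim (does-true (¬? (oneSided? κ)) t (u , v , cong₂ _∧_ e (cong not e′)))

    -- Reversing darts and turning around vertices never leaves a two-sided class, so the class
    -- fills a whole component.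
    twoSided-component : ∀ κ → twoSided κ ≡ true → ∀ {u v x w} → on κ u v ≡ true → EqClosure Adj u x → Adj x w → on κ x w ≡ true
    twoSided-component κ t {u} {v} e = walk (around e)
      where
      around : ∀ {u v} → on κ u v ≡ true → ∀ {w} → Adj u w → on κ u w ≡ true
      around {u} e a = go e (transitive (on-adj κ e) a)
        where
        go : ∀ {x w} → on κ u x ≡ true → Star (λ x y → next u x ≡ y) x w → on κ u w ≡ true
        go e ε = e
        go e (refl ◅ s) = go (trans (sym (on-next κ (on-adj κ e))) (twoSided-rev κ t e)) s
      walk : ∀ {u x w} → (∀ {w} → Adj u w → on κ u w ≡ true) → EqClosure Adj u x → Adj x w → on κ x w ≡ true
      walk p ε = p
      walk p (fwd a ◅ s) = walk (around (twoSided-rev κ t (p a))) s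
      walk p (bwd a ◅ s) = walk (around (twoSided-rev κ t (p (adj-sym a)))) s

    private
      sample : ∀ κ → ∃₂ λ u v → on κ u v ≡ true
      sample κ with dart u v a , e ← inhabited q κ = u , v , lemma
        where
        lemma : on κ u v ≡ true
        lemma with adj? u v
        ... | yes _ rewrite e = ==-refl κ
        -- The adjacency stored in a dart is irrelevant: it cannot be returned as evidence, but it
        -- may refute the negative answer.
        ... | no ¬a = ⊥-elim (irrelevant ¬a a)
          where
          irrelevant : ∀ {A : Set} → ¬ A → .A → ⊥
          irrelevant ¬a a = ⊥-elim-irr (¬a a)

      start : Fin k → Fin n
      start κ = proj₁ (sample κ)

      sample-on : ∀ κ → on κ (start κ) (proj₁ (proj₂ (sample κ))) ≡ true
      sample-on κ = proj₂ (proj₂ (sample κ))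

    two≤on : ∀ κ → twoSided κ ≡ true → 2 ≤ total (on κ)
    two≤on κ t with u , v , e ← sample κ = begin
      2 ≤⟨ s≤s (≤-trans (≤-reflexive (sym (cong ⟦_⟧ e₁))) (≤-sum₂ (λ x y → ⟦ without u v (on κ) x y ⟧) v u)) ⟩
      suc (total (without u v (on κ))) ≡⟨ total-without {p = on κ} e ⟨
      total (on κ) ∎
      where
      open ≤-Reasoning
      e₁ : without u v (on κ) v u ≡ true
      e₁ = without-true {p = on κ} (twoSided-rev κ t e) (λ (p , _) → adj-irr (sym p) (on-adj κ e))

    sum-on : ∀ u v → sum (λ κ → ⟦ on κ u v ⟧) ≡ ⟦ does (adj? u v) ⟧
    sum-on u v with adj? u v
    ... | yes a = sum-== (class q (dart u v a))
    ... | no _ = sum-zero {k}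

    total-on : sum (λ κ → total (on κ)) ≡ total (λ u v → does (adj? u v))
    total-on = begin
      sum (λ κ → sum (λ u → sum (λ v → ⟦ on κ u v ⟧))) ≡⟨ ∑-comm (λ κ u → sum (λ v → ⟦ on κ u v ⟧)) ⟩
      sum (λ u → sum (λ κ → sum (λ v → ⟦ on κ u v ⟧))) ≡⟨ sum-cong-≗ {n} (λ u → ∑-comm (λ κ v → ⟦ on κ u v ⟧)) ⟩
      sum₂ (λ u v → sum (λ κ → ⟦ on κ u v ⟧)) ≡⟨ sum₂-cong sum-on ⟩
      total (λ u v → does (adj? u v)) ∎
      where
      open ≡-Reasoning

    oneSided-on : ∀ κ {u v} → oneSided κ u v ≡ true → on κ u v ≡ true
    oneSided-on κ e = proj₁ (∧-true e)

    isIsolated : Fin n → Bool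
    isIsolated v = does (¬? (Fin.any? (adj? v)))

    length-isolated : length isolated ≡ sum (λ v → ⟦ isIsolated v ⟧)
    length-isolated = length-filter-tabulate (λ v → ¬? (Fin.any? (adj? v))) id

    private
      isolated-closure : ∀ {v x} → isIsolated v ≡ true → EqClosure Adj v x → v ≡ x
      isolated-closure i ε = refl
      isolated-closure {v} i (fwd a ◅ _) = ⊥-elim (does-true (¬? (Fin.any? (adj? v))) i (_ , a))
      isolated-closure {v} i (bwd a ◅ _) = ⊥-elim (does-true (¬? (Fin.any? (adj? v))) i (_ , adj-sym a))

    module _ {components : ℕ} (cc : ClassCount Adj components) where

      private
        component : Fin n → Fin components
        component = class-of cc

        home : Fin k → Fin components
        home κ = component (start κ)

        same-home : ∀ κ κ′ → twoSided κ ≡ true → home κ ≡ home κ′ → κ ≡ κ′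
        same-home κ κ′ t e =
          on-unique κ κ′ (twoSided-component κ t (sample-on κ) (class-of-≡⁻ cc e) (on-adj κ′ (sample-on κ′))) (sample-on κ′)

        not-isolated : ∀ κ {v} → isIsolated v ≡ true → component v ≢ home κ
        not-isolated κ {v} i e = does-true (¬? (Fin.any? (adj? v))) i
          (_ , subst (λ x → Adj x (proj₁ (proj₂ (sample κ)))) (sym (isolated-closure i (class-of-≡⁻ cc e))) (on-adj κ (sample-on κ)))

        -- Three disjoint sets of components are counted: the homes of two-sided classes, the
        -- isolated vertices and, if `extra` is given, the home of one class that is not two-sided.
        -- The option yields the strict and the weak bound from one argument.
        module _ (extra : Maybe (Fin k)) (extra-ok : ∀ κ → extra ≡ just κ → twoSided κ ≡ false) where

          Q₁? : ∀ x → Dec (∃ λ κ → twoSided κ ≡ true × home κ ≡ x)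
          Q₁? x = Fin.any? (λ κ → (twoSided κ Bool.≟ true) ×-dec (home κ Fin.≟ x))

          Q₂? : ∀ x → Dec (∃ λ v → isIsolated v ≡ true × component v ≡ x)
          Q₂? x = Fin.any? (λ v → (isIsolated v Bool.≟ true) ×-dec (component v Fin.≟ x))

          Q₃ : Fin components → Bool
          Q₃ x = maybe (λ κ → home κ == x) false extra

          Q₃⁻ : ∀ {x} → Q₃ x ≡ true → ∃ λ κ → twoSided κ ≡ false × home κ ≡ x
          Q₃⁻ {x} = go extra extra-ok
            where
            go : ∀ m → (∀ κ → m ≡ just κ → twoSided κ ≡ false) → maybe (λ κ → home κ == x) false m ≡ true →
                 ∃ λ κ → twoSided κ ≡ false × home κ ≡ x
            go (just κ) ok e = κ , ok κ refl , ==-true {i = home κ} {x} e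

          disjoint : ∀ x → ⟦ does (Q₁? x) ⟧ + (⟦ does (Q₂? x) ⟧ + ⟦ Q₃ x ⟧) ≤ 1
          disjoint x with Q₁? x | Q₂? x | Q₃ x in e
          ... | yes _ | no _ | false = ≤-refl
          ... | no _ | yes _ | false = ≤-refl
          ... | no _ | no _ | true = ≤-refl
          ... | no _ | no _ | false = z≤n
          ... | yes (κ , _ , h) | yes (v , i , h′) | _ = ⊥-elim (not-isolated κ i (trans h′ (sym h)))
          ... | no _ | yes (v , i , h′) | true = let κ , _ , h = Q₃⁻ e in ⊥-elim (not-isolated κ i (trans h′ (sym h)))
          ... | yes (κ , t , h) | no _ | true = let κ′ , f , h′ = Q₃⁻ e in
                ⊥-elim (true≢false (trans (cong twoSided (sym (same-home κ κ′ t (trans h (sym h′))))) t) f)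

          count-components : sum (λ κ → ⟦ twoSided κ ⟧) + (length isolated + maybe (λ _ → 1) 0 extra) ≤ components
          count-components = begin
            sum (λ κ → ⟦ twoSided κ ⟧) + (length isolated + maybe (λ _ → 1) 0 extra)
              ≤⟨ +-mono-≤ first (+-mono-≤ (≤-trans (≤-reflexive length-isolated) second) third) ⟩
            sum (λ x → ⟦ does (Q₁? x) ⟧) + (sum (λ x → ⟦ does (Q₂? x) ⟧) + sum (λ x → ⟦ Q₃ x ⟧))
              ≡⟨ cong (sum (λ x → ⟦ does (Q₁? x) ⟧) +_) (∑-distrib-+ {components} _ _) ⟨
            sum (λ x → ⟦ does (Q₁? x) ⟧) + sum (λ x → ⟦ does (Q₂? x) ⟧ + ⟦ Q₃ x ⟧)
              ≡⟨ ∑-distrib-+ {components} _ _ ⟨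
            sum (λ x → ⟦ does (Q₁? x) ⟧ + (⟦ does (Q₂? x) ⟧ + ⟦ Q₃ x ⟧))
              ≤⟨ sum-mono disjoint ⟩
            sum {components} (λ _ → 1) ≡⟨ sum-one {components} ⟩
            components ∎
            where
            open ≤-Reasoning
            first : sum (λ κ → ⟦ twoSided κ ⟧) ≤ sum (λ x → ⟦ does (Q₁? x) ⟧)
            first = sum-injection twoSided (λ x → does (Q₁? x)) home (λ {κ} t → true-does (Q₁? (home κ)) (κ , t , refl))
                      (λ {κ} {κ′} t _ e → same-home κ κ′ t e)
            second : sum (λ v → ⟦ isIsolated v ⟧) ≤ sum (λ x → ⟦ does (Q₂? x) ⟧)
            second = sum-injection isIsolated (λ x → does (Q₂? x)) component (λ {v} i → true-does (Q₂? (component v)) (v , i , refl))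
                       (λ i _ e → isolated-closure i (class-of-≡⁻ cc e))
            third : maybe (λ _ → 1) 0 extra ≤ sum (λ x → ⟦ Q₃ x ⟧)
            third = go extra
              where
              go : ∀ m → maybe (λ _ → 1) 0 m ≤ sum (λ x → ⟦ maybe (λ κ → home κ == x) false m ⟧)
              go (just κ) = ≤-reflexive (sym (sum-== (home κ)))
              go nothing = z≤n

      components-bound : sum (λ κ → ⟦ twoSided κ ⟧) + length isolated ≤ components
      components-bound = ≤-trans (≤-reflexive (cong (sum (λ κ → ⟦ twoSided κ ⟧) +_) (sym (+-identityʳ _)))) (count-components nothing (λ _ ()))

      components-bound-< : ∀ κ → twoSided κ ≡ false → sum (λ κ → ⟦ twoSided κ ⟧) + length isolated < components
      components-bound-< κ f = ≤-trans (≤-reflexive (lemma (sum (λ κ → ⟦ twoSided κ ⟧)) _)) (count-components (just κ) (λ { _ refl → f }))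
        where
        lemma : ∀ a b → suc (a + b) ≡ a + (b + 1)
        lemma = solve-∀

  -- Counting darts and bounding the number of edges

  module _ {n : ℕ} (G : Graph n) where

    open Graph G

    edgeCount : length edges ≡ total (λ u v → does (u Fin.<? v) ∧ does (adj? u v))
    edgeCount = length-filter-pairs (λ (u , v) → (u Fin.<? v) ×-dec adj? u v)

    adj?-sym : ∀ u v → does (adj? u v) ≡ does (adj? v u)
    adj?-sym u v with adj? u v | adj? v u
    ... | yes _ | yes _ = refl
    ... | no _ | no _ = refl
    ... | yes a | no ¬a = contradiction (adj-sym a) ¬a
    ... | no ¬a | yes a = contradiction (adj-sym a) ¬a

    adj?-irr : ∀ u → does (adj? u u) ≡ false
    adj?-irr u with adj? u u
    ... | no _ = refl
    ... | yes a = contradiction a (adj-irr refl)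

    dartCount : total (λ u v → does (adj? u v)) ≡ length edges + length edges
    dartCount = trans (total-double _ adj?-sym adj?-irr) (cong₂ _+_ (sym edgeCount) (sym edgeCount))

  module _ {n : ℕ} (G : Graph n) (P : PlanarEmbedding G) where

    open Graph G
    open PlanarEmbedding P

    private
      q : Partition (Dart G) faces
      q = classes face-count

      face : ∀ d → class q (RotationSystem.faceStep rotation d) ≡ class q d
      face d = class-of-≡ face-count (bwd refl ◅ ε)

    open Faces G rotation q face

    private
      b : ℕ
      b = sum (λ κ → ⟦ twoSided κ ⟧)

      -- The one-sided darts form a circulation without loops and opposite arcs, hence contain three
      -- distinct ones if any. A two-sided class may consist of the two darts of a single edge; the
      -- extra 1 makes up for it.
      threeDarts : ∀ κ → 3 ≤ total (on κ) + ⟦ twoSided κ ⟧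
      threeDarts κ with oneSided? κ
      ... | no none = ≤-trans (≤-reflexive refl) (+-monoˡ-≤ 1 (two≤on κ (true-does (¬? (oneSided? κ)) none)))
      ... | yes (u , v , e) =
        let u′ , v′ , u″ , v″ , e′ , e″ , p′ , p″ , c′ , c″ , d =
              threeArcs Fin._≟_ id (oneSided-circulation κ)
                (λ { f f′ _ refl refl → true≢false f′ (Circulation.asymmetric (oneSided-circulation κ) f) }) e u≢v
        in ≤-trans (three≤total (on κ) (oneSided-on κ e) (oneSided-on κ e′) (oneSided-on κ e″)
             (λ (r , _) → u≢v (trans (sym r) p′)) (λ (r , _) → d (trans (sym r) p″)) (λ (r , _) → c′ (trans (sym r) p″))) (m≤m+n _ 0)
        where
        u≢v : u ≢ v
        u≢v r = adj-irr r (on-adj κ (oneSided-on κ e))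

      threeFaces : faces + (faces + faces) ≤ (length edges + length edges) + b
      threeFaces = begin
        faces + (faces + faces) ≡⟨ cong₂ (λ x y → x + (y + y)) (sym (sum-one {faces})) (sym (sum-one {faces})) ⟩
        sum {faces} (λ _ → 1) + (sum {faces} (λ _ → 1) + sum {faces} (λ _ → 1)) ≡⟨ cong (sum {faces} (λ _ → 1) +_) (∑-distrib-+ {faces} _ _) ⟨
        sum {faces} (λ _ → 1) + sum {faces} (λ _ → 2) ≡⟨ ∑-distrib-+ {faces} _ _ ⟨
        sum {faces} (λ _ → 3) ≤⟨ sum-mono threeDarts ⟩
        sum (λ κ → total (on κ) + ⟦ twoSided κ ⟧) ≡⟨ ∑-distrib-+ {faces} _ _ ⟩
        sum (λ κ → total (on κ)) + b ≡⟨ cong (_+ b) (trans total-on (dartCount G)) ⟩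
        (length edges + length edges) + b ∎
        where open ≤-Reasoning

      -- The usual derivation of e ≤ 3n - 6 for several components. Of the 6c that Euler's formula
      -- contributes, one half absorbs `b` and `i` and leaves 3 because c > b + i; the other half
      -- leaves 3 because c ≥ 1.
      many-edges : ∀ {e f i b c n} → f + (f + f) ≤ (e + e) + b → n + (f + i) ≡ e + 2 * c → suc (b + i) ≤ c → e + 6 ≤ 3 * n
      many-edges {e} {f} {i} {b} {c} {n} h₁ h₂ h₃ = +-cancelʳ-≤ ((e + e) + b + 3 * i) (e + 6) (3 * n) (begin
        (e + 6) + ((e + e) + b + 3 * i) ≤⟨ m≤m+n _ (b + b) ⟩
        (e + 6) + ((e + e) + b + 3 * i) + (b + b) ≡⟨ l₁ e b i ⟩
        3 * e + 3 + 3 * suc (b + i) ≤⟨ +-mono-≤ (+-monoʳ-≤ (3 * e) (*-monoʳ-≤ 3 (≤-trans (s≤s z≤n) h₃))) (*-monoʳ-≤ 3 h₃) ⟩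
        3 * e + 3 * c + 3 * c ≡⟨ l₂ e c ⟩
        3 * (e + 2 * c) ≡⟨ cong (3 *_) h₂ ⟨
        3 * (n + (f + i)) ≡⟨ l₃ n f i ⟩
        3 * n + (f + (f + f) + 3 * i) ≤⟨ +-monoʳ-≤ (3 * n) (+-monoˡ-≤ (3 * i) h₁) ⟩
        3 * n + ((e + e) + b + 3 * i) ∎)
        where
        open ≤-Reasoning
        l₁ : ∀ e b i → (e + 6) + ((e + e) + b + 3 * i) + (b + b) ≡ 3 * e + 3 + 3 * suc (b + i)
        l₁ = solve-∀
        l₂ : ∀ e c → 3 * e + 3 * c + 3 * c ≡ 3 * (e + 2 * c)
        l₂ = solve-∀
        l₃ : ∀ n f i → 3 * (n + (f + i)) ≡ 3 * n + (f + (f + f) + 3 * i)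
        l₃ = solve-∀

      few-edges : ∀ {e f i c n} → n + (f + i) ≡ e + 2 * c → f + i ≤ c → e ≤ n
      few-edges {e} {f} {i} {c} {n} h₁ h₂ = +-cancelʳ-≤ (f + i) e n (begin
        e + (f + i) ≤⟨ +-monoʳ-≤ e (≤-trans h₂ (m≤n*m c 2)) ⟩
        e + 2 * c ≡⟨ h₁ ⟨
        n + (f + i) ∎)
        where open ≤-Reasoning

    -- The second alternative covers embeddings all of whose faces are two-sided. These are the
    -- forests, among which e ≤ 3n - 6 can fail.
    edge-bound : length edges + 6 ≤ 3 * n ⊎ length edges ≤ n
    edge-bound with Fin.any? (λ κ → twoSided κ Bool.≟ false)
    ... | yes (κ , f) = inj₁ (many-edges {e = length edges} {faces} {length isolated} {b} {components} {n} threeFaces euler (components-bound-< component-count κ f))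
    ... | no none = inj₂ (few-edges {length edges} {faces} {length isolated} {components} {n} euler
                      (≤-trans (≤-reflexive (cong (_+ length isolated) (sym all))) (components-bound component-count)))
      where
      all : b ≡ faces
      all = trans (sum-cong-≗ {faces} (λ κ → cong ⟦_⟧ (¬false (λ e → none (κ , e))))) (sum-one {faces})
        where
        ¬false : ∀ {x} → ¬ x ≡ false → x ≡ true
        ¬false {true} _ = refl
        ¬false {false} p = ⊥-elim (p refl)

  does-cong : {A B : Set} (A? : Dec A) (B? : Dec B) → (A → B) → (B → A) → does A? ≡ does B?
  does-cong (yes _) (yes _) _ _ = refl
  does-cong (no _) (no _) _ _ = refl
  does-cong (yes a) (no ¬b) f _ = ⊥-elim (¬b (f a))
  does-cong (no ¬a) (yes b) _ g = ⊥-elim (¬a (g b))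

  -- Planar graphs have no K₅ minor

  module _ {n : ℕ} (G : Graph n) (P : PlanarEmbedding G) where

    open Graph G
    open PlanarEmbedding P

    module _ (branch : Fin n → Maybe (Fin 5))
      (touching : ∀ {i j} → i ≢ j → ∃₂ λ u v → branch u ≡ just i × branch v ≡ just j × Adj u v)
      (connected : ∀ {i u v} → branch u ≡ just i → branch v ≡ just i → Star (λ u v → Adj u v × branch u ≡ just i × branch v ≡ just i) u v)
      where

      private
        Touches : Fin 5 → Fin 5 → Fin n → Fin n → Set
        Touches i j u v = branch u ≡ just i × branch v ≡ just j × Adj u v

        abstract
          pick : Fin 5 → Fin 5 → Fin n × Fin n
          pick i j with i Fin.<? j
          ... | yes lt = let u , v , _ = touching (Fin.<⇒≢ lt) in u , v
          ... | no _ = let u , v , _ = touching {zero} {suc zero} (λ ()) in u , v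

          pick-ok : ∀ {i j} → i Fin.< j → Touches i j (proj₁ (pick i j)) (proj₂ (pick i j))
          pick-ok {i} {j} lt with i Fin.<? j
          ... | yes lt = let _ , _ , t = touching (Fin.<⇒≢ lt) in t
          ... | no ge = ⊥-elim (ge lt)

          -- Reading the choice off the increasing pair of indices makes `end i j` and `end j i` the
          -- two ends of one edge; for other pairs `pick` returns a default.
          end : Fin 5 → Fin 5 → Fin n
          end i j with i Fin.<? j
          ... | yes _ = proj₁ (pick i j)
          ... | no _ = proj₂ (pick j i)

          end-ok : ∀ {i j} → i ≢ j → Touches i j (end i j) (end j i)
          end-ok {i} {j} i≢j with i Fin.<? j | j Fin.<? i
          ... | yes l | no _ = pick-ok l
          ... | no _ | yes g = let p , q , a = pick-ok g in q , p , adj-sym a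
          ... | yes l | yes g = ⊥-elim (<-asym l g)
          ... | no a | no b with Fin.<-cmp i j
          ...   | tri< l _ _ = ⊥-elim (a l)
          ...   | tri≈ _ e _ = ⊥-elim (i≢j e)
          ...   | tri> _ _ g = ⊥-elim (b g)

        -- The ten chosen edges, the pairs inside a branch set, and the rest, to which surplus edges
        -- between branch sets belong.
        Marked Within Other : Fin n → Fin n → Set
        Marked u v = ∃₂ λ i j → i ≢ j × u ≡ end i j × v ≡ end j i
        Within u v = ∃ λ i → branch u ≡ just i × branch v ≡ just i
        Other u v = ¬ Within u v × ¬ Marked u v

        abstract
          marked? : ∀ u v → Dec (Marked u v)
          marked? u v = Fin.any? (λ i → Fin.any? (λ j → ¬? (i Fin.≟ j) ×-dec ((u Fin.≟ end i j) ×-dec (v Fin.≟ end j i))))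

          within? : ∀ u v → Dec (Within u v)
          within? u v = Fin.any? (λ i → maybe-≟ Fin._≟_ (branch u) (just i) ×-dec maybe-≟ Fin._≟_ (branch v) (just i))

        marked-adj : ∀ {u v} → Marked u v → Adj u v
        marked-adj (i , j , i≢j , refl , refl) = proj₂ (proj₂ (end-ok i≢j))

        marked-sym : ∀ {u v} → Marked u v → Marked v u
        marked-sym (i , j , i≢j , p , q) = j , i , i≢j ∘ sym , q , p

        within-sym : ∀ {u v} → Within u v → Within v u
        within-sym (i , p , q) = i , q , p

        just-unique : ∀ {u} {i j : Fin 5} → branch u ≡ just i → branch u ≡ just j → i ≡ j
        just-unique p q = just-injective (trans (sym p) q)

        marked-¬within : ∀ {u v} → Marked u v → ¬ Within u v
        marked-¬within (i , j , i≢j , refl , refl) (l , p , q) =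
          let p′ , q′ , _ = end-ok i≢j in i≢j (trans (just-unique p′ p) (just-unique q q′))

        within-edge? : Decidable {A = Fin n × Fin n} (λ (u , v) → u Fin.< v × Adj u v × Within u v)
        within-edge? (u , v) = (u Fin.<? v) ×-dec (adj? u v ×-dec within? u v)

        other-edge? : Decidable {A = Fin n × Fin n} (λ (u , v) → u Fin.< v × Adj u v × Other u v)
        other-edge? (u , v) = (u Fin.<? v) ×-dec (adj? u v ×-dec (¬? (within? u v) ×-dec ¬? (marked? u v)))

        pairs : List (Fin n × Fin n)
        pairs = cartesianProduct (allFin n) (allFin n)

        ∈-pairs : ∀ {u v} → (u , v) ∈ pairs
        ∈-pairs {u} {v} = ∈-cartesianProduct⁺ (∈-allFin u) (∈-allFin v)

        withinEdges otherEdges : List (Fin n × Fin n)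
        withinEdges = filter within-edge? pairs
        otherEdges = filter other-edge? pairs

        oriented : ∀ {u v} → Adj u v → u Fin.< v ⊎ v Fin.< u
        oriented {u} {v} a with Fin.<-cmp u v
        ... | tri< l _ _ = inj₁ l
        ... | tri≈ _ e _ = ⊥-elim (adj-irr e a)
        ... | tri> _ _ g = inj₂ g

        ∈-within : ∀ {u v} → Adj u v → Within u v → (u , v) ∈ withinEdges ⊎ (v , u) ∈ withinEdges
        ∈-within a w with oriented a
        ... | inj₁ l = inj₁ (∈-filter⁺ within-edge? ∈-pairs (l , a , w))
        ... | inj₂ g = inj₂ (∈-filter⁺ within-edge? ∈-pairs (g , adj-sym a , within-sym w))

        ∈-other : ∀ {u v} → Adj u v → Other u v → (u , v) ∈ otherEdges ⊎ (v , u) ∈ otherEdges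
        ∈-other a (w , m) with oriented a
        ... | inj₁ l = inj₁ (∈-filter⁺ other-edge? ∈-pairs (l , a , w , m))
        ... | inj₂ g = inj₂ (∈-filter⁺ other-edge? ∈-pairs (g , adj-sym a , w ∘ within-sym , m ∘ marked-sym))

        off : Fin 5 → Fin 5 → Bool
        off i j = not (i == j)

        off-≢ : ∀ i j → off i j ≡ true → i ≢ j
        off-≢ i _ e refl = true≢false e (cong not (==-refl i))

        twenty : 20 ≤ total (λ u v → does (marked? u v))
        twenty = total-injection off (λ u v → does (marked? u v)) end (λ i j → end j i)
          (λ {i} {j} e → true-does (marked? (end i j) (end j i)) (i , j , off-≢ i j e , refl , refl))
          (λ {i} {j} {i′} {j′} e e′ p q →
            just-unique (proj₁ (end-ok (off-≢ i j e))) (trans (cong branch p) (proj₁ (end-ok (off-≢ i′ j′ e′)))) ,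
            just-unique (proj₁ (proj₂ (end-ok (off-≢ i j e)))) (trans (cong branch q) (proj₁ (proj₂ (end-ok (off-≢ i′ j′ e′))))))

        lowerMarked : ℕ
        lowerMarked = total (λ u v → does (u Fin.<? v) ∧ does (marked? u v))

        ten : 10 ≤ lowerMarked
        ten = *-cancelˡ-≤ 2 (≤-trans twenty (≤-reflexive (trans (total-double _ m-sym m-irr) (cong (lowerMarked +_) (sym (+-identityʳ _))))))
          where
          m-sym : ∀ u v → does (marked? u v) ≡ does (marked? v u)
          m-sym u v = does-cong (marked? u v) (marked? v u) marked-sym marked-sym
          m-irr : ∀ u → does (marked? u u) ≡ false
          m-irr u = ≢true (λ e → adj-irr refl (marked-adj (does-true (marked? u u) e)))

        -- The three classes of edges are disjoint, as a marked edge joins different branch sets.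
        edge-split : length withinEdges + length otherEdges + 10 ≤ length edges
        edge-split = begin
          length withinEdges + length otherEdges + 10 ≤⟨ +-monoʳ-≤ (length withinEdges + length otherEdges) ten ⟩
          length withinEdges + length otherEdges + lowerMarked
            ≡⟨ cong₂ (λ a b → a + b + lowerMarked) (length-filter-pairs within-edge?) (length-filter-pairs other-edge?) ⟩
          total w + total o + lowerMarked ≡⟨ cong (_+ lowerMarked) (sum₂-+ (λ u v → ⟦ w u v ⟧) (λ u v → ⟦ o u v ⟧)) ⟨
          sum₂ (λ u v → ⟦ w u v ⟧ + ⟦ o u v ⟧) + lowerMarked ≡⟨ sum₂-+ (λ u v → ⟦ w u v ⟧ + ⟦ o u v ⟧) (λ u v → ⟦ m u v ⟧) ⟨
          sum₂ (λ u v → ⟦ w u v ⟧ + ⟦ o u v ⟧ + ⟦ m u v ⟧) ≤⟨ sum₂-mono pointwise ⟩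
          total (λ u v → does (u Fin.<? v) ∧ does (adj? u v)) ≡⟨ edgeCount G ⟨
          length edges ∎
          where
          open ≤-Reasoning
          w o m : Fin n → Fin n → Bool
          w u v = does (within-edge? (u , v))
          o u v = does (other-edge? (u , v))
          m u v = does (u Fin.<? v) ∧ does (marked? u v)
          bits : ∀ l a w m → (m ≡ true → a ≡ true × w ≡ false) → ⟦ l ∧ (a ∧ w) ⟧ + ⟦ l ∧ (a ∧ (not w ∧ not m)) ⟧ + ⟦ l ∧ m ⟧ ≤ ⟦ l ∧ a ⟧
          bits false _ _ _ _ = z≤n
          bits true true true false _ = ≤-refl
          bits true true false false _ = ≤-refl
          bits true true false true _ = ≤-refl
          bits true false _ false _ = z≤n
          bits true true true true h with () ← proj₂ (h refl)
          bits true false _ true h with () ← proj₁ (h refl)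
          pointwise : ∀ u v → ⟦ w u v ⟧ + ⟦ o u v ⟧ + ⟦ m u v ⟧ ≤ ⟦ does (u Fin.<? v) ∧ does (adj? u v) ⟧
          pointwise u v = bits (does (u Fin.<? v)) (does (adj? u v)) (does (within? u v)) (does (marked? u v)) λ e →
            true-does (adj? u v) (marked-adj (does-true (marked? u v) e)) ,
            ≢true (λ e′ → marked-¬within (does-true (marked? u v) e) (does-true (within? u v) e′))

        abstract
          -- Spanning trees of the branch sets; a vertex outside all of them remains a class of its
          -- own.
          forest₁ : Forest (finest n) withinEdges
          forest₁ = forest (finest n) withinEdges

        module F₁ = Forest forest₁

        r₁ : Fin n → Fin F₁.size
        r₁ = class F₁.partition

        r₁-within : ∀ {u v} → Adj u v → Within u v → r₁ u ≡ r₁ v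
        r₁-within a w with ∈-within a w
        ... | inj₁ m = F₁.joined m
        ... | inj₂ m = sym (F₁.joined m)

        r₁-branch : ∀ {i u v} → branch u ≡ just i → branch v ≡ just i → r₁ u ≡ r₁ v
        r₁-branch {i} p q = go (connected p q)
          where
          go : ∀ {u v} → Star (λ u v → Adj u v × branch u ≡ just i × branch v ≡ just i) u v → r₁ u ≡ r₁ v
          go ε = refl
          go ((a , p , q) ◅ s) = trans (r₁-within a (i , p , q)) (go s)

        -- Names the intended classes of `r₁`, a branch set or a single vertex. Being constant along
        -- the edges within branch sets, it shows that `r₁` joins nothing more.
        label : Fin n → Fin 5 ⊎ Fin n
        label u = maybe inj₁ (inj₂ u) (branch u)

        label-just : ∀ {u i} → branch u ≡ just i → label u ≡ inj₁ i
        label-just p rewrite p = refl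

        r₁-label : ∀ {u v} → r₁ u ≡ r₁ v → label u ≡ label v
        r₁-label = F₁.invariant label (cong label) λ m → let _ , _ , _ , p , q = proj₂ (∈-filter⁻ within-edge? {xs = pairs} m) in trans (label-just p) (sym (label-just q))

        label-within : ∀ {u v} → label u ≡ label v → u ≢ v → Within u v
        label-within {u} {v} e u≢v with branch u | branch v
        ... | just i | just j with refl ← e = i , refl , refl
        ... | nothing | nothing = ⊥-elim (u≢v (inj₂-injective e))

        r₁-unique : ∀ {u v i j} → branch u ≡ just i → branch v ≡ just j → r₁ u ≡ r₁ v → i ≡ j
        r₁-unique p q e = inj₁-injective (trans (sym (label-just p)) (trans (r₁-label e) (label-just q)))

        hub : Fin 5 → Fin n
        hub zero = end zero (suc zero)
        hub (suc i) = end (suc i) zero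

        hub-branch : ∀ i → branch (hub i) ≡ just i
        hub-branch zero = proj₁ (end-ok {zero} {suc zero} (λ ()))
        hub-branch (suc i) = proj₁ (end-ok {suc i} {zero} (λ ()))

        -- Pairs to be joined, not necessarily edges. They fuse the five branch sets at a cost of at
        -- most four classes, so that marked edges run inside a class before the remaining edges are
        -- added.
        spokes : List (Fin n × Fin n)
        spokes = (hub zero , hub (suc zero)) ∷ (hub zero , hub (suc (suc zero))) ∷
                 (hub zero , hub (suc (suc (suc zero)))) ∷ (hub zero , hub (suc (suc (suc (suc zero))))) ∷ []

        abstract
          coarsening₂ : Coarsening F₁.partition spokes
          coarsening₂ = coarsen F₁.partition spokes

        module C₂ = Coarsening coarsening₂

        r₂ : Fin n → Fin C₂.size
        r₂ = class C₂.partition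

        r₂-hub : ∀ i → r₂ (hub zero) ≡ r₂ (hub i)
        r₂-hub zero = refl
        r₂-hub (suc zero) = C₂.joined (here refl)
        r₂-hub (suc (suc zero)) = C₂.joined (there (here refl))
        r₂-hub (suc (suc (suc zero))) = C₂.joined (there (there (here refl)))
        r₂-hub (suc (suc (suc (suc zero)))) = C₂.joined (there (there (there (here refl))))

        r₂-branch : ∀ {i j u v} → branch u ≡ just i → branch v ≡ just j → r₂ u ≡ r₂ v
        r₂-branch {i} {j} p q = trans (C₂.respects (r₁-branch p (hub-branch i)))
          (trans (sym (r₂-hub i)) (trans (r₂-hub j) (C₂.respects (r₁-branch (hub-branch j) q))))

        r₂-marked : ∀ {u v} → Marked u v → r₂ u ≡ r₂ v
        r₂-marked (i , j , i≢j , refl , refl) = let p , q , _ = end-ok i≢j in r₂-branch p q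

        abstract
          -- With the branch sets fused, an unmarked edge between two of them closes a cycle and
          -- becomes a chord like any other.
          forest₃ : Forest C₂.partition otherEdges
          forest₃ = forest C₂.partition otherEdges

        module F₃ = Forest forest₃

        r₃ : Fin n → Fin F₃.size
        r₃ = class F₃.partition

        r₂-or-other : ∀ {u v} → Adj u v → r₂ u ≡ r₂ v ⊎ Other u v
        r₂-or-other {u} {v} a with within? u v | marked? u v
        ... | yes w | _ = inj₁ (C₂.respects (r₁-within a w))
        ... | no _ | yes m = inj₁ (r₂-marked m)
        ... | no w | no m = inj₂ (w , m)

        r₃-adj : ∀ {u v} → Adj u v → r₃ u ≡ r₃ v
        r₃-adj a with r₂-or-other a
        ... | inj₁ e = F₃.respects e
        ... | inj₂ o with ∈-other a o
        ...   | inj₁ m = F₃.joined m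
        ...   | inj₂ m = sym (F₃.joined m)

        r₃-component : ∀ {u v} → EqClosure Adj u v → r₃ u ≡ r₃ v
        r₃-component ε = refl
        r₃-component (fwd a ◅ s) = trans (r₃-adj a) (r₃-component s)
        r₃-component (bwd a ◅ s) = trans (sym (r₃-adj a)) (r₃-component s)

        -- No edge leaves a class of `r₃`, so its classes are unions of components.
        size₃-≤ : F₃.size ≤ components
        size₃-≤ = Fin.injective⇒≤ {f = λ κ → class-of component-count (proj₁ (inhabited F₃.partition κ))} λ {κ} {κ′} e →
          trans (sym (proj₂ (inhabited F₃.partition κ)))
            (trans (r₃-component (class-of-≡⁻ component-count e)) (proj₂ (inhabited F₃.partition κ′)))

        chords : List (Fin n × Fin n)
        chords = F₁.chords ++ F₃.chords

        sides : List (Fin n × Fin n) → List (Dart G × Dart G)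
        sides [] = []
        sides ((u , v) ∷ es) with adj? u v
        ... | yes a = (dart u v a , dart v u (adj-sym a)) ∷ sides es
        ... | no _ = sides es

        length-sides : ∀ es → length (sides es) ≤ length es
        length-sides [] = z≤n
        length-sides ((u , v) ∷ es) with adj? u v
        ... | yes _ = s≤s (length-sides es)
        ... | no _ = m≤n⇒m≤1+n (length-sides es)

        ∈-sides : ∀ {es u v} (a : Adj u v) → (u , v) ∈ es → (dart u v a , dart v u (adj-sym a)) ∈ sides es
        ∈-sides {(u , v) ∷ es} a (here refl) with adj? u v
        ... | yes _ = here refl
        ... | no ¬a = ⊥-elim (¬a a)
        ∈-sides {(u , v) ∷ es} a (there m) with adj? u v
        ... | yes _ = there (∈-sides a m)
        ... | no _ = ∈-sides a m

        abstract
          -- In effect the chords are deleted from the embedding, while the graph and its rotation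
          -- system stay as they are.
          merging : Coarsening (classes face-count) (sides chords)
          merging = coarsen (classes face-count) (sides chords)

        module D = Coarsening merging

        open Faces G rotation D.partition (λ d → D.respects (class-of-≡ face-count (bwd refl ◅ ε)))

        k : ℕ
        k = D.size

        chord-adj : ∀ {u v} → (u , v) ∈ F₁.chords ⊎ (u , v) ∈ F₃.chords → Adj u v
        chord-adj (inj₁ m) = proj₁ (proj₂ (proj₂ (∈-filter⁻ within-edge? {xs = pairs} (F₁.chords-⊆ m))))
        chord-adj (inj₂ m) = proj₁ (proj₂ (proj₂ (∈-filter⁻ other-edge? {xs = pairs} (F₃.chords-⊆ m))))

        chord-twoSided : ∀ κ {u v} → (u , v) ∈ F₁.chords ⊎ (u , v) ∈ F₃.chords → oneSided κ u v ≡ false × oneSided κ v u ≡ false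
        chord-twoSided κ {u} {v} m = cancel eq , cancel (sym eq)
          where
          a : Adj u v
          a = chord-adj m
          member : (u , v) ∈ F₁.chords ⊎ (u , v) ∈ F₃.chords → (u , v) ∈ chords
          member (inj₁ m₁) = ∈-++⁺ˡ m₁
          member (inj₂ m₃) = ∈-++⁺ʳ F₁.chords m₃
          eq : on κ u v ≡ on κ v u
          eq = trans (on-dart κ a) (trans (cong (_== κ) (D.joined (∈-sides a (member m)))) (sym (on-dart κ (adj-sym a))))
          cancel : ∀ {x y} → x ≡ y → x ∧ not y ≡ false
          cancel {true} refl = refl
          cancel {false} refl = refl

        crossing : Fin k → Fin 5 → Fin 5 → Bool
        crossing κ i j = off i j ∧ on κ (end i j) (end j i)

        module _ (κ : Fin k) where

          private
            a : Fin n → Fin n → Bool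
            a = oneSided κ

            circ : Circulation a
            circ = oneSided-circulation κ

            a-adj : ∀ {u v} → a u v ≡ true → Adj u v
            a-adj e = on-adj κ (oneSided-on κ e)

            a-r₂ : ∀ {u v} → a u v ≡ true → r₂ u ≡ r₂ v
            a-r₂ = F₃.flowless circ (chord-twoSided κ ∘ inj₂) (r₃-adj ∘ a-adj) known
              where
              known : ∀ {u v} → a u v ≡ true → r₂ u ≢ r₂ v → (u , v) ∈ otherEdges ⊎ (v , u) ∈ otherEdges
              known e ne with r₂-or-other (a-adj e)
              ... | inj₁ eq = ⊥-elim (ne eq)
              ... | inj₂ o = ∈-other (a-adj e) o

            -- Inside a class of `r₂` every edge of `otherEdges` is a chord and carries nothing,
            -- which leaves the marked edges for passing between classes of `r₁`.
            a-marked : ∀ {u v} → a u v ≡ true → r₁ u ≢ r₁ v → Marked u v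
            a-marked {u} {v} e ne with within? u v | marked? u v
            ... | yes w | _ = ⊥-elim (ne (r₁-within (a-adj e) w))
            ... | no _ | yes m = m
            ... | no w | no m with ∈-other (a-adj e) (w , m)
            ...   | inj₁ l = ⊥-elim (true≢false e (proj₁ (chord-twoSided κ (inj₂ (F₃.inner l (a-r₂ e))))))
            ...   | inj₂ l = ⊥-elim (true≢false e (proj₂ (chord-twoSided κ (inj₂ (F₃.inner l (sym (a-r₂ e)))))))

            -- Otherwise the circulation would live on the spanning trees of the branch sets, where
            -- only the zero circulation exists.
            some-crossing : ∀ {u v} → a u v ≡ true → ∃₂ λ u v → a u v ≡ true × r₁ u ≢ r₁ v
            some-crossing {u} {v} e with Fin.any? (λ u → Fin.any? (λ v → (a u v Bool.≟ true) ×-dec ¬? (r₁ u Fin.≟ r₁ v)))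
            ... | yes (x , y , r) = x , y , r
            ... | no none = ⊥-elim (adj-irr (F₁.flowless circ (chord-twoSided κ ∘ inj₁) inside known e) (a-adj e))
              where
              inside : ∀ {u v} → a u v ≡ true → r₁ u ≡ r₁ v
              inside {u} {v} e with r₁ u Fin.≟ r₁ v
              ... | yes p = p
              ... | no p = ⊥-elim (none (u , v , e , p))
              known : ∀ {u v} → a u v ≡ true → u ≢ v → (u , v) ∈ withinEdges ⊎ (v , u) ∈ withinEdges
              known e ne = ∈-within (a-adj e) (label-within (r₁-label (inside e)) ne)

            -- Two branch sets are joined by only one marked edge, so opposite arcs of the quotient
            -- would be its two darts, against asymmetry.
            simple : ∀ {u v u′ v′} → a u v ≡ true → a u′ v′ ≡ true → r₁ u ≢ r₁ v → r₁ u′ ≡ r₁ v → r₁ v′ ≡ r₁ u → ⊥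
            simple e e′ ne p q with a-marked e ne | a-marked e′ (λ s → ne (trans (sym q) (trans (sym s) p)))
            ... | i , j , i≢j , refl , refl | i′ , j′ , i′≢j′ , refl , refl
              with refl ← r₁-unique (proj₁ (end-ok i′≢j′)) (proj₁ (proj₂ (end-ok i≢j))) p
                 | refl ← r₁-unique (proj₁ (proj₂ (end-ok i′≢j′))) (proj₁ (end-ok i≢j)) q =
              true≢false e′ (Circulation.asymmetric circ e)

          private
            on-crossing : ∀ {i j} → i ≢ j → a (end i j) (end j i) ≡ true → crossing κ i j ≡ true
            on-crossing i≢j e = cong₂ _∧_ (cong not (==-≢ i≢j)) (oneSided-on κ e)

            ThreeCrossings : Set
            ThreeCrossings = ∃₂ λ i j → ∃₂ λ i′ j′ → ∃₂ λ i″ j″ →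
              crossing κ i j ≡ true × crossing κ i′ j′ ≡ true × crossing κ i″ j″ ≡ true ×
              ¬ (i′ ≡ i × j′ ≡ j) × ¬ (i″ ≡ i × j″ ≡ j) × ¬ (i″ ≡ i′ × j″ ≡ j′)

            collect : ∀ {u v u′ v′ u″ v″} → Marked u v → Marked u′ v′ → Marked u″ v″ →
              a u v ≡ true → a u′ v′ ≡ true → a u″ v″ ≡ true → r₁ u′ ≡ r₁ v → r₁ u″ ≡ r₁ v′ → r₁ u ≢ r₁ v′ → ThreeCrossings
            collect (i , j , i≢j , refl , refl) (i′ , j′ , i′≢j′ , refl , refl) (i″ , j″ , i″≢j″ , refl , refl) e e′ e″ p′ p″ d =
              i , j , i′ , j′ , i″ , j″ , on-crossing i≢j e , on-crossing i′≢j′ e′ , on-crossing i″≢j″ e″ ,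
              (λ (s , _) → i≢j (trans (sym s) i′≡j)) , (λ (s , _) → i≢j′ (trans (sym s) i″≡j′)) , (λ (s , _) → i′≢j′ (trans (sym s) i″≡j′))
              where
              i′≡j : i′ ≡ j
              i′≡j = r₁-unique (proj₁ (end-ok i′≢j′)) (proj₁ (proj₂ (end-ok i≢j))) p′
              i″≡j′ : i″ ≡ j′
              i″≡j′ = r₁-unique (proj₁ (end-ok i″≢j″)) (proj₁ (proj₂ (end-ok i′≢j′))) p″
              i≢j′ : i ≢ j′
              i≢j′ eq = d (r₁-branch (proj₁ (end-ok i≢j)) (trans (proj₁ (proj₂ (end-ok i′≢j′))) (cong just (sym eq))))

            crossings : (∃₂ λ u v → a u v ≡ true) → ThreeCrossings
            crossings (_ , _ , e₀) =
              let _ , _ , e , ne = some-crossing e₀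
                  _ , _ , _ , _ , e′ , e″ , p′ , p″ , c′ , c″ , d = threeArcs Fin._≟_ r₁ circ simple e ne
              in collect (a-marked e ne) (a-marked e′ c′) (a-marked e″ c″) e e′ e″ p′ p″ d

          threeCrossings : 3 ≤ total (crossing κ) + 3 * ⟦ twoSided κ ⟧
          threeCrossings = cases (oneSided? κ)
            where
            cases : Dec (∃₂ λ u v → a u v ≡ true) → 3 ≤ total (crossing κ) + 3 * ⟦ twoSided κ ⟧
            cases (no none) = ≤-trans (≤-reflexive (cong (λ t → 3 * ⟦ t ⟧) (sym (true-does (¬? (oneSided? κ)) none)))) (m≤n+m _ (total (crossing κ)))
            cases (yes one) = let _ , _ , _ , _ , _ , _ , c , c′ , c″ , d , d′ , d″ = crossings one in
              ≤-trans (three≤total (crossing κ) c c′ c″ d d′ d″) (m≤m+n _ _)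

        b : ℕ
        b = sum (λ κ → ⟦ twoSided κ ⟧)

        total-crossing : sum (λ κ → total (crossing κ)) ≡ 20
        total-crossing = begin
          sum (λ κ → sum (λ i → sum (λ j → ⟦ crossing κ i j ⟧))) ≡⟨ ∑-comm (λ κ i → sum (λ j → ⟦ crossing κ i j ⟧)) ⟩
          sum (λ i → sum (λ κ → sum (λ j → ⟦ crossing κ i j ⟧))) ≡⟨ sum-cong-≗ {5} (λ i → ∑-comm (λ κ j → ⟦ crossing κ i j ⟧)) ⟩
          sum₂ (λ i j → sum (λ κ → ⟦ crossing κ i j ⟧)) ≡⟨ sum₂-cong each ⟩
          total off ≡⟨⟩
          20 ∎
          where
          open ≡-Reasoning
          each : ∀ i j → sum (λ κ → ⟦ crossing κ i j ⟧) ≡ ⟦ off i j ⟧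
          each i j with off i j in e
          ... | true = trans (sum-on (end i j) (end j i)) (cong ⟦_⟧ (true-does (adj? (end i j) (end j i)) (proj₂ (proj₂ (end-ok (off-≢ i j e))))))
          ... | false = sum-zero {k}

        sum-3* : ∀ {m} (f : Fin m → ℕ) → sum (λ κ → 3 * f κ) ≡ 3 * sum f
        sum-3* {zero} f = refl
        sum-3* {suc m} f = trans (cong (3 * f zero +_) (sum-3* (f ∘ suc))) (sym (*-distribˡ-+ 3 (f zero) _))

        threeClasses : 3 * k ≤ 20 + 3 * b
        threeClasses = begin
          3 * k ≡⟨ cong (3 *_) (sum-one {k}) ⟨
          3 * sum {k} (λ _ → 1) ≡⟨ sum-3* {k} (λ _ → 1) ⟨
          sum {k} (λ _ → 3) ≤⟨ sum-mono threeCrossings ⟩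
          sum (λ κ → total (crossing κ) + 3 * ⟦ twoSided κ ⟧) ≡⟨ ∑-distrib-+ {k} _ _ ⟩
          sum (λ κ → total (crossing κ)) + sum (λ κ → 3 * ⟦ twoSided κ ⟧) ≡⟨ cong₂ _+_ total-crossing (sum-3* (λ κ → ⟦ twoSided κ ⟧)) ⟩
          20 + 3 * b ∎
          where open ≤-Reasoning

        -- Euler's formula after the removal of the chords. The 6 is the cyclomatic number of K₅:
        -- ten marked edges less the four classes spent on fusing the branch sets.
        arithmetic : ∀ {e₁ e₃ e x₁ x₃ k₁ k₂ k₃ f k i c n : ℕ} → e₁ + e₃ + 10 ≤ e → x₁ + n ≡ e₁ + k₁ → k₁ ≤ k₂ + 4 →
          x₃ + k₂ ≡ e₃ + k₃ → k₃ ≤ c → f ≤ k + (x₁ + x₃) → n + (f + i) ≡ e + 2 * c → c + 6 ≤ k + i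
        arithmetic {e₁} {e₃} {e} {x₁} {x₃} {k₁} {k₂} {k₃} {f} {k} {i} {c} {n} h₁ h₂ h₃ h₄ h₅ h₆ h₇ =
          +-cancelʳ-≤ (e₁ + e₃ + 4 + c) (c + 6) (k + i) (begin
            c + 6 + (e₁ + e₃ + 4 + c) ≡⟨ l₁ c e₁ e₃ ⟩
            e₁ + e₃ + 10 + 2 * c ≤⟨ +-monoˡ-≤ (2 * c) h₁ ⟩
            e + 2 * c ≡⟨ h₇ ⟨
            n + (f + i) ≤⟨ +-monoʳ-≤ n (+-monoˡ-≤ i h₆) ⟩
            n + (k + (x₁ + x₃) + i) ≡⟨ l₂ n k x₁ x₃ i ⟩
            x₁ + n + (x₃ + (k + i)) ≡⟨ cong (_+ (x₃ + (k + i))) h₂ ⟩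
            e₁ + k₁ + (x₃ + (k + i)) ≤⟨ +-monoˡ-≤ (x₃ + (k + i)) (+-monoʳ-≤ e₁ h₃) ⟩
            e₁ + (k₂ + 4) + (x₃ + (k + i)) ≡⟨ l₃ e₁ k₂ x₃ k i ⟩
            x₃ + k₂ + (e₁ + 4 + (k + i)) ≡⟨ cong (_+ (e₁ + 4 + (k + i))) h₄ ⟩
            e₃ + k₃ + (e₁ + 4 + (k + i)) ≤⟨ +-monoˡ-≤ (e₁ + 4 + (k + i)) (+-monoʳ-≤ e₃ h₅) ⟩
            e₃ + c + (e₁ + 4 + (k + i)) ≡⟨ l₄ e₃ c e₁ k i ⟩
            k + i + (e₁ + e₃ + 4 + c) ∎)
          where
          open ≤-Reasoning
          l₁ : ∀ c e₁ e₃ → c + 6 + (e₁ + e₃ + 4 + c) ≡ e₁ + e₃ + 10 + 2 * c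
          l₁ = solve-∀
          l₂ : ∀ n k x₁ x₃ i → n + (k + (x₁ + x₃) + i) ≡ x₁ + n + (x₃ + (k + i))
          l₂ = solve-∀
          l₃ : ∀ e₁ k₂ x₃ k i → e₁ + (k₂ + 4) + (x₃ + (k + i)) ≡ x₃ + k₂ + (e₁ + 4 + (k + i))
          l₃ = solve-∀
          l₄ : ∀ e₃ c e₁ k i → e₃ + c + (e₁ + 4 + (k + i)) ≡ k + i + (e₁ + e₃ + 4 + c)
          l₄ = solve-∀

        manyClasses : components + 6 ≤ k + length isolated
        manyClasses = arithmetic {length withinEdges} {length otherEdges} {length edges} {length F₁.chords} {length F₃.chords}
          {F₁.size} {C₂.size} {F₃.size} {faces} {k} {length isolated} {components} {n}
          edge-split F₁.count C₂.size-≤ F₃.count size₃-≤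
          (≤-trans D.size-≤ (+-monoʳ-≤ k (≤-trans (length-sides chords) (≤-reflexive (length-++ F₁.chords)))))
          euler

      noK₅ : ⊥
      noK₅ with Fin.any? (λ κ → twoSided κ Bool.≟ false)
      ... | yes (κ , f) = 1+n≰n (≤-trans (≤-trans (≤-reflexive (lemma b)) (*-monoʳ-≤ 3 b+7≤k)) threeClasses)
        where
        lemma : ∀ b → suc (20 + 3 * b) ≡ 3 * (b + 7)
        lemma = solve-∀
        shift : ∀ b i → b + 7 + i ≡ suc (b + i) + 6
        shift = solve-∀
        -- The seventh class comes from the strict bound: a class that is not two-sided shares its
        -- component with no two-sided one.
        b+7≤k : b + 7 ≤ k
        b+7≤k = +-cancelʳ-≤ (length isolated) (b + 7) k (≤-trans (≤-reflexive (shift b _))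
                  (≤-trans (+-monoˡ-≤ 6 (components-bound-< component-count κ f)) manyClasses))
      -- If all classes are two-sided, classes and isolated vertices together do not outnumber the
      -- components, against a surplus of six.
      ... | no none = 1+n≰n (≤-trans (s≤s (≤-trans (≤-reflexive (cong (_+ length isolated) (sym all))) (components-bound component-count)))
                        (≤-trans (≤-trans (s≤s (m≤m+n components 5)) (≤-reflexive (sym (+-suc components 5)))) manyClasses))
        where
        ¬false : ∀ {x} → ¬ x ≡ false → x ≡ true
        ¬false {true} _ = refl
        ¬false {false} p = ⊥-elim (p refl)
        all : b ≡ k
        all = trans (sum-cong-≗ {k} (λ κ → cong ⟦_⟧ (¬false (λ e → none (κ , e))))) (sum-one {k})

open Embeddings

-- From weights to feedback vertex sets and rational bounds

open import Data.Integer as ℤ using (+_)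
import Data.Integer.Properties as ℤ
open import Data.Rational using (_≤_; _/_)
import Data.Rational.Properties as ℚ
import Data.Rational.Unnormalised as ℚᵘ
import Data.Rational.Unnormalised.Properties as ℚᵘ
open import Data.Fin.Subset using (∣_∣; _∉_)
open import Data.Vec using (tabulate)
open import Data.Vec.Properties using (lookup∘tabulate; lookup⇒[]=)

module _ {n : ℕ} (G : OrientedGraph n) where

  open OrientedGraph G

  digraph : Digraph n
  digraph = record
    { alive = λ _ → true
    ; arc = λ u v → does (u ⟶? v)
    ; tail-alive = λ _ → refl
    ; head-alive = λ _ → refl
    ; asym = λ {u} {v} e → ≢true λ e′ → no-digons (does-true (u ⟶? v) e) (does-true (v ⟶? u) e′)
    }

  weight-digraph : Digraph.weight digraph ≡ 2 ℕ.* n ℕ.+ length arcs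
  weight-digraph = cong₂ (λ a b → 2 ℕ.* a ℕ.+ b) (sum-one {n}) (sym (length-filter-pairs (uncurry _⟶?_)))

  open Graph underlying using (Adj; adj?; edges)

  edge⇒adj : ∀ {u v} → Digraph.Edge digraph u v → Adj u v
  edge⇒adj {u} {v} = Sum.map (does-true (u ⟶? v)) (does-true (v ⟶? u))

  planar⇒noK₅ : Planar G → ¬ CompleteMinor 5 digraph
  planar⇒noK₅ P M = noK₅ underlying P branch
    (λ i≢j → let u , v , p , q , e = touching i≢j in u , v , p , q , edge⇒adj e)
    (λ p q → Star.map (λ (e , r) → edge⇒adj e , r) (connected p q))
    where open CompleteMinor M

  -- Without digons every edge carries exactly one arc; both sides are compared through the number
  -- of darts.
  arcs≡edges : length arcs ≡ length edges
  arcs≡edges = ℕ.*-cancelˡ-≡ (length arcs) (length edges) 2 (begin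
    2 ℕ.* length arcs ≡⟨ cong (length arcs ℕ.+_) (ℕ.+-identityʳ _) ⟩
    length arcs ℕ.+ length arcs ≡⟨ cong₂ ℕ._+_ count (trans count (sym (total-comm arc))) ⟩
    total arc ℕ.+ total (λ u v → arc v u) ≡⟨ sum₂-+ (λ u v → ⟦ arc u v ⟧) (λ u v → ⟦ arc v u ⟧) ⟨
    sum₂ (λ u v → ⟦ arc u v ⟧ ℕ.+ ⟦ arc v u ⟧) ≡⟨ sum₂-cong pointwise ⟩
    total (λ u v → does (adj? u v)) ≡⟨ dartCount underlying ⟩
    length edges ℕ.+ length edges ≡⟨ cong (length edges ℕ.+_) (ℕ.+-identityʳ _) ⟨
    2 ℕ.* length edges ∎)
    where
    open ≡-Reasoning
    arc : Fin n → Fin n → Bool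
    arc u v = does (u ⟶? v)
    count : length arcs ≡ total arc
    count = length-filter-pairs (uncurry _⟶?_)
    pointwise : ∀ u v → ⟦ arc u v ⟧ ℕ.+ ⟦ arc v u ⟧ ≡ ⟦ does (adj? u v) ⟧
    pointwise u v with u ⟶? v | v ⟶? u
    ... | yes p | yes q = ⊥-elim (no-digons p q)
    ... | yes _ | no _ = refl
    ... | no _ | yes _ = refl
    ... | no _ | no _ = refl

  module _ (S : Fin n → Bool) (rank : Fin n → ℕ)
    (increasing : ∀ {u v} → does (u ⟶? v) ≡ true → S u ≡ false → S v ≡ false → rank u ℕ.< rank v) where

    private
      outside : ∀ {v} → v ∉ tabulate S → S v ≡ false
      outside {v} v∉ = ≢true λ e → v∉ (lookup⇒[]= v (tabulate S) (trans (lookup∘tabulate S v) e))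

      climb : ∀ {u} vs {w} → Linked _⟶_ (u ∷ vs ∷ʳ w) → All (_∉ tabulate S) (u ∷ vs) → w ∉ tabulate S → rank u ℕ.< rank w
      climb {u} [] {w} (e ∷ [-]) (u∉ ∷ []) w∉ = increasing (true-does (u ⟶? w) e) (outside u∉) (outside w∉)
      climb {u} (v ∷ vs) (e ∷ l) (u∉ ∷ v∉ ∷ vs∉) w∉ =
        ℕ.<-trans (increasing (true-does (u ⟶? v) e) (outside u∉) (outside v∉)) (climb vs l (v∉ ∷ vs∉) w∉)

    -- Along a directed cycle that avoids the set, the rank would increase strictly and yet return
    -- to its initial value.
    ranked⇒FVS : IsFeedbackVertexSet G (tabulate S)
    ranked⇒FVS (v ∷ vs , (_ , l) , (v∉ ∷ vs∉)) = ℕ.<-irrefl refl (climb vs l (v∉ ∷ vs∉) v∉)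

  ∣tabulate∣ : ∀ {m} (S : Fin m → Bool) → ∣ tabulate S ∣ ≡ sum (λ v → ⟦ S v ⟧)
  ∣tabulate∣ {zero} S = refl
  ∣tabulate∣ {suc m} S with S zero
  ... | true = cong suc (∣tabulate∣ (S ∘ suc))
  ... | false = ∣tabulate∣ (S ∘ suc)

  fv-bound : Planar G → 9 ℕ.* fv G ℕ.≤ 2 ℕ.* n ℕ.+ length arcs
  fv-bound P = ℕ.≤-trans (ℕ.*-monoʳ-≤ 9 (fv-minimal G (tabulate S) (ranked⇒FVS S rank increasing)))
    (subst₂ (λ s w → 9 ℕ.* s ℕ.≤ w) (sym (∣tabulate∣ S)) weight-digraph le)
    where
    B : Bounded digraph (Digraph.weight digraph)
    B = bounded digraph (planar⇒noK₅ P)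
    S = proj₁ B
    rank = proj₁ (proj₂ B)
    increasing = proj₁ (proj₂ (proj₂ B))
    le = proj₂ (proj₂ (proj₂ B))

/-mono : ∀ a z → (+ a) ℤ.* (+ 9) ℤ.≤ z → (+ a) / 1 ≤ z / 9
-- `mkℚᵘ` takes the denominator minus one, hence the 8 here and the 0 below.
/-mono a z le = ℚ.toℚᵘ-cancel-≤ (ℚᵘ.≤-respʳ-≃ (ℚᵘ.≃-sym (ℚ.toℚᵘ-fromℚᵘ (ℚᵘ.mkℚᵘ z 8)))
  (ℚᵘ.≤-respˡ-≃ (ℚᵘ.≃-sym (ℚ.toℚᵘ-fromℚᵘ (ℚᵘ.mkℚᵘ (+ a) 0)))
    (ℚᵘ.*≤* (subst ((+ a) ℤ.* (+ 9) ℤ.≤_) (sym (ℤ.*-identityʳ z)) le))))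

pos-bound : ∀ a b → 9 ℕ.* a ℕ.≤ b → (+ a) ℤ.* (+ 9) ℤ.≤ + b
pos-bound a b le = subst (ℤ._≤ + b) (trans (cong +_ (ℕ.*-comm 9 a)) (ℤ.pos-* a 9)) (ℤ.+≤+ le)

-- If e ≤ n, then 9k + 6 ≤ 3n + 6, which is at most 5n from n = 3 on. For n = 2 the bound 9k ≤ 4 + 2
-- forces k = 0.
shifted : ∀ {n k e} → 2 ℕ.≤ n → 9 ℕ.* k ℕ.≤ 2 ℕ.* n ℕ.+ e → (e ℕ.+ 6 ℕ.≤ 3 ℕ.* n ⊎ e ℕ.≤ n) → 9 ℕ.* k ℕ.+ 6 ℕ.≤ 5 ℕ.* n
shifted {n} {k} {e} _ h (inj₁ le) = begin
  9 ℕ.* k ℕ.+ 6 ≤⟨ ℕ.+-monoˡ-≤ 6 h ⟩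
  2 ℕ.* n ℕ.+ e ℕ.+ 6 ≡⟨ ℕ.+-assoc (2 ℕ.* n) e 6 ⟩
  2 ℕ.* n ℕ.+ (e ℕ.+ 6) ≤⟨ ℕ.+-monoʳ-≤ (2 ℕ.* n) le ⟩
  2 ℕ.* n ℕ.+ 3 ℕ.* n ≡⟨ ℕ.*-distribʳ-+ n 2 3 ⟨
  5 ℕ.* n ∎
  where open ℕ.≤-Reasoning
shifted {1} (s≤s ()) _ (inj₂ _)
shifted {2} {zero} _ _ (inj₂ _) = ℕ.m≤m+n 6 4
shifted {2} {suc k} {e} _ h (inj₂ le) =
  ⊥-elim (ℕ.<⇒≱ (ℕ.m≤m+n 7 2) (ℕ.≤-trans (ℕ.≤-trans (ℕ.m≤m*n 9 (suc k)) h) (ℕ.+-monoʳ-≤ 4 le)))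
shifted {suc (suc (suc n))} {k} {e} _ h (inj₂ le) = begin
  9 ℕ.* k ℕ.+ 6 ≤⟨ ℕ.+-mono-≤ (ℕ.≤-trans h (ℕ.+-monoʳ-≤ (2 ℕ.* N) le)) (ℕ.*-monoʳ-≤ 2 (ℕ.m≤m+n 3 n)) ⟩
  2 ℕ.* N ℕ.+ N ℕ.+ 2 ℕ.* N ≡⟨ lemma N ⟩
  5 ℕ.* N ∎
  where
  open ℕ.≤-Reasoning
  N : ℕ
  N = 3 ℕ.+ n
  lemma : ∀ m → 2 ℕ.* m ℕ.+ m ℕ.+ 2 ℕ.* m ≡ 5 ℕ.* m
  lemma = solve-∀

ratio-bounds : ∀ n k e → 9 ℕ.* k ℕ.≤ 2 ℕ.* n ℕ.+ e → (e ℕ.+ 6 ℕ.≤ 3 ℕ.* n ⊎ e ℕ.≤ n) →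
  ((+ k) / 1 ≤ (+ (2 ℕ.* n ℕ.+ e)) / 9) × (2 ℕ.≤ n → (+ k) / 1 ≤ ((+ 5) ℤ.* (+ n) ℤ.- (+ 6)) / 9)
ratio-bounds n k e bound edges = /-mono k _ (pos-bound k _ bound) , λ 2≤n → /-mono k _ (second 2≤n)
  where
  module _ (2≤n : 2 ℕ.≤ n) where
    le : 9 ℕ.* k ℕ.+ 6 ℕ.≤ 5 ℕ.* n
    le = shifted {n} {k} {e} 2≤n bound edges
    difference : (+ 5) ℤ.* (+ n) ℤ.- (+ 6) ≡ + (5 ℕ.* n ℕ.∸ 6)
    difference = trans (cong (ℤ._- (+ 6)) (sym (ℤ.pos-* 5 n)))
      (trans (ℤ.m-n≡m⊖n (5 ℕ.* n) 6) (ℤ.⊖-≥ (ℕ.≤-trans (ℕ.m≤n+m 6 (9 ℕ.* k)) le)))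
    second : (+ k) ℤ.* (+ 9) ℤ.≤ (+ 5) ℤ.* (+ n) ℤ.- (+ 6)
    second = subst ((+ k) ℤ.* (+ 9) ℤ.≤_) (sym difference) (pos-bound k _
      (ℕ.≤-trans (ℕ.≤-reflexive (sym (ℕ.m+n∸n≡m (9 ℕ.* k) 6))) (ℕ.∸-monoˡ-≤ 6 le)))

corollary9 : ∀ {n : ℕ} (G : OrientedGraph n) → Planar G →
    let m = length (OrientedGraph.arcs G) in
    ((+ fv G) / 1 ≤ (+ (2 ℕ.* n ℕ.+ m)) / 9)
    × (2 ℕ.≤ n → (+ fv G) / 1 ≤ ((+ 5) ℤ.* (+ n) ℤ.- (+ 6)) / 9)
corollary9 {n} G P = ratio-bounds n (fv G) (length (OrientedGraph.arcs G)) (fv-bound G P)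
  (subst (λ e → e ℕ.+ 6 ℕ.≤ 3 ℕ.* n ⊎ e ℕ.≤ n) (sym (arcs≡edges G)) (edge-bound (OrientedGraph.underlying G) P))
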